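{- Let $\mathbb{S}$ be any surface and $n\geq 1$ an integer. There exists a 2-to-1 correspondence between the set of rooted bipartite quadrangulations on $\mathbb{S}$ with $n$ faces carrying a pointed vertex $v_0$, and the set of rooted maps on $\mathbb{S}$ with $n$ edges carrying a pointed vertex $\widetilde{v_0}$, with the following property: if a pointed quadrangulation $(\mathfrak{q},v_0)$ has, for some $i\geq 1$, exactly $n_i$ non-extremal vertices at distance $i$ from $v_0$, and has exactly $k$ extremal vertices, then its associated pointed map has exactly $n_i$ vertices at distance $i$ from $\widetilde{v_0}$ and exactly $k$ faces.
   Context: A surface is a compact connected 2-dimensional manifold up to homeomorphism. A map is an embedding of a finite connected graph (loops and multiple edges allowed) into a surface such that each face is simply connected, considered up to homeomorphism; it is rooted if it carries a distinguished half-edge with a distinguished side. A quadrangulation is a map all of whose faces have degree 4; it is bipartite if its vertices can be properly 2-colored. Distances are graph distances. In a map $\mathcal{M}$ with pointed vertex $v_0$, a vertex $u$ is extremal if $d_{\mathcal{M}}(u,v_0)>d_{\mathcal{M}}(v,v_0)$ for every vertex $v$ adjacent to $u$, and non-extremal otherwise. A 2-to-1 correspondence means a surjection from the first set onto the second in which every element of the second set has exactly two preimages. -}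

module Defs where

open import Data.Nat using (ℕ; zero; suc; _+_; _*_; _≤_; _<_)
open import Data.Integer as ℤ using (ℤ; +_)
open import Data.Fin using (Fin)
open import Data.Bool using (Bool; true; false)
open import Data.Product using (Σ; Σ-syntax; ∃; ∃-syntax; _×_; _,_)
open import Data.Sum using (_⊎_)
open import Relation.Binary.PropositionalEquality using (_≡_; _≢_)
open import Relation.Binary.Construct.Closure.ReflexiveTransitive using (Star)
open import Relation.Nullary using (¬_)
open import Data.Unit using (⊤)

-- Surfaces, via the classification theorem:
-- the orientable surface of genus g, or the non-orientable surface
-- of genus h+1 (connected sum of h+1 projective planes).

data Surface : Set where
  orientable    : ℕ → Surface
  nonorientable : ℕ → Surface   -- nonorientable h has genus (suc h)

eulerChar : Surface → ℤ
eulerChar (orientable g)    = + 2 ℤ.- + (2 * g)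
eulerChar (nonorientable h) = + 2 ℤ.- + (suc h)

ClassCount : {N : ℕ} → (Fin N → Fin N → Set) → (Fin N → Set) → ℕ → Set
ClassCount {N} _~_ P k =
  Σ[ rep ∈ (Fin k → Fin N) ]
    ((∀ i → P (rep i)) ×
     (∀ i j → rep i ~ rep j → i ≡ j) ×
     (∀ x → P x → ∃[ i ] (x ~ rep i)))

-- Maps (without boundary) on surfaces, as combinatorial maps:
-- a finite set of flags with three fixed-point-free involutions
-- α₀ (change vertex), α₁ (change edge), α₂ (change face), such that
-- α₀α₂ is a fixed-point-free involution, with transitive monodromy
-- group (connectedness).

record CMap : Set where
  field
    N  : ℕ
    α₀ α₁ α₂ : Fin N → Fin N
    inv₀ : ∀ x → α₀ (α₀ x) ≡ x
    inv₁ : ∀ x → α₁ (α₁ x) ≡ x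
    inv₂ : ∀ x → α₂ (α₂ x) ≡ x
    fpf₀ : ∀ x → α₀ x ≢ x
    fpf₁ : ∀ x → α₁ x ≢ x
    fpf₂ : ∀ x → α₂ x ≢ x
    comm₀₂ : ∀ x → α₀ (α₂ x) ≡ α₂ (α₀ x)
    fpf₀₂  : ∀ x → α₀ (α₂ x) ≢ x

  AllStep : Fin N → Fin N → Set
  AllStep x y = (y ≡ α₀ x) ⊎ (y ≡ α₁ x) ⊎ (y ≡ α₂ x)

  VStep : Fin N → Fin N → Set
  VStep x y = (y ≡ α₁ x) ⊎ (y ≡ α₂ x)

  EStep : Fin N → Fin N → Set
  EStep x y = (y ≡ α₀ x) ⊎ (y ≡ α₂ x)

  FStep : Fin N → Fin N → Set
  FStep x y = (y ≡ α₀ x) ⊎ (y ≡ α₁ x)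

  SameV SameE SameF : Fin N → Fin N → Set
  SameV = Star VStep
  SameE = Star EStep
  SameF = Star FStep

  NumVertices NumEdges NumFaces : ℕ → Set
  NumVertices = ClassCount SameV (λ _ → ⊤)
  NumEdges    = ClassCount SameE (λ _ → ⊤)
  NumFaces    = ClassCount SameF (λ _ → ⊤)

  Orientable : Set
  Orientable = Σ[ c ∈ (Fin N → Bool) ]
    ((∀ x → c (α₀ x) ≢ c x) × (∀ x → c (α₁ x) ≢ c x) × (∀ x → c (α₂ x) ≢ c x))

  -- face-rotation φ = α₀ ∘ α₁ ; the degree of the face containing x
  -- is the length of the φ-cycle of x
  φ : Fin N → Fin N
  φ x = α₀ (α₁ x)

  φ^ : ℕ → Fin N → Fin N
  φ^ zero    x = x
  φ^ (suc k) x = φ (φ^ k x)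

  FaceDegree : Fin N → ℕ → Set
  FaceDegree x d = (0 < d) × (φ^ d x ≡ x) × (∀ k → 0 < k → k < d → φ^ k x ≢ x)

  IsQuadrangulation : Set
  IsQuadrangulation = ∀ x → FaceDegree x 4

  IsBipartite : Set
  IsBipartite = Σ[ c ∈ (Fin N → Bool) ]
    ((∀ x → c (α₁ x) ≡ c x) × (∀ x → c (α₂ x) ≡ c x) × (∀ x → c (α₀ x) ≢ c x))

  -- walks in the underlying graph between the vertex of x and the
  -- vertex of y, of a given length (an edge step goes from a flag x'
  -- to the other end α₀ x' of its edge)
  data Walk : Fin N → Fin N → ℕ → Set where
    here  : ∀ {x y} → SameV x y → Walk x y 0
    there : ∀ {x x' y k} → SameV x x' → Walk (α₀ x') y k → Walk x y (suc k)

  Dist : Fin N → Fin N → ℕ → Set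
  Dist x y d = Walk x y d × (∀ j → Walk x y j → d ≤ j)

  Adjacent : Fin N → Fin N → Set
  Adjacent x y = Walk x y 1

  Extremal : Fin N → Fin N → Set
  Extremal v₀ u = ∀ v i j → Adjacent u v → Dist u v₀ i → Dist v v₀ j → j < i

Connected : CMap → Set
Connected M = ∀ x y → Star AllStep x y
  where open CMap M

OnSurface : CMap → Surface → Set
OnSurface M S = OrientOK S ×
  Σ[ v ∈ ℕ ] Σ[ e ∈ ℕ ] Σ[ f ∈ ℕ ]
    (NumVertices v × NumEdges e × NumFaces f ×
     ((+ v ℤ.- + e) ℤ.+ + f ≡ eulerChar S))
  where
  open CMap M
  OrientOK : Surface → Set
  OrientOK (orientable _)    = Orientable
  OrientOK (nonorientable _) = ¬ Orientable

-- Rooted pointed maps: a connected map with a root flag (half-edge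
-- with a distinguished side) and a pointed vertex (given by any flag
-- incident to it; flags at the same vertex give the same pointed map).

record RPMap : Set where
  field
    map   : CMap
    conn  : Connected map
    root  : Fin (CMap.N map)
    point : Fin (CMap.N map)
  open CMap map public

_≅_ : RPMap → RPMap → Set
A ≅ B =
  Σ[ f ∈ (Fin A.N → Fin B.N) ] Σ[ g ∈ (Fin B.N → Fin A.N) ]
    ((∀ x → g (f x) ≡ x) × (∀ y → f (g y) ≡ y) ×
     (∀ x → f (A.α₀ x) ≡ B.α₀ (f x)) ×
     (∀ x → f (A.α₁ x) ≡ B.α₁ (f x)) ×
     (∀ x → f (A.α₂ x) ≡ B.α₂ (f x)) ×
     (f A.root ≡ B.root) ×
     B.SameV (f A.point) B.point)
  where
  module A = RPMap A
  module B = RPMap B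

PointedQuad : Surface → ℕ → Set
PointedQuad S n = Σ[ q ∈ RPMap ]
  (RPMap.IsQuadrangulation q × RPMap.IsBipartite q ×
   OnSurface (RPMap.map q) S × RPMap.NumFaces q n)

PointedMap : Surface → ℕ → Set
PointedMap S n = Σ[ m ∈ RPMap ] (OnSurface (RPMap.map m) S × RPMap.NumEdges m n)

-- 2-to-1 correspondence between isomorphism classes, given by a
-- map Φ on representatives compatible with isomorphism.

TwoToOne : {A B : Set} → (A → A → Set) → (B → B → Set) → (A → B) → Set
TwoToOne {A} {B} _≈A_ _≈B_ Φ =
  (∀ a a' → a ≈A a' → Φ a ≈B Φ a') ×
  (∀ b → Σ[ a₁ ∈ A ] Σ[ a₂ ∈ A ]
     (Φ a₁ ≈B b × Φ a₂ ≈B b × ¬ (a₁ ≈A a₂) ×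
      (∀ a → Φ a ≈B b → (a ≈A a₁) ⊎ (a ≈A a₂))))

{-# OPTIONS --safe #-}
-- Label the vertices of a pointed bipartite quadrangulation by their distance to the pointed
-- vertex. The map has an edge i–i in every face labelled (i, i+1, i, i+1), and in every face
-- (i, i+1, i+2, i+1) an edge parallel to one of the two edges (i, i+1) of that face. Without a
-- global orientation that choice is made as follows. The curves at level i + 1/2, which separate
-- labels ≤ i from labels > i, form disjoint loops, and orienting every loop in an arbitrary way
-- determines all choices. Half of the flags of the quadrangulation, those at the closer end of
-- their edge, are the flags of the map; on these the loops, and the involutions around vertices,
-- are the same for both objects, while the rest of either structure is a bijection between
-- falling and rising flags, the two bijections differing by a twist by the orientation.
--
-- Orienting each loop by the first flag of it that is reached when exploring the quadrangulation
-- from its root gives the correspondence. It is injective on isomorphism classes, for two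
-- preimages of one map are explored in the same way step by step. Exploring the map instead
-- gives an injection in the other direction, and as maps of a given size are finitely many
-- both injections are bijections. The factor two comes from the end of the root edge at which
-- the quadrangulation is rooted.
module Submission where

open import Defs
open import Data.Bool using (Bool; true; false; not; if_then_else_)
open import Data.Bool.Properties using (not-involutive; not-injective)
open import Data.Empty using (⊥-elim)
open import Data.Fin using (Fin; zero; suc; toℕ; fromℕ<; _↑ˡ_; _↑ʳ_; splitAt; join; combine; remQuot; funToFin; finToFun)
open import Data.Fin.Properties
  using (_≟_; any?; all?; pigeonhole; toℕ-injective; toℕ<n; toℕ-fromℕ<; splitAt-↑ˡ; splitAt-↑ʳ; join-splitAt;
         combine-remQuot; combine-injective; cantor-schröder-bernstein; finToFun-funToFin)
open import Data.Integer as ℤ using (+_)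
import Data.Integer.Properties as ℤ
open import Data.Integer.Solver using (module +-*-Solver)
open import Data.List using (List; []; _∷_; allFin)
open import Data.List.Membership.Propositional using (_∈_)
open import Data.List.Membership.Propositional.Properties using (∈-allFin)
import Data.List.Relation.Unary.Any as Any
open import Data.Nat using (ℕ; zero; suc; _+_; _*_; _^_; _∸_; _≤_; _<_; z≤n; s≤s)
import Data.Nat.Properties as ℕ
open import Data.Product using (Σ-syntax; ∃-syntax; _×_; _,_; proj₁; proj₂)
open import Data.Sum using (_⊎_; inj₁; inj₂; [_,_]; [_,_]′)
open import Data.Unit using (⊤; tt)
open import Function using (_∘_; id)
open import Relation.Binary.Construct.Closure.ReflexiveTransitive using (Star; ε; _◅_; _◅◅_)
import Relation.Binary.Construct.Closure.ReflexiveTransitive as Star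
open import Relation.Binary.PropositionalEquality
  using (_≡_; _≢_; refl; sym; trans; cong; cong₂; subst; subst₂)
open import Relation.Binary.PropositionalEquality using () renaming (trans to infixr 5 _∙_)
open import Relation.Nullary using (Dec; yes; no; ¬_; does)
open import Relation.Nullary.Decidable using (map′; _×-dec_; _⊎-dec_; ¬?; _→-dec_; dec-true; dec-false)

-- Why the twist works: the rising flags of a loop come in a cyclic order, and two pairings of
-- neighbours alternate along it, `τ` inside a face and `seg` around an upper vertex. For a
-- quadrangulation the bijection `z` from falls to rises carries `v` to `seg` and `τ` to `τ`; for a
-- map the bijection `t` carries `v` to `τ` and `τ` to `seg`. Moving every rising flag one place
-- along its loop exchanges the two pairings, so `z` followed by this shift has the properties of
-- `t`, and the shift backwards undoes it.
--
-- The obstacle is the choice of orientation. It must be invariant under isomorphism, but exploring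
-- a quadrangulation and exploring the map made from it use different generators and may orient the
-- loops differently, so the two constructions are not claimed to be inverse to each other.
-- Injectivity can still be proved: a step that enters a new loop arrives at its first visited flag,
-- where the orientation is prescribed, so the result of the step is known before the orientation of
-- that loop has been compared.

-- Finite sets and involutions

-- Reachability through intermediate points in a list, as in Warshall's algorithm.
module Reachability {N : ℕ} (R : Fin N → Fin N → Set) (R? : ∀ x y → Dec (R x y)) where

  Via : List (Fin N) → Fin N → Fin N → Set
  Via []       x y = x ≡ y ⊎ R x y
  Via (m ∷ ms) x y = Via ms x y ⊎ (Via ms x m × Via ms m y)

  via? : ∀ ms x y → Dec (Via ms x y)
  via? []       x y = (x ≟ y) ⊎-dec R? x y
  via? (m ∷ ms) x y = via? ms x y ⊎-dec (via? ms x m ×-dec via? ms m y)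

  via⇒star : ∀ ms {x y} → Via ms x y → Star R x y
  via⇒star []       (inj₁ refl)    = ε
  via⇒star []       (inj₂ r)       = r ◅ ε
  via⇒star (m ∷ ms) (inj₁ p)       = via⇒star ms p
  via⇒star (m ∷ ms) (inj₂ (p , q)) = via⇒star ms p ◅◅ via⇒star ms q

  via-base : ∀ ms {x y} → x ≡ y ⊎ R x y → Via ms x y
  via-base []       p = p
  via-base (m ∷ ms) p = inj₁ (via-base ms p)

  -- When both halves pass through the head of the list, the detour between the two passages is cut
  -- out, so one passage is enough.
  via-trans : ∀ ms {x m y} → m ∈ ms → Via ms x m → Via ms m y → Via ms x y
  via-trans (_ ∷ ms) (Any.here refl) (inj₁ p)       (inj₁ q)       = inj₂ (p , q)
  via-trans (_ ∷ ms) (Any.here refl) (inj₁ p)       (inj₂ (_ , q)) = inj₂ (p , q)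
  via-trans (_ ∷ ms) (Any.here refl) (inj₂ (p , _)) (inj₁ q)       = inj₂ (p , q)
  via-trans (_ ∷ ms) (Any.here refl) (inj₂ (p , _)) (inj₂ (_ , q)) = inj₂ (p , q)
  via-trans (_ ∷ ms) (Any.there m∈) (inj₁ p) (inj₁ q) = inj₁ (via-trans ms m∈ p q)
  via-trans (_ ∷ ms) (Any.there m∈) (inj₁ p) (inj₂ (q , q′)) = inj₂ (via-trans ms m∈ p q , q′)
  via-trans (_ ∷ ms) (Any.there m∈) (inj₂ (p , p′)) (inj₁ q) = inj₂ (p , via-trans ms m∈ p′ q)
  via-trans (_ ∷ ms) (Any.there m∈) (inj₂ (p , _)) (inj₂ (_ , q)) = inj₂ (p , q)

  star⇒via : ∀ {x y} → Star R x y → Via (allFin N) x y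
  star⇒via ε = via-base (allFin N) (inj₁ refl)
  star⇒via (r ◅ rs) =
    via-trans (allFin N) (∈-allFin _) (via-base (allFin N) (inj₂ r)) (star⇒via rs)

  opaque
    star? : ∀ x y → Dec (Star R x y)
    star? x y = map′ (via⇒star (allFin N)) star⇒via (via? (allFin N) x y)

least : {P : ℕ → Set} → (∀ k → Dec (P k)) → ∀ k → P k →
        Σ[ l ∈ ℕ ] (l ≤ k × P l × (∀ j → j < l → ¬ P j))
least P? zero p = zero , z≤n , p , λ _ ()
least {P} P? (suc k) p with P? zero
... | yes p₀ = zero , z≤n , p₀ , λ _ ()
... | no ¬p₀ with least (λ j → P? (suc j)) k p
... | l , l≤k , pl , min = suc l , s≤s l≤k , pl , min′
  where
  min′ : ∀ j → j < suc l → ¬ P j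
  min′ zero    _         = ¬p₀
  min′ (suc j) (s≤s j<l) = min j j<l

record Enumeration {N : ℕ} (P : Fin N → Set) : Set where
  field
    size    : ℕ
    elt     : Fin size → Fin N
    holds   : ∀ i → P (elt i)
    elt-inj : ∀ i j → elt i ≡ elt j → i ≡ j
    find    : ∀ x → P x → ∃[ i ] elt i ≡ x

suc-inj : ∀ {n} {i j : Fin n} → Fin.suc i ≡ suc j → i ≡ j
suc-inj refl = refl

opaque
  enumerate : ∀ {N} {P : Fin N → Set} → (∀ x → Dec (P x)) → Enumeration P
  enumerate {zero} P? = record
    { size = 0 ; elt = λ () ; holds = λ () ; elt-inj = λ () ; find = λ () }
  enumerate {suc N} {P} P? with enumerate (λ x → P? (suc x)) | P? zero
  ... | e | no ¬p₀ = record
    { size = size ; elt = suc ∘ elt ; holds = holds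
    ; elt-inj = λ i j eq → elt-inj i j (suc-inj eq)
    ; find = find′ }
    where
    open Enumeration e
    find′ : ∀ x → P x → ∃[ i ] suc (elt i) ≡ x
    find′ zero    p = ⊥-elim (¬p₀ p)
    find′ (suc x) p = proj₁ (find x p) , cong suc (proj₂ (find x p))
  ... | e | yes p₀ = record
    { size = suc size ; elt = elt′ ; holds = holds′ ; elt-inj = inj′ ; find = find′ }
    where
    open Enumeration e
    elt′ : Fin (suc size) → Fin (suc N)
    elt′ zero    = zero
    elt′ (suc i) = suc (elt i)
    holds′ : ∀ i → P (elt′ i)
    holds′ zero    = p₀
    holds′ (suc i) = holds i
    inj′ : ∀ i j → elt′ i ≡ elt′ j → i ≡ j
    inj′ zero    zero    _  = refl
    inj′ (suc i) (suc j) eq = cong suc (elt-inj i j (suc-inj eq))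
    find′ : ∀ x → P x → ∃[ i ] elt′ i ≡ x
    find′ zero    p = zero , refl
    find′ (suc x) p = suc (proj₁ (find x p)) , cong suc (proj₂ (find x p))

iter : {A : Set} → (A → A) → ℕ → A → A
iter f zero    x = x
iter f (suc k) x = iter f k (f x)

iter-comm : {A : Set} (f : A → A) → ∀ k x → iter f k (f x) ≡ f (iter f k x)
iter-comm f zero    x = refl
iter-comm f (suc k) x = iter-comm f k (f x)

iter-+ : {A : Set} (f : A → A) → ∀ j k x → iter f (j + k) x ≡ iter f k (iter f j x)
iter-+ f zero    k x = refl
iter-+ f (suc j) k x = iter-+ f j k (f x)

involutive⇒injective : {A : Set} (f : A → A) → (∀ x → f (f x) ≡ x) → ∀ {x y} → f x ≡ f y → x ≡ y
involutive⇒injective f f-inv eq = sym (f-inv _) ∙ cong f eq ∙ f-inv _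

-- Two of the first `N + 1` iterates coincide, and injectivity strips their common prefix.
period : ∀ {N} (f : Fin N → Fin N) → (∀ {x y} → f x ≡ f y → x ≡ y) →
         ∀ x → ∃[ k ] iter f (suc k) x ≡ x
period {N} f f-inj x with pigeonhole (ℕ.n<1+n N) (λ i → iter f (toℕ i) x)
... | i , j , i<j , eq = toℕ j ∸ suc (toℕ i) , cancel (toℕ i) _ (eq′ ∙ sym eq)
  where
  cancel : ∀ m n → iter f (m + n) x ≡ iter f m x → iter f n x ≡ x
  cancel zero    n p = p
  cancel (suc m) n p =
    cancel m n (f-inj (sym (iter-comm f (m + n) x) ∙ p ∙ iter-comm f m x))
  eq′ : iter f (toℕ i + suc (toℕ j ∸ suc (toℕ i))) x ≡ iter f (toℕ j) x
  eq′ = cong (λ k → iter f k x)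
    (ℕ.+-suc (toℕ i) _ ∙ ℕ.m+[n∸m]≡n i<j)

not-≢ : ∀ b → not b ≢ b
not-≢ true  ()
not-≢ false ()

flip-≡ : ∀ {b c} → b ≢ c → b ≡ not c
flip-≡ {true}  {true}  p = ⊥-elim (p refl)
flip-≡ {true}  {false} p = refl
flip-≡ {false} {true}  p = refl
flip-≡ {false} {false} p = ⊥-elim (p refl)

step? : ∀ {N} (a b : Fin N → Fin N) → ∀ x y → Dec (y ≡ a x ⊎ y ≡ b x)
step? a b x y = (y ≟ a x) ⊎-dec (y ≟ b x)

step-sym : ∀ {N} (a b : Fin N → Fin N) → (∀ x → a (a x) ≡ x) → (∀ x → b (b x) ≡ x) →
           ∀ {x y} → y ≡ a x ⊎ y ≡ b x → x ≡ a y ⊎ x ≡ b y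
step-sym a b a-inv b-inv (inj₁ refl) = inj₁ (sym (a-inv _))
step-sym a b a-inv b-inv (inj₂ refl) = inj₂ (sym (b-inv _))

-- Loops of two involutions and their orientations

module Dihedral {N : ℕ} (a b : Fin N → Fin N)
  (a-inv : ∀ x → a (a x) ≡ x) (b-inv : ∀ x → b (b x) ≡ x) where

  rot : Fin N → Fin N
  rot x = b (a x)

  rot-inj : ∀ {x y} → rot x ≡ rot y → x ≡ y
  rot-inj eq = involutive⇒injective a a-inv (involutive⇒injective b b-inv eq)

  -- A reflection a(ba)^k is conjugate to a or to b.
  reflection-fpf : (I : Fin N → Set) → (∀ {x} → I x → I (a x)) → (∀ {x} → I x → I (b x)) →
    (∀ {x} → I x → a x ≢ x) → (∀ {x} → I x → b x ≢ x) →
    ∀ k {x} → I x → a (iter rot k x) ≢ x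
  reflection-fpf I Ia Ib fa fb zero          i eq = fa i eq
  reflection-fpf I Ia Ib fa fb (suc zero)    {x} i eq =
    fb (Ia i) (sym (a-inv _) ∙ cong a eq)
  reflection-fpf I Ia Ib fa fb (suc (suc k)) {x} i eq =
    reflection-fpf I Ia Ib fa fb k (Ib (Ia i)) (sym (b-inv _) ∙ cong b (sym (a-inv _) ∙ cong a eq′))
    where
    eq′ : a (b (a (iter rot k (rot x)))) ≡ x
    eq′ = cong a (sym (iter-comm rot k (rot x))) ∙ eq

  Loop : Fin N → Fin N → Set
  Loop = Star (λ x y → y ≡ a x ⊎ y ≡ b x)

  loop? : ∀ x y → Dec (Loop x y)
  loop? = Reachability.star? _ (step? a b)

  loop-sym : ∀ {x y} → Loop x y → Loop y x
  loop-sym = Star.reverse (step-sym a b a-inv b-inv)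

  loop-a : ∀ {x} → Loop x (a x)
  loop-a = inj₁ refl ◅ ε

  loop-b : ∀ {x} → Loop x (b x)
  loop-b = inj₂ refl ◅ ε

  record Orientation (o : Fin N → Bool) : Set where
    field
      flip-a : ∀ x → o (a x) ≡ not (o x)
      flip-b : ∀ x → o (b x) ≡ not (o x)

  orientation-unique : ∀ {o o′} → Orientation o → Orientation o′ →
    ∀ {x y} → Loop x y → o x ≡ o′ x → o y ≡ o′ y
  orientation-unique O O′ ε eq = eq
  orientation-unique O O′ (inj₁ refl ◅ p) eq = orientation-unique O O′ p
    (Orientation.flip-a O _ ∙ cong not eq ∙ sym (Orientation.flip-a O′ _))
  orientation-unique O O′ (inj₂ refl ◅ p) eq = orientation-unique O O′ p
    (Orientation.flip-b O _ ∙ cong not eq ∙ sym (Orientation.flip-b O′ _))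

  -- An orientation is prescribed on a loop by its value at the earliest visit. The value `b` is a
  -- parameter because reversing all loops turns `true` into `false`.
  First : Bool → (ℕ → Fin N) → (Fin N → Bool) → Set
  First b s o = ∀ k → (∀ j → j < k → ¬ Loop (s k) (s j)) → o (s k) ≡ b

  module Orient (a-fpf : ∀ x → a x ≢ x) (b-fpf : ∀ x → b x ≢ x)
    (s : ℕ → Fin N) (covers : ∀ x → ∃[ k ] Loop x (s k)) where

    Rot : Fin N → Fin N → Set
    Rot = Star (λ x y → y ≡ rot x)

    rot? : ∀ x y → Dec (Rot x y)
    rot? = Reachability.star? _ (λ x y → y ≟ rot x)

    rot-iter : ∀ {x y} → Rot x y → ∃[ k ] iter rot k x ≡ y
    rot-iter ε = 0 , refl
    rot-iter (refl ◅ p) = suc (proj₁ (rot-iter p)) , proj₂ (rot-iter p)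

    iter-rot : ∀ k x → Rot x (iter rot k x)
    iter-rot zero    x = ε
    iter-rot (suc k) x = refl ◅ iter-rot k (rot x)

    rot-back : ∀ x → Rot (rot x) x
    rot-back x with period rot rot-inj x
    ... | k , eq = subst (Rot (rot x)) eq (iter-rot k (rot x))

    rot-sym : ∀ {x y} → Rot x y → Rot y x
    rot-sym ε = ε
    rot-sym (refl ◅ p) = rot-sym p ◅◅ rot-back _

    -- Otherwise a power of `rot` would carry `x` to `a x`, and a reflection would fix `x`.
    two-sided : ∀ {m x} → Rot m x → ¬ Rot m (a x)
    two-sided {m} {x} p q with rot-iter (rot-sym p ◅◅ q)
    ... | k , eq = reflection-fpf (λ _ → ⊤) id id (λ {x} _ → a-fpf x) (λ {x} _ → b-fpf x) k tt
                     (cong a eq ∙ a-inv x)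

    rot-b : ∀ {m x} → Rot m x → Rot m (a (b x))
    -- `a (b x)` is the predecessor of `x` under `rot`; it is reached by going once round the finite
    -- orbit.
    rot-b {m} {x} p = p ◅◅ subst (λ y → Rot y (a (b x))) (cong b (a-inv _) ∙ b-inv x) (rot-back (a (b x)))

    either : ∀ {m x} → Loop m x → Rot m x ⊎ Rot m (a x)
    either {m} p = go p (inj₁ ε)
      where
      go : ∀ {x y} → Loop x y → Rot m x ⊎ Rot m (a x) → Rot m y ⊎ Rot m (a y)
      go ε q = q
      go {x} (inj₁ refl ◅ p) (inj₁ q) = go p (inj₂ (subst (Rot m) (sym (a-inv x)) q))
      go (inj₁ refl ◅ p) (inj₂ q) = go p (inj₁ q)
      go (inj₂ refl ◅ p) (inj₁ q) = go p (inj₂ (rot-b q))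
      go {x} (inj₂ refl ◅ p) (inj₂ q) =
        go p (inj₁ (q ◅◅ (cong b (sym (a-inv x)) ◅ ε)))

    first : ∀ x → Σ[ l ∈ ℕ ] (Loop x (s l) × (∀ j → j < l → ¬ Loop x (s j)))
    first x with covers x
    ... | k , p with least (λ j → loop? x (s j)) k p
    ... | l , _ , q , min = l , q , min

    first-loop : ∀ x → Loop x (s (proj₁ (first x)))
    first-loop x = proj₁ (proj₂ (first x))

    first-min : ∀ x {j} → Loop x (s j) → proj₁ (first x) ≤ j
    first-min x {j} p = ℕ.≮⇒≥ (λ lt → proj₂ (proj₂ (first x)) j lt p)

    first-unique : ∀ {x y} → Loop x y → proj₁ (first x) ≡ proj₁ (first y)
    first-unique {x} {y} p = ℕ.≤-antisym
      (first-min x (p ◅◅ first-loop y))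
      (first-min y (loop-sym p ◅◅ first-loop x))

    base : Fin N → Fin N
    base x = s (proj₁ (first x))

    base-loop : ∀ x → Loop (base x) x
    base-loop x = loop-sym (first-loop x)

    -- A loop splits into two `rot`-orbits exchanged by `a` and by `b`, one for each direction of
    -- travel. The orbit of the first visited point gets `true`.
    o : Fin N → Bool
    o x = does (rot? (base x) x)

    o-true : ∀ {x} → Rot (base x) x → o x ≡ true
    o-true {x} = dec-true (rot? (base x) x)

    o-false : ∀ {x} → ¬ Rot (base x) x → o x ≡ false
    o-false {x} = dec-false (rot? (base x) x)

    o-flip : ∀ {x y} → Loop x y → (∀ {m} → Rot m x → Rot m (a y)) → (∀ {m} → Rot m (a x) → Rot m y) →
             o y ≡ not (o x)
    o-flip {x} {y} l f g with either (base-loop x)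
    ... | inj₁ p = (o-false λ q → two-sided q (subst (λ k → Rot (s k) (a y)) (first-unique l) (f p))) ∙
                     cong not (sym (o-true p))
    ... | inj₂ p = o-true (subst (λ k → Rot (s k) y) (first-unique l) (g p)) ∙
                     cong not (sym (o-false λ q → two-sided q p))

    o-orientation : Orientation o
    o-orientation = record
      { flip-a = λ x → o-flip loop-a (subst (Rot _) (sym (a-inv x))) id
      ; flip-b = λ x → o-flip loop-b rot-b (λ q → q ◅◅ (cong b (sym (a-inv x)) ◅ ε)) }

    o-first : First true s o
    o-first k min = o-true (subst (λ j → Rot (s j) (s k)) (sym eq) ε)
      where
      eq : proj₁ (first (s k)) ≡ k
      eq = ℕ.≤-antisym (first-min (s k) ε) (ℕ.≮⇒≥ (λ lt → min _ lt (first-loop (s k))))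

  opaque
    oriented : (∀ x → a x ≢ x) → (∀ x → b x ≢ x) → (s : ℕ → Fin N) → (∀ x → ∃[ k ] Loop x (s k)) →
      Σ[ o ∈ (Fin N → Bool) ] (Orientation o × First true s o)
    oriented a-fpf b-fpf s covers = o , o-orientation , o-first
      where open Orient a-fpf b-fpf s covers

-- Segments of a loop between marked points

-- The first point satisfying P on the walk a x, aba x, ababa x, …
data Seg {N : ℕ} (a b : Fin N → Fin N) (P : Fin N → Set) : Fin N → Fin N → Set where
  end  : ∀ {x} → P (a x) → Seg a b P x (a x)
  step : ∀ {x y} → ¬ P (a x) → Seg a b P (b (a x)) y → Seg a b P x y

-- The invariant `I` confines the commutation hypotheses to the walk. It will be a level set, since
-- `τ` is compared by induction on the level.
Seg-map : ∀ {N N′} {a b : Fin N → Fin N} {a′ b′ : Fin N′ → Fin N′}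
  {P : Fin N → Set} {P′ : Fin N′ → Set} (f : Fin N → Fin N′) (I : Fin N → Set) →
  (∀ {x} → I x → I (a x)) → (∀ {x} → I x → I (b x)) →
  (∀ {x} → P x → P′ (f x)) → (∀ {x} → P′ (f x) → P x) →
  (∀ {x} → I x → f (a x) ≡ a′ (f x)) → (∀ {x} → I x → f (b x) ≡ b′ (f x)) →
  ∀ {x y} → I x → Seg a b P x y → Seg a′ b′ P′ (f x) (f y)
Seg-map {a = a} {a′ = a′} {b′ = b′} {P′ = P′} f I Ia Ib P⇒ P⇐ fa fb {x} i (end p) =
  subst (Seg a′ b′ P′ (f x)) (sym (fa i)) (end (subst P′ (fa i) (P⇒ p)))
Seg-map {a = a} {a′ = a′} {b′ = b′} {P′ = P′} f I Ia Ib P⇒ P⇐ fa fb {x} i (step ¬p s) =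
  step (λ p → ¬p (P⇐ (subst P′ (sym (fa i)) p)))
       (subst (λ z → Seg a′ b′ P′ z _) (fb (Ia i) ∙ cong b′ (fa i))
         (Seg-map f I Ia Ib P⇒ P⇐ fa fb (Ib (Ia i)) s))

Seg-flip : ∀ {N} {a b : Fin N → Fin N} {P : Fin N → Set} (c : Fin N → Bool) (I : Fin N → Set) →
  (∀ {x} → I x → I (a x)) → (∀ {x} → I x → I (b x)) →
  (∀ {x} → I x → c (a x) ≡ not (c x)) → (∀ {x} → I x → c (b x) ≡ not (c x)) →
  ∀ {x y} → I x → Seg a b P x y → c y ≡ not (c x)
Seg-flip c I Ia Ib ca cb i (end _) = ca i
Seg-flip c I Ia Ib ca cb i (step _ s) = Seg-flip c I Ia Ib ca cb (Ib (Ia i)) s ∙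
  cong not (cb (Ia i) ∙ cong not (ca i) ∙ not-involutive _)

Seg-inv : ∀ {N} {a b : Fin N → Fin N} {P : Fin N → Set} (I : Fin N → Set) →
  (∀ {x} → I x → I (a x)) → (∀ {x} → I x → I (b x)) →
  ∀ {x y} → I x → Seg a b P x y → I y
Seg-inv I Ia Ib i (end _) = Ia i
Seg-inv I Ia Ib i (step _ s) = Seg-inv I Ia Ib (Ib (Ia i)) s

Seg-iter : ∀ {N} {a b : Fin N → Fin N} {P : Fin N → Set} {x y} → Seg a b P x y →
  ∃[ k ] a (iter (λ z → b (a z)) k x) ≡ y
Seg-iter (end _) = 0 , refl
Seg-iter (step _ s) = suc (proj₁ (Seg-iter s)) , proj₂ (Seg-iter s)

Seg-det : ∀ {N} {a b : Fin N → Fin N} {P : Fin N → Set} {x y z} →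
  Seg a b P x y → Seg a b P x z → y ≡ z
Seg-det (end _)     (end _)     = refl
Seg-det (end p)     (step ¬p _) = ⊥-elim (¬p p)
Seg-det (step ¬p _) (end p)     = ⊥-elim (¬p p)
Seg-det (step _ s)  (step _ t)  = Seg-det s t

Seg-end : ∀ {N} {a b : Fin N → Fin N} {P : Fin N → Set} {x y} → Seg a b P x y → P y
Seg-end (end p)    = p
Seg-end (step _ s) = Seg-end s

module Segment {N : ℕ} (a b : Fin N → Fin N)
  (a-inv : ∀ x → a (a x) ≡ x) (b-inv : ∀ x → b (b x) ≡ x)
  (P : Fin N → Set) (P? : ∀ x → Dec (P x)) (P-b : ∀ {x} → P x → P (b x)) where

  open Dihedral a b a-inv b-inv

  -- By periodicity the walk returns to `x`, and the point just before the return is `b x`, which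
  -- satisfies `P` by `P-b`.
  exists : ∀ {x} → P x → ∃[ y ] Seg a b P x y
  exists {x} px = go (proj₁ (period rot rot-inj x)) x (proj₂ (period rot rot-inj x))
    where
    go : ∀ k y → iter rot (suc k) y ≡ x → ∃[ z ] Seg a b P y z
    go k y eq with P? (a y)
    ... | yes p = a y , end p
    go zero y eq | no ¬p = ⊥-elim (¬p (subst P (cong b (sym eq) ∙ b-inv (a y)) (P-b px)))
    go (suc k) y eq | no ¬p = proj₁ (go k (rot y) eq) , step ¬p (proj₂ (go k (rot y) eq))

  opaque
    seg : Fin N → Fin N
    seg x with P? x
    ... | yes p = proj₁ (exists p)
    ... | no _  = x

    seg-Seg : ∀ {x} → P x → Seg a b P x (seg x)
    seg-Seg {x} p with P? x
    ... | yes p′ = proj₂ (exists p′)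
    ... | no ¬p  = ⊥-elim (¬p p)

  seg-P : ∀ {x} → P x → P (seg x)
  seg-P p = Seg-end (seg-Seg p)

  -- The loop cut at its `b`-steps between points of `P`. For a level loop of a quadrangulation a
  -- piece is a run of consecutive edges descending from one vertex.
  Conn : Fin N → Fin N → Set
  Conn = Star (λ x y → y ≡ a x ⊎ (¬ P x × y ≡ b x))

  conn? : ∀ x y → Dec (Conn x y)
  conn? = Reachability.star? _ (λ x y → (y ≟ a x) ⊎-dec (¬? (P? x) ×-dec (y ≟ b x)))

  ¬P-b : ∀ {x} → ¬ P x → ¬ P (b x)
  ¬P-b {x} ¬p p = ¬p (subst P (b-inv x) (P-b p))

  conn-sym : ∀ {x y} → Conn x y → Conn y x
  conn-sym = Star.reverse λ where
    (inj₁ refl)        → inj₁ (sym (a-inv _))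
    (inj₂ (¬p , refl)) → inj₂ (¬P-b ¬p , sym (b-inv _))

  Seg⇒Conn : ∀ {x y} → Seg a b P x y → Conn x y
  Seg⇒Conn (end _)     = inj₁ refl ◅ ε
  Seg⇒Conn (step ¬p s) = inj₁ refl ◅ inj₂ (¬p , refl) ◅ Seg⇒Conn s

  -- The ends of the segment through q met when leaving q along a and along b.
  Ends : Fin N → Fin N → Fin N → Set
  Ends q e e′ = Seg a b P q e × ((P q × q ≡ e′) ⊎ (¬ P q × Seg a b P (b q) e′))

  ends-a : ∀ {q e e′} → Ends q e e′ → Ends (a q) e′ e
  ends-a {q} {e} {e′} (s , r) = front r , back s
    where
    front : (P q × q ≡ e′) ⊎ (¬ P q × Seg a b P (b q) e′) → Seg a b P (a q) e′
    front (inj₁ (p , refl)) = subst (Seg a b P (a q)) (a-inv q) (end (subst P (sym (a-inv q)) p))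
    front (inj₂ (¬p , t)) = step (λ p → ¬p (subst P (a-inv q) p))
      (subst (λ y → Seg a b P (b y) e′) (sym (a-inv q)) t)
    back : Seg a b P q e → (P (a q) × a q ≡ e) ⊎ (¬ P (a q) × Seg a b P (b (a q)) e)
    back (end p)     = inj₁ (p , refl)
    back (step ¬p t) = inj₂ (¬p , t)

  ends-b : ∀ {q e e′} → ¬ P q → Ends q e e′ → Ends (b q) e′ e
  ends-b ¬p (s , inj₁ (p , _)) = ⊥-elim (¬p p)
  ends-b {q} {e} ¬p (s , inj₂ (_ , t)) =
    t , inj₂ (¬P-b ¬p , subst (λ y → Seg a b P y e) (sym (b-inv q)) s)

  conn-ends : ∀ {x y e e′} → Conn x y → Ends x e e′ → Ends y e e′ ⊎ Ends y e′ e
  conn-ends ε E = inj₁ E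
  conn-ends (inj₁ refl ◅ c) E = [ inj₂ , inj₁ ] (conn-ends c (ends-a E))
  conn-ends (inj₂ (¬p , refl) ◅ c) E = [ inj₂ , inj₁ ] (conn-ends c (ends-b ¬p E))

  ends-P : ∀ {q e e′} → P q → Ends q e e′ → q ≡ e′
  ends-P p (_ , inj₁ (_ , eq)) = eq
  ends-P p (_ , inj₂ (¬p , _)) = ⊥-elim (¬p p)

  ends-seg : ∀ {x} → P x → Ends x (seg x) x
  ends-seg p = seg-Seg p , inj₁ (p , refl)

  -- The pair of ends is constant along a piece up to a swap, and a point of `P` is itself one of
  -- the two.
  conn-end : ∀ {x y} → P x → P y → Conn x y → y ≡ x ⊎ y ≡ seg x
  conn-end px py c with conn-ends c (ends-seg px)
  ... | inj₁ E = inj₁ (ends-P py E)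
  ... | inj₂ E = inj₂ (ends-P py E)

  Seg⇒seg : ∀ {x y} → P x → Seg a b P x y → seg x ≡ y
  Seg⇒seg p = Seg-det (seg-Seg p)

  seg-inv : ∀ {x} → P x → seg (seg x) ≡ x
  seg-inv {x} p with conn-ends (Seg⇒Conn (seg-Seg p)) (ends-seg p)
  ... | inj₁ E = Seg⇒seg (seg-P p) (proj₁ E) ∙ ends-P (seg-P p) E
  ... | inj₂ E = Seg⇒seg (seg-P p) (proj₁ E)

  -- By `Seg-iter` a segment acts as a reflection. `I` restricts the argument to the points where
  -- `b` is known to move everything.
  seg-fpf : (I : Fin N → Set) → (∀ {x} → I x → I (a x)) → (∀ {x} → I x → I (b x)) →
    (∀ {x} → I x → a x ≢ x) → (∀ {x} → I x → b x ≢ x) → ∀ {x} → P x → I x → seg x ≢ x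
  seg-fpf I Ia Ib fa fb {x} p i eq with Seg-iter (seg-Seg p)
  ... | k , eq′ = reflection-fpf I Ia Ib fa fb k i (eq′ ∙ eq)

-- Frames, and the map and the quadrangulation built on a frame

data Slope : Set where
  flat rise fall : Slope

_≟ₛ_ : (s s′ : Slope) → Dec (s ≡ s′)
flat ≟ₛ flat = yes refl
flat ≟ₛ rise = no λ ()
flat ≟ₛ fall = no λ ()
rise ≟ₛ flat = no λ ()
rise ≟ₛ rise = yes refl
rise ≟ₛ fall = no λ ()
fall ≟ₛ flat = no λ ()
fall ≟ₛ rise = no λ ()
fall ≟ₛ fall = yes refl

opp : Slope → Slope
opp flat = flat
opp rise = fall
opp fall = rise

onSlope : ∀ {A : Set} s → (s ≡ flat → A) → (s ≡ rise → A) → (s ≡ fall → A) → A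
onSlope flat f g h = f refl
onSlope rise f g h = g refl
onSlope fall f g h = h refl

-- The structure on flags seen both from the quadrangulation and from the map: a crosses a
-- corner of the map (an edge of the quadrangulation), v crosses an edge of the map, and τ
-- follows a level curve of the labelling ℓ from one edge of the quadrangulation to the next.
-- The slope compares ℓ at the two ends of the edge of the map.
record Frame (N : ℕ) : Set where
  no-eta-equality
  field
    a v τ : Fin N → Fin N
    slope : Fin N → Slope
    ℓ     : Fin N → ℕ
    a-inv : ∀ x → a (a x) ≡ x
    v-inv : ∀ x → v (v x) ≡ x
    τ-inv : ∀ x → τ (τ x) ≡ x
    a-fpf : ∀ x → a x ≢ x
    v-fpf : ∀ x → v x ≢ x
    τ-fpf : ∀ x → τ x ≢ x
    slope-v : ∀ x → slope (v x) ≡ slope x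
    slope-τ : ∀ x → slope (τ x) ≡ slope x
    ℓ-a : ∀ x → ℓ (a x) ≡ ℓ x
    ℓ-v : ∀ x → ℓ (v x) ≡ ℓ x
    ℓ-τ : ∀ x → ℓ (τ x) ≡ ℓ x
    -- In a face `(i, i+1, i+2, i+1)` the curve at level `i + 1/2` turns around the corner at `i`,
    -- the corner through which the edge of the map leaves its lower end.
    τ-rise    : ∀ {x} → slope x ≡ rise → τ x ≡ v x
    -- A face `(i, i+1, i, i+1)` carries exactly the four flags of one edge of the map, on which `v`
    -- and `τ` act freely as a Klein four-group.
    flat-comm : ∀ {x} → slope x ≡ flat → v (τ x) ≡ τ (v x)
    flat-fpf  : ∀ {x} → slope x ≡ flat → v (τ x) ≢ x

  Rise : Fin N → Set
  Rise x = slope x ≡ rise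

  open Dihedral a τ a-inv τ-inv public
  open Segment a τ a-inv τ-inv Rise (λ x → slope x ≟ₛ rise) (λ {x} p → slope-τ x ∙ p) public

  seg-ℓ : ∀ {x} → Rise x → ℓ (seg x) ≡ ℓ x
  seg-ℓ {x} p = Seg-inv (λ y → ℓ y ≡ ℓ x) (trans (ℓ-a _)) (trans (ℓ-τ _)) refl (seg-Seg p)

  Seg-o : ∀ {o x y} → Orientation o → Seg a τ Rise x y → o y ≡ not (o x)
  Seg-o O = Seg-flip _ (λ _ → ⊤) id id (λ _ → Orientation.flip-a O _) (λ _ → Orientation.flip-b O _) tt

  seg-o : ∀ {o x} → Orientation o → Rise x → o (seg x) ≡ not (o x)
  seg-o O p = Seg-o O (seg-Seg p)

  rise-τ : ∀ {x} → Rise x → Rise (τ x)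
  rise-τ = trans (slope-τ _)

  -- A matching of falling flags with rising flags carries the involutions v and τ to ρ and σ.
  record Matching (ρ σ z : Fin N → Fin N) : Set where
    no-eta-equality
    field
      inv    : ∀ x → z (z x) ≡ x
      slopes : ∀ x → slope (z x) ≡ opp (slope x)
      on-flat : ∀ {x} → slope x ≡ flat → z x ≡ τ x
      drop   : ∀ {x} → slope x ≡ fall → ℓ x ≡ suc (ℓ (z x))
      mv     : ∀ {x} → slope x ≡ fall → z (v x) ≡ ρ (z x)
      mτ     : ∀ {x} → slope x ≡ fall → z (τ x) ≡ σ (z x)

    fall⇒rise : ∀ {x} → slope x ≡ fall → Rise (z x)
    fall⇒rise eq = slopes _ ∙ cong opp eq

    rise⇒fall : ∀ {x} → Rise x → slope (z x) ≡ fall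
    rise⇒fall eq = slopes _ ∙ cong opp eq

    injective : ∀ {x y} → z x ≡ z y → x ≡ y
    injective = involutive⇒injective z inv

  -- In the quadrangulation `v` at a fall skips the edges descending from the vertex, that is, a
  -- segment one level below, and `τ` joins two edges of the same face. In the map the two sides of
  -- an edge correspond at its ends, so `v` goes to `τ`, which is `v` on rises; and a level curve at
  -- a fall runs along a face above a segment, so `τ` goes to `seg`.
  QuadMatching MapMatching : (Fin N → Fin N) → Set
  QuadMatching = Matching seg τ
  MapMatching  = Matching τ seg

  -- One place forward among the rising flags of a loop: the neighbour ahead is the `τ`-partner
  -- where `o` is true and the `seg`-partner where it is false.
  θ : (Fin N → Bool) → Fin N → Fin N
  θ o u = if o u then τ u else seg u

  θ-true : ∀ o {u} → o u ≡ true → θ o u ≡ τ u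
  θ-true o eq rewrite eq = refl

  θ-false : ∀ o {u} → o u ≡ false → θ o u ≡ seg u
  θ-false o eq rewrite eq = refl

  θ-cong : ∀ o o′ {u} → o u ≡ o′ u → θ o u ≡ θ o′ u
  θ-cong o o′ eq rewrite eq = refl

  conn⇒loop : ∀ {x y} → Conn x y → Loop x y
  conn⇒loop = Star.map λ where
    (inj₁ eq)       → inj₁ eq
    (inj₂ (_ , eq)) → inj₂ eq

  θ-loop : ∀ o {u} → Rise u → Loop u (θ o u)
  θ-loop o {u} r with o u
  ... | true  = loop-b
  ... | false = conn⇒loop (Seg⇒Conn (seg-Seg r))

  -- `z` exchanges rises and falls. To keep an involution, shifting after `z` on falls forces the
  -- inverse shift, that of the reversed orientation, before `z` on rises.
  twistBy : Slope → (Fin N → Bool) → (Fin N → Fin N) → Fin N → Fin N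
  twistBy flat o z x = z x
  twistBy rise o z x = z (θ (not ∘ o) x)
  twistBy fall o z x = θ o (z x)

  twist : (Fin N → Bool) → (Fin N → Fin N) → Fin N → Fin N
  twist o z x = twistBy (slope x) o z x

  twist-flat : ∀ {o z x} → slope x ≡ flat → twist o z x ≡ z x
  twist-flat {o} {z} {x} eq = cong (λ s → twistBy s o z x) eq

  twist-rise : ∀ {o z x} → slope x ≡ rise → twist o z x ≡ z (θ (not ∘ o) x)
  twist-rise {o} {z} {x} eq = cong (λ s → twistBy s o z x) eq

  twist-fall : ∀ {o z x} → slope x ≡ fall → twist o z x ≡ θ o (z x)
  twist-fall {o} {z} {x} eq = cong (λ s → twistBy s o z x) eq

  not-orientation : ∀ {o} → Orientation o → Orientation (not ∘ o)
  not-orientation O = record { flip-a = λ x → cong not (flip-a x) ; flip-b = λ x → cong not (flip-b x) }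
    where open Orientation O

  slope-cases : ∀ {A : Set} x → (slope x ≡ flat → A) → (slope x ≡ rise → A) → (slope x ≡ fall → A) → A
  slope-cases x = onSlope (slope x)

  module Twist {o : Fin N → Bool} (O : Orientation o) where
    open Orientation O

    θ-rise : ∀ {u} → Rise u → Rise (θ o u)
    θ-rise {u} p with o u
    ... | true  = rise-τ p
    ... | false = seg-P p

    θ-ℓ : ∀ {u} → Rise u → ℓ (θ o u) ≡ ℓ u
    θ-ℓ {u} p with o u
    ... | true  = ℓ-τ u
    ... | false = seg-ℓ p

    θ-o : ∀ {u} → Rise u → o (θ o u) ≡ not (o u)
    θ-o {u} p with o u in eq
    ... | true  = flip-b u ∙ cong not eq
    ... | false = seg-o O p ∙ cong not eq

    θ-o⁻ : ∀ {u b} → Rise u → o (θ o u) ≡ b → o u ≡ not b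
    θ-o⁻ r eq = sym (not-involutive _) ∙ cong not (sym (θ-o r) ∙ eq)

    -- The shift flips `o`, so afterwards the reversed orientation selects the pairing that has just
    -- been used.
    θ-inv : ∀ {u} → Rise u → θ (not ∘ o) (θ o u) ≡ u
    θ-inv {u} p with o u in eq
    ... | true  = θ-true (not ∘ o) (cong not (flip-b u ∙ cong not eq)) ∙ τ-inv u
    ... | false = θ-false (not ∘ o) (cong not (seg-o O p ∙ cong not eq)) ∙ seg-inv p

    θ-τ : ∀ {u} → Rise u → θ o (τ u) ≡ seg (θ o u)
    θ-τ {u} p with o u in eq
    ... | true  = θ-false o (flip-b u ∙ cong not eq)
    ... | false = θ-true o (flip-b u ∙ cong not eq) ∙ τ-inv u ∙ sym (seg-inv p)

    θ-seg : ∀ {u} → Rise u → θ o (seg u) ≡ τ (θ o u)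
    θ-seg {u} p with o u in eq
    ... | true  = θ-false o (seg-o O p ∙ cong not eq) ∙ seg-inv p ∙ sym (τ-inv u)
    ... | false = θ-true o (seg-o O p ∙ cong not eq)

  -- Generic in the pairings carried, so that one argument leads from quadrangulations to maps and
  -- from maps to quadrangulations.
  module TwistMatching {o : Fin N → Bool} (O : Orientation o)
    {ρ σ ρ′ σ′ z : Fin N → Fin N} (m : Matching ρ σ z)
    (θ-ρ : ∀ {u} → Rise u → θ o (ρ u) ≡ ρ′ (θ o u))
    (θ-σ : ∀ {u} → Rise u → θ o (σ u) ≡ σ′ (θ o u)) where
    open Matching m
    open Twist O
    module T′ = Twist (not-orientation O)

    t : Fin N → Fin N
    t = twist o z

    θ-inv′ : ∀ {u} → Rise u → θ o (θ (not ∘ o) u) ≡ u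
    θ-inv′ {u} p = θ-cong o (not ∘ not ∘ o) (sym (not-involutive (o (θ (not ∘ o) u)))) ∙ T′.θ-inv p

    t-fall : ∀ {x} → slope x ≡ fall → Rise (t x)
    t-fall eq = cong slope (twist-fall eq) ∙ θ-rise (fall⇒rise eq)

    t-rise : ∀ {x} → slope x ≡ rise → slope (t x) ≡ fall
    t-rise eq = cong slope (twist-rise eq) ∙ rise⇒fall (T′.θ-rise eq)

    twist-inv : ∀ x → t (t x) ≡ x
    twist-inv x = slope-cases x
      (λ eq → twist-flat (cong slope (twist-flat eq) ∙ slopes x ∙ cong opp eq) ∙
                cong z (twist-flat eq) ∙ inv x)
      (λ eq → twist-fall (t-rise eq) ∙
                cong (θ o) (cong z (twist-rise eq) ∙ inv _) ∙ θ-inv′ eq)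
      (λ eq → twist-rise (t-fall eq) ∙
                cong (z ∘ θ (not ∘ o)) (twist-fall eq) ∙
                  cong z (θ-inv (fall⇒rise eq)) ∙ inv x)

    matching : Matching ρ′ σ′ t
    matching = record
      { inv = twist-inv
      ; slopes = λ x → slope-cases x
          (λ eq → cong slope (twist-flat eq) ∙ slopes x)
          (λ eq → t-rise eq ∙ cong opp (sym eq))
          (λ eq → t-fall eq ∙ cong opp (sym eq))
      ; on-flat = λ eq → twist-flat eq ∙ on-flat eq
      ; drop = λ eq → drop eq ∙
          cong suc (sym (cong ℓ (twist-fall eq) ∙ θ-ℓ (fall⇒rise eq)))
      ; mv = λ eq → twist-fall (slope-v _ ∙ eq) ∙ cong (θ o) (mv eq) ∙
          θ-ρ (fall⇒rise eq) ∙ cong ρ′ (sym (twist-fall eq))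
      ; mτ = λ eq → twist-fall (slope-τ _ ∙ eq) ∙ cong (θ o) (mτ eq) ∙
          θ-σ (fall⇒rise eq) ∙ cong σ′ (sym (twist-fall eq))
      }

    twist-twist : ∀ x → twist (not ∘ o) t x ≡ z x
    twist-twist x = slope-cases x
      (λ eq → twist-flat eq ∙ twist-flat eq)
      (λ eq → twist-rise eq ∙
        cong t (θ-cong (not ∘ not ∘ o) o (not-involutive (o x))) ∙
          twist-rise (θ-rise eq) ∙ cong z (θ-inv eq))
      (λ eq → twist-fall eq ∙
        cong (θ (not ∘ o)) (twist-fall eq) ∙ θ-inv (fall⇒rise eq))

module FrameMaps {N : ℕ} (F : Frame N) where
  open Frame F

  mapM : ∀ {t} → MapMatching t → CMap
  mapM {t} m = record
    { N = N ; α₀ = t ; α₁ = a ; α₂ = v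
    ; inv₀ = inv ; inv₁ = a-inv ; inv₂ = v-inv
    ; fpf₀ = t-fpf ; fpf₁ = a-fpf ; fpf₂ = v-fpf
    ; comm₀₂ = comm ; fpf₀₂ = fpf }
    where
    open Matching m
    changes : ∀ {x s} → slope x ≡ s → opp s ≢ s → ∀ {y} → slope y ≡ slope x → t y ≢ x
    changes {x} eq ne {y} eq′ ty =
      ne (cong opp (sym (eq′ ∙ eq)) ∙ sym (slopes y) ∙ cong slope ty ∙ eq)
    t-fpf : ∀ x → t x ≢ x
    t-fpf x = slope-cases x (λ eq p → τ-fpf x (sym (on-flat eq) ∙ p))
      (λ eq → changes eq (λ ()) refl) (λ eq → changes eq (λ ()) refl)
    comm-fall : ∀ {x} → slope x ≡ fall → t (v x) ≡ v (t x)
    comm-fall eq = mv eq ∙ τ-rise (fall⇒rise eq)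
    comm : ∀ x → t (v x) ≡ v (t x)
    comm x = slope-cases x
      (λ eq → on-flat (slope-v x ∙ eq) ∙ sym (flat-comm eq) ∙ cong v (sym (on-flat eq)))
      (λ eq → cong (t ∘ v) (sym (inv x)) ∙
                cong t (sym (comm-fall (rise⇒fall eq))) ∙ inv _)
      comm-fall
    fpf : ∀ x → t (v x) ≢ x
    fpf x = slope-cases x
      (λ eq p → flat-fpf eq (flat-comm eq ∙ sym (on-flat (slope-v x ∙ eq)) ∙ p))
      (λ eq → changes eq (λ ()) (slope-v x)) (λ eq → changes eq (λ ()) (slope-v x))

  -- The flags of the quadrangulation: lo x and up x lie on the same side of the same edge,
  -- lo x at the end closer to the pointed vertex.
  opaque
    lo up : Fin N → Fin (N + N)
    lo x = x ↑ˡ N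
    up x = N ↑ʳ x

    onFlags : {A : Set} → (Fin N → A) → (Fin N → A) → Fin (N + N) → A
    onFlags f g p = [ f , g ] (splitAt N p)

    on-lo : ∀ {A : Set} (f g : Fin N → A) x → onFlags f g (lo x) ≡ f x
    on-lo f g x = cong [ f , g ] (splitAt-↑ˡ N x N)

    on-up : ∀ {A : Set} (f g : Fin N → A) x → onFlags f g (up x) ≡ g x
    on-up f g x = cong [ f , g ] (splitAt-↑ʳ N N x)

    flag-elim : (P : Fin (N + N) → Set) → (∀ x → P (lo x)) → (∀ x → P (up x)) → ∀ p → P p
    flag-elim P f g p = subst P (join-splitAt N N p) (go (splitAt N p))
      where
      go : ∀ s → P (join N N s)
      go (inj₁ x) = f x
      go (inj₂ x) = g x

  isLo : Fin (N + N) → Bool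
  isLo = onFlags (λ _ → true) (λ _ → false)

  pr : Fin (N + N) → Fin N
  pr = onFlags id id

  lo-inj : ∀ {x y} → lo x ≡ lo y → x ≡ y
  lo-inj {x} {y} eq = sym (on-lo id id x) ∙ cong pr eq ∙ on-lo id id y

  up-inj : ∀ {x y} → up x ≡ up y → x ≡ y
  up-inj {x} {y} eq = sym (on-up id id x) ∙ cong pr eq ∙ on-up id id y

  up≢lo : ∀ {x y} → up x ≢ lo y
  up≢lo {x} {y} eq with trans (sym (on-up (λ _ → true) (λ _ → false) x))
                          (cong isLo eq ∙ on-lo (λ _ → true) (λ _ → false) y)
  ... | ()

  module Quad {z : Fin N → Fin N} (m : QuadMatching z) where
    open Matching m

    -- Turning around a vertex inside a face, a low flag meets a descending edge exactly at a fall,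
    -- and an upper flag meets an ascending edge exactly at a rise.
    turnLo turnUp : Slope → Fin N → Fin (N + N)
    turnLo flat x = lo (v x)
    turnLo rise x = lo (v x)
    turnLo fall x = up (z x)
    turnUp flat x = up (τ x)
    turnUp rise x = lo (z x)
    turnUp fall x = up (τ x)

    opaque
      β₀ β₁ β₂ : Fin (N + N) → Fin (N + N)
      β₀ = onFlags up lo
      β₁ = onFlags (λ x → turnLo (slope x) x) (λ x → turnUp (slope x) x)
      β₂ = onFlags (lo ∘ a) (up ∘ a)

      β₀-lo : ∀ x → β₀ (lo x) ≡ up x
      β₀-lo = on-lo up lo

      β₀-up : ∀ x → β₀ (up x) ≡ lo x
      β₀-up = on-up up lo

      β₂-lo : ∀ x → β₂ (lo x) ≡ lo (a x)
      β₂-lo = on-lo (lo ∘ a) (up ∘ a)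

      β₂-up : ∀ x → β₂ (up x) ≡ up (a x)
      β₂-up = on-up (lo ∘ a) (up ∘ a)

      β₁-lo : ∀ {x} s → slope x ≡ s → β₁ (lo x) ≡ turnLo s x
      β₁-lo {x} s eq = on-lo _ _ x ∙ cong (λ s → turnLo s x) eq

      β₁-up : ∀ {x} s → slope x ≡ s → β₁ (up x) ≡ turnUp s x
      β₁-up {x} s eq = on-up _ _ x ∙ cong (λ s → turnUp s x) eq

    v-slope : ∀ {x s} → slope x ≡ s → slope (v x) ≡ s
    v-slope = trans (slope-v _)

    τ-slope : ∀ {x s} → slope x ≡ s → slope (τ x) ≡ s
    τ-slope = trans (slope-τ _)

    β₁-inv-lo : ∀ x → β₁ (β₁ (lo x)) ≡ lo x
    β₁-inv-lo x = slope-cases x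
      (λ eq → cong β₁ (β₁-lo flat eq) ∙ β₁-lo flat (v-slope eq) ∙ cong lo (v-inv x))
      (λ eq → cong β₁ (β₁-lo rise eq) ∙ β₁-lo rise (v-slope eq) ∙ cong lo (v-inv x))
      (λ eq → cong β₁ (β₁-lo fall eq) ∙ β₁-up rise (fall⇒rise eq) ∙ cong lo (inv x))

    β₁-inv-up : ∀ x → β₁ (β₁ (up x)) ≡ up x
    β₁-inv-up x = slope-cases x
      (λ eq → cong β₁ (β₁-up flat eq) ∙ β₁-up flat (τ-slope eq) ∙ cong up (τ-inv x))
      (λ eq → cong β₁ (β₁-up rise eq) ∙ β₁-lo fall (rise⇒fall eq) ∙ cong up (inv x))
      (λ eq → cong β₁ (β₁-up fall eq) ∙ β₁-up fall (τ-slope eq) ∙ cong up (τ-inv x))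

    β₁-fpf-lo : ∀ x → β₁ (lo x) ≢ lo x
    β₁-fpf-lo x p = slope-cases x
      (λ eq → v-fpf x (lo-inj (sym (β₁-lo flat eq) ∙ p)))
      (λ eq → v-fpf x (lo-inj (sym (β₁-lo rise eq) ∙ p)))
      (λ eq → up≢lo (sym (β₁-lo fall eq) ∙ p))

    β₁-fpf-up : ∀ x → β₁ (up x) ≢ up x
    β₁-fpf-up x p = slope-cases x
      (λ eq → τ-fpf x (up-inj (sym (β₁-up flat eq) ∙ p)))
      (λ eq → up≢lo (sym (sym (β₁-up rise eq) ∙ p)))
      (λ eq → τ-fpf x (up-inj (sym (β₁-up fall eq) ∙ p)))

    mapQ : CMap
    mapQ = record
      { N = N + N ; α₀ = β₀ ; α₁ = β₁ ; α₂ = β₂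
      ; inv₀ = flag-elim _ (λ x → cong β₀ (β₀-lo x) ∙ β₀-up x)
                           (λ x → cong β₀ (β₀-up x) ∙ β₀-lo x)
      ; inv₁ = flag-elim _ β₁-inv-lo β₁-inv-up
      ; inv₂ = flag-elim _ (λ x → cong β₂ (β₂-lo x) ∙ β₂-lo _ ∙ cong lo (a-inv x))
                           (λ x → cong β₂ (β₂-up x) ∙ β₂-up _ ∙ cong up (a-inv x))
      ; fpf₀ = flag-elim _ (λ x p → up≢lo (sym (β₀-lo x) ∙ p))
                           (λ x p → up≢lo (sym (sym (β₀-up x) ∙ p)))
      ; fpf₁ = flag-elim _ β₁-fpf-lo β₁-fpf-up
      ; fpf₂ = flag-elim _ (λ x p → a-fpf x (lo-inj (sym (β₂-lo x) ∙ p)))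
                           (λ x p → a-fpf x (up-inj (sym (β₂-up x) ∙ p)))
      ; comm₀₂ = flag-elim _
          (λ x → cong β₀ (β₂-lo x) ∙ β₀-lo _ ∙ sym (cong β₂ (β₀-lo x) ∙ β₂-up x))
          (λ x → cong β₀ (β₂-up x) ∙ β₀-up _ ∙ sym (cong β₂ (β₀-up x) ∙ β₂-lo x))
      ; fpf₀₂ = flag-elim _
          (λ x p → up≢lo (sym (cong β₀ (β₂-lo x) ∙ β₀-lo _) ∙ p))
          (λ x p → up≢lo (sym (sym (cong β₀ (β₂-up x) ∙ β₀-up _) ∙ p)))
      }

-- Walks and distance labellings

even : ℕ → Bool
even zero    = true
even (suc n) = not (even n)

module MapFacts (C : CMap) where
  open CMap C

  sameV-sym : ∀ {x y} → SameV x y → SameV y x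
  sameV-sym = Star.reverse (step-sym α₁ α₂ inv₁ inv₂)

  sameE-sym : ∀ {x y} → SameE x y → SameE y x
  sameE-sym = Star.reverse (step-sym α₀ α₂ inv₀ inv₂)

  sameF-sym : ∀ {x y} → SameF x y → SameF y x
  sameF-sym = Star.reverse (step-sym α₀ α₁ inv₀ inv₁)

  sameV? : ∀ x y → Dec (SameV x y)
  sameV? = Reachability.star? _ (step? α₁ α₂)

  sameE? : ∀ x y → Dec (SameE x y)
  sameE? = Reachability.star? _ (step? α₀ α₂)

  sameF? : ∀ x y → Dec (SameF x y)
  sameF? = Reachability.star? _ (step? α₀ α₁)

  α₁-V : ∀ {x} → SameV x (α₁ x)
  α₁-V = inj₁ refl ◅ ε

  α₂-V : ∀ {x} → SameV x (α₂ x)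
  α₂-V = inj₂ refl ◅ ε

  walk-resp : ∀ {x x′ y k} → SameV x x′ → Walk x′ y k → Walk x y k
  walk-resp s (here s′)    = here (s ◅◅ s′)
  walk-resp s (there s′ w) = there (s ◅◅ s′) w

  walk-respʳ : ∀ {x y y′ k} → Walk x y k → SameV y y′ → Walk x y′ k
  walk-respʳ (here s′)    s = here (s′ ◅◅ s)
  walk-respʳ (there s′ w) s = there s′ (walk-respʳ w s)

  walk-++ : ∀ {x y z j k} → Walk x y j → Walk y z k → Walk x z (j + k)
  walk-++ (here s)    w′ = walk-resp s w′
  walk-++ (there s w) w′ = there s (walk-++ w w′)

  walk-sym : ∀ {x y k} → Walk x y k → Walk y x k
  walk-sym (here s) = here (sameV-sym s)
  walk-sym {x} {y} {suc k} (there {x' = x′} s w) = subst (Walk y x) (ℕ.+-comm k 1)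
    (walk-++ (walk-sym w)
      (there ε (here (subst (λ q → SameV q x) (sym (inv₀ x′)) (sameV-sym s)))))

  dist-unique : ∀ {x y i j} → Dist x y i → Dist x y j → i ≡ j
  dist-unique (w , min) (w′ , min′) = ℕ.≤-antisym (min _ w′) (min′ _ w)

  dist-resp : ∀ {x x′ y k} → SameV x x′ → Dist x y k → Dist x′ y k
  dist-resp s (w , min) =
    walk-resp (sameV-sym s) w , λ j w′ → min j (walk-resp s w′)

  walk⇒steps : ∀ {x y k} → Walk x y k → Star AllStep x y
  walk⇒steps (here s)    = Star.map inj₂ s
  walk⇒steps (there s w) = Star.map inj₂ s ◅◅ inj₁ refl ◅ walk⇒steps w

  steps-sym : ∀ {x y} → Star AllStep x y → Star AllStep y x
  steps-sym = Star.reverse λ where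
    (inj₁ refl)        → inj₁ (sym (inv₀ _))
    (inj₂ (inj₁ refl)) → inj₂ (inj₁ (sym (inv₁ _)))
    (inj₂ (inj₂ refl)) → inj₂ (inj₂ (sym (inv₂ _)))

  -- Local conditions that force `d` to be the distance to `p`, and the map to be connected.
  -- Distances in the constructed maps are obtained by checking them.
  record Labelling (p : Fin N) (d : Fin N → ℕ) : Set where
    field
      d-α₁    : ∀ x → d (α₁ x) ≡ d x
      d-α₂    : ∀ x → d (α₂ x) ≡ d x
      d-α₀    : ∀ x → d (α₀ x) ≤ suc (d x)
      d-point : d p ≡ 0
      zero-V  : ∀ x → d x ≡ 0 → SameV x p
      descent : ∀ x k → d x ≡ suc k → ∃[ y ] (SameV x y × d (α₀ y) ≡ k)

    d-V : ∀ {x y} → SameV x y → d x ≡ d y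
    d-V ε = refl
    d-V (inj₁ refl ◅ s) = sym (d-α₁ _) ∙ d-V s
    d-V (inj₂ refl ◅ s) = sym (d-α₂ _) ∙ d-V s

    d-walk : ∀ {x k} → Walk x p k → d x ≤ k
    d-walk (here s) = ℕ.≤-reflexive (d-V s ∙ d-point)
    d-walk (there {x' = y} s w) = ℕ.≤-trans
      (ℕ.≤-reflexive (d-V s ∙ cong d (sym (inv₀ y))))
      (ℕ.≤-trans (d-α₀ (α₀ y)) (s≤s (d-walk w)))

    walk : ∀ k x → d x ≡ k → Walk x p k
    walk zero    x eq = here (zero-V x eq)
    walk (suc k) x eq with descent x k eq
    ... | y , s , eq′ = there s (walk k (α₀ y) eq′)

    isDist : ∀ x → Dist x p (d x)
    isDist x = walk _ x refl , λ _ → d-walk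

    connected : Connected C
    connected x y = walk⇒steps (proj₁ (isDist x)) ◅◅ steps-sym (walk⇒steps (proj₁ (isDist y)))

module FrameV {N : ℕ} (F : Frame N) where
  open Frame F

  SameV : Fin N → Fin N → Set
  SameV = Star (λ x y → y ≡ a x ⊎ y ≡ v x)

  sameV-ℓ : ∀ {x y} → SameV x y → ℓ x ≡ ℓ y
  sameV-ℓ ε = refl
  sameV-ℓ (inj₁ refl ◅ s) = sym (ℓ-a _) ∙ sameV-ℓ s
  sameV-ℓ (inj₂ refl ◅ s) = sym (ℓ-v _) ∙ sameV-ℓ s

  record Pointed (point : Fin N) : Set where
    no-eta-equality
    field
      ℓ-point : ℓ point ≡ 0
      ℓ-zero  : ∀ x → ℓ x ≡ 0 → SameV x point
      ℓ-suc   : ∀ x k → ℓ x ≡ suc k → ∃[ y ] (SameV x y × slope y ≡ fall)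

module Distances {N : ℕ} (F : Frame N) where
  open Frame F
  open FrameV F
  open FrameMaps F

  module OnMap {t : Fin N → Fin N} (m : MapMatching t) {point : Fin N} (P : Pointed point) where
    open Matching m
    open Pointed P

    labelling : MapFacts.Labelling (mapM m) point ℓ
    labelling = record
      { d-α₁ = ℓ-a ; d-α₂ = ℓ-v
      ; d-α₀ = λ x → slope-cases x
          (λ eq → ℕ.≤-trans (ℕ.≤-reflexive (cong ℓ (on-flat eq) ∙ ℓ-τ x)) (ℕ.n≤1+n _))
          (λ eq → ℕ.≤-reflexive (drop (rise⇒fall eq) ∙ cong (suc ∘ ℓ) (inv x)))
          (λ eq → ℕ.≤-trans (ℕ.n≤1+n _) (ℕ.≤-trans (ℕ.≤-reflexive (sym (drop eq))) (ℕ.n≤1+n _)))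
      ; d-point = ℓ-point ; zero-V = ℓ-zero
      ; descent = λ x k eq → let (y , s , f) = ℓ-suc x k eq in
          y , s , ℕ.suc-injective (sym (drop f) ∙ sym (sameV-ℓ s) ∙ eq) }

  module OnQuad {z : Fin N → Fin N} (m : QuadMatching z) where
    open Matching m
    open Quad m
    open MapFacts mapQ using (α₁-V; α₂-V)

    label : Fin (N + N) → ℕ
    label = onFlags ℓ (suc ∘ ℓ)

    label-lo : ∀ x → label (lo x) ≡ ℓ x
    label-lo = on-lo ℓ (suc ∘ ℓ)

    label-up : ∀ x → label (up x) ≡ suc (ℓ x)
    label-up = on-up ℓ (suc ∘ ℓ)

    open CMap mapQ using () renaming (SameV to SameVQ)

    α₁-to : ∀ {p q} → β₁ p ≡ q → SameVQ p q
    α₁-to eq = inj₁ (sym eq) ◅ ε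

    α₂-to : ∀ {p q} → β₂ p ≡ q → SameVQ p q
    α₂-to eq = inj₂ (sym eq) ◅ ε

    β₁-up-¬rise : ∀ {x} → ¬ Rise x → β₁ (up x) ≡ up (τ x)
    β₁-up-¬rise {x} ¬r = slope-cases x (β₁-up flat) (λ r → ⊥-elim (¬r r)) (β₁-up fall)

    conn⇒sameV : ∀ {x y} → Conn x y → SameVQ (up x) (up y)
    conn⇒sameV ε = ε
    conn⇒sameV (inj₁ refl ◅ c) = α₂-to (β₂-up _) ◅◅ conn⇒sameV c
    conn⇒sameV (inj₂ (¬r , refl) ◅ c) = α₁-to (β₁-up-¬rise ¬r) ◅◅ conn⇒sameV c

    -- At a fall, turning passes to the upper flags, runs through the segment from `z x` and comes
    -- back at `v x`, because `z` carries `v` to `seg`.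
    v-sameV : ∀ x → SameVQ (lo x) (lo (v x))
    v-sameV x = slope-cases x (λ eq → α₁-to (β₁-lo flat eq)) (λ eq → α₁-to (β₁-lo rise eq))
      (λ eq → α₁-to (β₁-lo fall eq)
        ◅◅ conn⇒sameV (Seg⇒Conn (seg-Seg (fall⇒rise eq)))
        ◅◅ α₁-to (cong (β₁ ∘ up) (sym (mv eq)) ∙
             β₁-up rise (fall⇒rise (slope-v x ∙ eq)) ∙ cong lo (inv (v x))))

    sameV⇒ : ∀ {x y} → SameV x y → SameVQ (lo x) (lo y)
    sameV⇒ ε = ε
    sameV⇒ (inj₁ refl ◅ s) = α₂-to (β₂-lo _) ◅◅ sameV⇒ s
    sameV⇒ (inj₂ refl ◅ s) = v-sameV _ ◅◅ sameV⇒ s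

    -- Invariant for the converse: an upper flag around the vertex lies in the run of descending
    -- edges entered from some falling flag `y`.
    data Reach (x : Fin N) (p : Fin (N + N)) : Set where
      at-lo : ∀ {y} → p ≡ lo y → SameV x y → Reach x p
      at-up : ∀ {y u} → p ≡ up u → slope y ≡ fall → SameV x y → Conn (z y) u → Reach x p

    a-V : ∀ {x} → SameV x (a x)
    a-V = inj₁ refl ◅ ε

    v-V : ∀ {x} → SameV x (v x)
    v-V = inj₂ refl ◅ ε

    reach-β₂ : ∀ {x p} → Reach x p → Reach x (β₂ p)
    reach-β₂ (at-lo refl s)     = at-lo (β₂-lo _) (s ◅◅ a-V)
    reach-β₂ (at-up refl f s c) = at-up (β₂-up _) f s (c ◅◅ inj₁ refl ◅ ε)

    reach-β₁ : ∀ {x p} → Reach x p → Reach x (β₁ p)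
    reach-β₁ (at-lo {y} refl s) = slope-cases y
      (λ eq → at-lo (β₁-lo flat eq) (s ◅◅ v-V))
      (λ eq → at-lo (β₁-lo rise eq) (s ◅◅ v-V))
      (λ eq → at-up (β₁-lo fall eq) eq s ε)
    reach-β₁ {x} (at-up {y} {u} refl f s c) = slope-cases u
      (λ eq → at-up (β₁-up flat eq) f s (c ◅◅ inj₂ ((λ r → λ-flat (sym eq ∙ r)) , refl) ◅ ε))
      -- The run has two ends: leaving it at `z y` leads back to `y`, leaving it at `seg (z y)`
      -- leads to `v y`.
      (λ eq → at-lo (β₁-up rise eq) (s ◅◅ rising (conn-end (fall⇒rise f) eq c)))
      (λ eq → at-up (β₁-up fall eq) f s (c ◅◅ inj₂ ((λ r → λ-fall (sym eq ∙ r)) , refl) ◅ ε))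
      where
      λ-flat : flat ≢ rise
      λ-flat ()
      λ-fall : fall ≢ rise
      λ-fall ()
      rising : u ≡ z y ⊎ u ≡ seg (z y) → SameV y (z u)
      rising (inj₁ refl) = subst (SameV y) (sym (inv y)) ε
      rising (inj₂ refl) = subst (SameV y) (sym (inv (v y)) ∙ cong z (mv f)) v-V

    reach : ∀ {x p q} → Reach x p → SameVQ p q → Reach x q
    reach r ε = r
    reach r (inj₁ refl ◅ s) = reach (reach-β₁ r) s
    reach r (inj₂ refl ◅ s) = reach (reach-β₂ r) s

    sameV⇐ : ∀ {x y} → SameVQ (lo x) (lo y) → SameV x y
    sameV⇐ {x} {y} s with reach (at-lo refl ε) s
    ... | at-lo eq s′ = subst (SameV x) (sym (lo-inj eq)) s′
    ... | at-up eq _ _ _ = ⊥-elim (up≢lo (sym eq))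

    label-β₁ : ∀ p → label (β₁ p) ≡ label p
    label-β₁ = flag-elim _
      (λ x → slope-cases x
          (λ eq → cong label (β₁-lo flat eq) ∙ label-lo _ ∙ ℓ-v x)
          (λ eq → cong label (β₁-lo rise eq) ∙ label-lo _ ∙ ℓ-v x)
          (λ eq → cong label (β₁-lo fall eq) ∙ label-up _ ∙ sym (drop eq)) ∙
        sym (label-lo x))
      (λ x → slope-cases x
          (λ eq → cong label (β₁-up flat eq) ∙ label-up _ ∙ cong suc (ℓ-τ x))
          (λ eq → cong label (β₁-up rise eq) ∙
            label-lo _ ∙ drop (rise⇒fall eq) ∙ cong (suc ∘ ℓ) (inv x))
          (λ eq → cong label (β₁-up fall eq) ∙ label-up _ ∙ cong suc (ℓ-τ x)) ∙
        sym (label-up x))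

    label-β₂ : ∀ p → label (β₂ p) ≡ label p
    label-β₂ = flag-elim _
      (λ x → cong label (β₂-lo x) ∙ label-lo _ ∙ ℓ-a x ∙ sym (label-lo x))
      (λ x → cong label (β₂-up x) ∙ label-up _ ∙ cong suc (ℓ-a x) ∙ sym (label-up x))

    label-β₀-lo : ∀ x → label (β₀ (lo x)) ≡ suc (ℓ x)
    label-β₀-lo x = cong label (β₀-lo x) ∙ label-up x

    label-β₀-up : ∀ x → label (β₀ (up x)) ≡ ℓ x
    label-β₀-up x = cong label (β₀-up x) ∙ label-lo x

    module _ {point : Fin N} (P : Pointed point) where
      open Pointed P

      descent-lo : ∀ x k → label (lo x) ≡ suc k → ∃[ q ] (SameVQ (lo x) q × label (β₀ q) ≡ k)
      descent-lo x k eq with ℓ-suc x k (sym (label-lo x) ∙ eq)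
      ... | y , s , f = up (z y) , sameV⇒ s ◅◅ α₁-to (β₁-lo fall f) ,
        label-β₀-up (z y) ∙ ℕ.suc-injective
          (sym (drop f) ∙ sym (sameV-ℓ s) ∙ sym (label-lo x) ∙ eq)

      labelling : MapFacts.Labelling mapQ (lo point) label
      labelling = record
        { d-α₁ = label-β₁ ; d-α₂ = label-β₂
        ; d-α₀ = flag-elim _
            (λ x → ℕ.≤-reflexive (label-β₀-lo x ∙ cong suc (sym (label-lo x))))
            (λ x → ℕ.≤-trans (ℕ.≤-reflexive (label-β₀-up x))
              (ℕ.≤-trans (ℕ.n≤1+n _) (ℕ.≤-trans (ℕ.≤-reflexive (sym (label-up x))) (ℕ.n≤1+n _))))
        ; d-point = label-lo _ ∙ ℓ-point
        ; zero-V = flag-elim _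
            (λ x eq → sameV⇒ (ℓ-zero x (sym (label-lo x) ∙ eq)))
            (λ x eq → ⊥-elim (ℕ.0≢1+n (sym eq ∙ label-up x)))
        ; descent = flag-elim _ descent-lo
            (λ x k eq → up x , ε , label-β₀-up x ∙
              ℕ.suc-injective (sym (label-up x) ∙ eq)) }

    bipartite : CMap.IsBipartite mapQ
    bipartite = even ∘ label , (λ x → cong even (label-β₁ x)) , (λ x → cong even (label-β₂ x)) ,
      flag-elim _
        (λ x p → not-≢ (even (ℓ x)) (cong even (sym (label-β₀-lo x)) ∙ p ∙ cong even (label-lo x)))
        (λ x p → not-≢ (even (ℓ x)) (sym (cong even (sym (label-β₀-up x)) ∙ p ∙ cong even (label-up x))))

    φ : Fin (N + N) → Fin (N + N)
    φ = CMap.φ mapQ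

    λ<4 : ∀ {A : ℕ → Set} → A 1 → A 2 → A 3 → ∀ k → 0 < k → k < 4 → A k
    λ<4 p q r (suc zero) _ _ = p
    λ<4 p q r (suc (suc zero)) _ _ = q
    λ<4 p q r (suc (suc (suc zero))) _ _ = r
    λ<4 p q r (suc (suc (suc (suc k)))) _ (s≤s (s≤s (s≤s (s≤s ()))))

    four-cycle : ∀ {p q r s} → φ p ≡ q → φ q ≡ r → φ r ≡ s → φ s ≡ p →
      q ≢ p → r ≢ p → s ≢ p → CMap.FaceDegree mapQ p 4
    four-cycle {p} refl refl refl eq n₁ n₂ n₃ = s≤s z≤n , eq , λ<4 {λ k → CMap.φ^ mapQ k p ≢ p} n₁ n₂ n₃

    φ-lo : ∀ {x y} → β₁ (lo x) ≡ lo y → φ (lo x) ≡ up y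
    φ-lo eq = cong β₀ eq ∙ β₀-lo _

    φ-lo-up : ∀ {x y} → β₁ (lo x) ≡ up y → φ (lo x) ≡ lo y
    φ-lo-up eq = cong β₀ eq ∙ β₀-up _

    φ-up : ∀ {x y} → β₁ (up x) ≡ up y → φ (up x) ≡ lo y
    φ-up eq = cong β₀ eq ∙ β₀-up _

    φ-up-lo : ∀ {x y} → β₁ (up x) ≡ lo y → φ (up x) ≡ up y
    φ-up-lo eq = cong β₀ eq ∙ β₀-lo _

    differ : ∀ {x y s} → slope x ≡ s → opp s ≢ s → slope y ≡ opp s → y ≢ x
    differ eq ne eq′ p = ne (sym eq′ ∙ cong slope p ∙ eq)

    -- A flat face closes up because `v` and `τ` commute, the others because `z` carries `τ` to `τ`,
    -- which is `v` on rising flags.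
    quadrangulation : CMap.IsQuadrangulation mapQ
    quadrangulation = flag-elim _
      (λ x → slope-cases x (lo-flat x) (lo-rise x) (lo-fall x))
      (λ x → slope-cases x (up-flat x) (up-rise x) (up-fall x))
      where
      vτvτ : ∀ {x} → slope x ≡ flat → v (τ (v (τ x))) ≡ x
      vτvτ eq = cong (v ∘ τ) (flat-comm eq) ∙ cong v (τ-inv _) ∙ v-inv _
      τvτv : ∀ {x} → slope x ≡ flat → τ (v (τ (v x))) ≡ x
      τvτv eq = cong (τ ∘ v) (sym (flat-comm eq)) ∙ cong τ (v-inv _) ∙ τ-inv _
      τzvz : ∀ {x} → Rise x → τ (z (v x)) ≡ z x
      τzvz {x} eq = cong (τ ∘ z) (sym (τ-rise eq) ∙ cong τ (sym (inv x))) ∙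
        cong (τ ∘ z) (sym (mτ (rise⇒fall eq))) ∙ cong τ (inv _) ∙ τ-inv _
      zvzτ : ∀ {x} → slope x ≡ fall → z (v (z x)) ≡ τ x
      zvzτ {x} eq = cong z (sym (τ-rise (fall⇒rise eq)) ∙ sym (mτ eq)) ∙ inv _

      lo-flat : ∀ x → slope x ≡ flat → CMap.FaceDegree mapQ (lo x) 4
      lo-flat x eq = four-cycle
        (φ-lo (β₁-lo flat eq)) (φ-up (β₁-up flat (v-slope eq)))
        (φ-lo (β₁-lo flat (τ-slope (v-slope eq))))
        (φ-up (β₁-up flat (v-slope (τ-slope (v-slope eq)))) ∙ cong lo (τvτv eq))
        up≢lo (λ p → flat-fpf eq (flat-comm eq ∙ lo-inj p)) up≢lo
      up-flat : ∀ x → slope x ≡ flat → CMap.FaceDegree mapQ (up x) 4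
      up-flat x eq = four-cycle
        (φ-up (β₁-up flat eq)) (φ-lo (β₁-lo flat (τ-slope eq)))
        (φ-up (β₁-up flat (v-slope (τ-slope eq))))
        (φ-lo (β₁-lo flat (τ-slope (v-slope (τ-slope eq)))) ∙ cong up (vτvτ eq))
        (up≢lo ∘ sym) (λ p → flat-fpf eq (up-inj p)) (up≢lo ∘ sym)
      lo-rise : ∀ x → slope x ≡ rise → CMap.FaceDegree mapQ (lo x) 4
      lo-rise x eq = four-cycle
        (φ-lo (β₁-lo rise eq)) (φ-up-lo (β₁-up rise (v-slope eq)))
        (φ-up (β₁-up fall (rise⇒fall (v-slope eq))))
        (φ-lo-up (β₁-lo fall (τ-slope (rise⇒fall (v-slope eq))) ∙ cong up (cong z (τzvz eq) ∙ inv x)) ∙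
          refl)
        up≢lo up≢lo (λ p → differ eq (λ ()) (τ-slope (rise⇒fall (v-slope eq))) (lo-inj p))
      lo-fall : ∀ x → slope x ≡ fall → CMap.FaceDegree mapQ (lo x) 4
      lo-fall x eq = four-cycle
        (φ-lo-up (β₁-lo fall eq)) (φ-lo (β₁-lo rise (fall⇒rise eq)))
        (φ-up-lo (β₁-up rise (v-slope (fall⇒rise eq)) ∙ cong lo (zvzτ eq)))
        (φ-up (β₁-up fall (τ-slope eq)) ∙ cong lo (τ-inv x))
        (λ p → differ eq (λ ()) (fall⇒rise eq) (lo-inj p)) up≢lo up≢lo
      up-rise : ∀ x → slope x ≡ rise → CMap.FaceDegree mapQ (up x) 4
      up-rise x eq = four-cycle
        (φ-up-lo (β₁-up rise eq)) (φ-up (β₁-up fall (rise⇒fall eq)))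
        (φ-lo-up (β₁-lo fall (τ-slope (rise⇒fall eq))))
        (φ-lo (β₁-lo rise (fall⇒rise (τ-slope (rise⇒fall eq)))) ∙
          cong up (cong v (mτ (rise⇒fall eq) ∙ cong τ (inv x) ∙ τ-rise eq) ∙ v-inv x))
        (λ p → differ eq (λ ()) (rise⇒fall eq) (up-inj p)) (up≢lo ∘ sym) (up≢lo ∘ sym)
      up-fall : ∀ x → slope x ≡ fall → CMap.FaceDegree mapQ (up x) 4
      up-fall x eq = four-cycle
        (φ-up (β₁-up fall eq)) (φ-lo-up (β₁-lo fall (τ-slope eq)))
        (φ-lo (β₁-lo rise (fall⇒rise (τ-slope eq))))
        (φ-up-lo (β₁-up rise (v-slope (fall⇒rise (τ-slope eq)))) ∙
          cong up (zvzτ (τ-slope eq) ∙ τ-inv x))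
        (up≢lo ∘ sym) (up≢lo ∘ sym) (λ p → differ eq (λ ()) (v-slope (fall⇒rise (τ-slope eq))) (up-inj p))

-- Counting classes

record SetoidEquivalence {N′ N : ℕ} (_~′_ : Fin N′ → Fin N′ → Set) (P′ : Fin N′ → Set)
  (_~_ : Fin N → Fin N → Set) (P : Fin N → Set) (f : Fin N′ → Fin N) : Set where
  field
    preserves : ∀ {x} → P′ x → P (f x)
    respects  : ∀ {x y} → P′ x → P′ y → x ~′ y → f x ~ f y
    reflects  : ∀ {x y} → P′ x → P′ y → f x ~ f y → x ~′ y
    covers    : ∀ {x} → P x → ∃[ y ] (P′ y × x ~ f y)

module Classes {N : ℕ} (_~_ : Fin N → Fin N → Set)
  (~-sym : ∀ {x y} → x ~ y → y ~ x) (~-trans : ∀ {x y z} → x ~ y → y ~ z → x ~ z) where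

  module _ {N′ : ℕ} {_~′_ : Fin N′ → Fin N′ → Set} {P′ : Fin N′ → Set} {P : Fin N → Set}
    {f : Fin N′ → Fin N} (e : SetoidEquivalence _~′_ P′ _~_ P f) where
    open SetoidEquivalence e

    count-forward : ∀ {k} → ClassCount _~′_ P′ k → ClassCount _~_ P k
    count-forward (rep , holds , sep , cover) = f ∘ rep , preserves ∘ holds ,
      (λ i j s → sep i j (reflects (holds i) (holds j) s)) ,
      λ x p → let (y , p′ , s) = covers p ; (i , s′) = cover y p′ in
        i , ~-trans s (respects p′ (holds i) s′)

    count-backward : ∀ {k} → ClassCount _~_ P k → ClassCount _~′_ P′ k
    count-backward (rep , holds , sep , cover) = rep′ , holds′ ,
      (λ i j s → sep i j (~-trans (rel i) (~-trans (respects (holds′ i) (holds′ j) s) (~-sym (rel j))))) ,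
      λ y p′ → let (i , s) = cover (f y) (preserves p′) in
        i , reflects p′ (holds′ i) (~-trans s (rel i))
      where
      rep′ : _ → Fin N′
      rep′ i = proj₁ (covers (holds i))
      holds′ : ∀ i → P′ (rep′ i)
      holds′ i = proj₁ (proj₂ (covers (holds i)))
      rel : ∀ i → rep i ~ f (rep′ i)
      rel i = proj₂ (proj₂ (covers (holds i)))

  count-unique : ∀ {P j k} → ClassCount _~_ P j → ClassCount _~_ P k → j ≡ k
  count-unique {P} (rep , holds , sep , cover) (rep′ , holds′ , sep′ , cover′) =
    cantor-schröder-bernstein {f = λ i → proj₁ (cover′ (rep i) (holds i))}
      {g = λ i → proj₁ (cover (rep′ i) (holds′ i))}
      (λ {i} {j} → inj sep rep′ (λ i → cover′ (rep i) (holds i)) i j)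
      (λ {i} {j} → inj sep′ rep (λ i → cover (rep′ i) (holds′ i)) i j)
    where
    inj : ∀ {m n} {r : Fin m → Fin N} → (∀ i j → r i ~ r j → i ≡ j) → (r′ : Fin n → Fin N) →
          (c : ∀ i → ∃[ l ] (r i ~ r′ l)) → ∀ i j → proj₁ (c i) ≡ proj₁ (c j) → i ≡ j
    inj {r = r} s r′ c i j eq =
      s i j (~-trans (proj₂ (c i)) (~-sym (subst (λ l → r j ~ r′ l) (sym eq) (proj₂ (c j)))))

  count-exists : (∀ x y → Dec (x ~ y)) → (∀ {x} → x ~ x) → ∃[ k ] ClassCount _~_ (λ _ → ⊤) k
  count-exists ~? ~-refl = size , elt , (λ _ → tt) , sep , cover
    where
    -- Each class is represented by its least element, which makes the representatives a decidable
    -- subset.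
    Least : Fin N → Set
    Least x = ∀ y → toℕ y < toℕ x → ¬ x ~ y
    least? : ∀ x → Dec (Least x)
    least? x = all? (λ y → (toℕ y ℕ.<? toℕ x) →-dec ¬? (~? x y))
    open Enumeration (enumerate least?)
    sep : ∀ i j → elt i ~ elt j → i ≡ j
    sep i j s = elt-inj i j (toℕ-injective (ℕ.≤-antisym
      (ℕ.≮⇒≥ (λ lt → holds i (elt j) lt s))
      (ℕ.≮⇒≥ (λ lt → holds j (elt i) lt (~-sym s)))))
    cover : ∀ x → ⊤ → ∃[ i ] (x ~ elt i)
    cover x _ with least (λ k → any? (λ y → (toℕ y ℕ.≟ k) ×-dec ~? x y)) (toℕ x) (x , refl , ~-refl)
    ... | k , _ , (y , eq , s) , min
      with find y (λ w lt s′ → min (toℕ w) (subst (toℕ w <_) eq lt) (w , refl , ~-trans s s′))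
    ... | i , refl = i , s

  count-sum : ∀ {P P′ j k} → (∀ x → P x ⊎ P′ x) → (∀ {x y} → P x → P′ y → ¬ x ~ y) →
    ClassCount _~_ P j → ClassCount _~_ P′ k → ClassCount _~_ (λ _ → ⊤) (j + k)
  count-sum {P} {P′} {j} {k} either disjoint (rep , holds , sep , cover) (rep′ , holds′ , sep′ , cover′) =
    both ∘ splitAt j , (λ _ → tt) ,
    (λ p q s → sym (join-splitAt j k p) ∙
      cong (join j k) (both-sep (splitAt j p) (splitAt j q) s) ∙ join-splitAt j k q) ,
    λ x _ → [ (λ p → let (i , s) = cover x p in
                i ↑ˡ k , subst (λ w → x ~ both w) (sym (splitAt-↑ˡ j i k)) s)
            , (λ p → let (i , s) = cover′ x p in
                j ↑ʳ i , subst (λ w → x ~ both w) (sym (splitAt-↑ʳ j k i)) s)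
            ]′ (either x)
    where
    both : Fin j ⊎ Fin k → Fin N
    both = [ rep , rep′ ]
    both-sep : ∀ p q → both p ~ both q → p ≡ q
    both-sep (inj₁ i) (inj₁ l) s = cong inj₁ (sep i l s)
    both-sep (inj₁ i) (inj₂ l) s = ⊥-elim (disjoint (holds i) (holds′ l) s)
    both-sep (inj₂ i) (inj₁ l) s = ⊥-elim (disjoint (holds l) (holds′ i) (~-sym s))
    both-sep (inj₂ i) (inj₂ l) s = cong inj₂ (sep′ i l s)

  count-cong : ∀ {P P′ k} → (∀ {x} → P x → P′ x) → (∀ {x} → P′ x → P x) →
    ClassCount _~_ P k → ClassCount _~_ P′ k
  count-cong to from (rep , holds , sep , cover) = rep , to ∘ holds , sep , λ x p → cover x (from p)

module EdgeFlags (C : CMap) where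
  open CMap C

  nth : Fin N → Fin 4 → Fin N
  nth x zero                   = x
  nth x (suc zero)             = α₂ x
  nth x (suc (suc zero))       = α₀ x
  nth x (suc (suc (suc zero))) = α₀ (α₂ x)

  pattern 0F = zero
  pattern 1F = suc zero
  pattern 2F = suc (suc zero)
  pattern 3F = suc (suc (suc zero))

  nth-α₀ : ∀ x i → ∃[ j ] α₀ (nth x i) ≡ nth x j
  nth-α₀ x 0F = 2F , refl
  nth-α₀ x 1F = 3F , refl
  nth-α₀ x 2F = 0F , inv₀ x
  nth-α₀ x 3F = 1F , inv₀ _

  nth-α₂ : ∀ x i → ∃[ j ] α₂ (nth x i) ≡ nth x j
  nth-α₂ x 0F = 1F , refl
  nth-α₂ x 1F = 0F , inv₂ x
  nth-α₂ x 2F = 3F , sym (comm₀₂ x)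
  nth-α₂ x 3F = 2F , sym (comm₀₂ _) ∙ cong α₀ (inv₂ x)

  sameE⇒nth : ∀ {x y} → SameE x y → ∃[ i ] y ≡ nth x i
  sameE⇒nth {x} s = go s (0F , refl)
    where
    go : ∀ {w y} → SameE w y → ∃[ i ] w ≡ nth x i → ∃[ i ] y ≡ nth x i
    go ε p = p
    go (inj₁ refl ◅ s) (i , refl) = go s (nth-α₀ x i)
    go (inj₂ refl ◅ s) (i , refl) = go s (nth-α₂ x i)

  nth⇒sameE : ∀ x i → SameE x (nth x i)
  nth⇒sameE x 0F = ε
  nth⇒sameE x 1F = inj₂ refl ◅ ε
  nth⇒sameE x 2F = inj₁ refl ◅ ε
  nth⇒sameE x 3F = inj₂ refl ◅ inj₁ refl ◅ ε

  α₀≢α₂ : ∀ x → α₀ x ≢ α₂ x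
  α₀≢α₂ x eq = fpf₀₂ x (cong α₀ (sym eq) ∙ inv₀ x)

  nth-inj : ∀ x i j → nth x i ≡ nth x j → i ≡ j
  nth-inj x 0F 0F eq = refl
  nth-inj x 0F 1F eq = ⊥-elim (fpf₂ x (sym eq))
  nth-inj x 0F 2F eq = ⊥-elim (fpf₀ x (sym eq))
  nth-inj x 0F 3F eq = ⊥-elim (fpf₀₂ x (sym eq))
  nth-inj x 1F 0F eq = ⊥-elim (fpf₂ x eq)
  nth-inj x 1F 1F eq = refl
  nth-inj x 1F 2F eq = ⊥-elim (α₀≢α₂ x (sym eq))
  nth-inj x 1F 3F eq = ⊥-elim (fpf₀ _ (sym eq))
  nth-inj x 2F 0F eq = ⊥-elim (fpf₀ x eq)
  nth-inj x 2F 1F eq = ⊥-elim (α₀≢α₂ x eq)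
  nth-inj x 2F 2F eq = refl
  nth-inj x 2F 3F eq = ⊥-elim (fpf₂ x (sym (involutive⇒injective α₀ inv₀ eq)))
  nth-inj x 3F 0F eq = ⊥-elim (fpf₀₂ x eq)
  nth-inj x 3F 1F eq = ⊥-elim (fpf₀ _ eq)
  nth-inj x 3F 2F eq = ⊥-elim (fpf₂ x (involutive⇒injective α₀ inv₀ eq))
  nth-inj x 3F 3F eq = refl

  -- The four flags of an edge differ because `α₀`, `α₂` and `α₀ ∘ α₂` have no fixed point. This
  -- compares numbers of edges through numbers of flags, and bounds the size of a map with a given
  -- number of edges.
  edges*4 : ∀ {k} → NumEdges k → N ≡ k * 4
  edges*4 {k} (rep , _ , sep , cover) = cantor-schröder-bernstein
    {f = code} {g = λ p → flag (remQuot 4 p)} code-inj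
    (λ {p} {q} eq → sym (combine-remQuot {k} 4 p) ∙
      cong (λ (i , j) → combine i j) (flag-inj (remQuot {k} 4 p) (remQuot {k} 4 q) eq) ∙
        combine-remQuot {k} 4 q)
    where
    flag : Fin k × Fin 4 → Fin N
    flag (i , j) = nth (rep i) j
    idx : ∀ x → Σ[ p ∈ Fin k × Fin 4 ] flag p ≡ x
    idx x with cover x tt
    ... | i , s with sameE⇒nth (MapFacts.sameE-sym C s)
    ... | j , eq = (i , j) , sym eq
    code : Fin N → Fin (k * 4)
    code x = combine (proj₁ (proj₁ (idx x))) (proj₂ (proj₁ (idx x)))
    code-inj : ∀ {x y} → code x ≡ code y → x ≡ y
    code-inj {x} {y} eq with combine-injective _ _ _ _ eq
    ... | p , q = sym (proj₂ (idx x)) ∙ cong₂ (λ i j → flag (i , j)) p q ∙ proj₂ (idx y)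
    flag-inj : ∀ p q → flag p ≡ flag q → p ≡ q
    flag-inj (i , j) (i′ , j′) eq with sep i i′
      (nth⇒sameE (rep i) j ◅◅ subst (λ w → SameE w (rep i′)) (sym eq) (MapFacts.sameE-sym C (nth⇒sameE (rep i′) j′)))
    ... | refl = cong (i ,_) (nth-inj (rep i) j j′ eq)

-- Vertices, edges, faces and orientability

bounded : ∀ {N} (f : Fin N → ℕ) → ∃[ B ] (∀ x → f x ≤ B)
bounded {zero} f = 0 , λ ()
bounded {suc N} f with bounded (f ∘ suc)
... | B , le = f zero + B , bound
  where
  bound : ∀ x → f x ≤ f zero + B
  bound zero    = ℕ.m≤m+n _ _
  bound (suc x) = ℕ.≤-trans (le x) (ℕ.m≤n+m _ _)

flat≢rise : ∀ {s} → s ≡ flat → s ≢ rise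
flat≢rise refl ()

fall≢rise : ∀ {s} → s ≡ fall → s ≢ rise
fall≢rise refl ()

flat≢fall : ∀ {s} → s ≡ flat → s ≢ fall
flat≢fall refl ()

-- The quadrangulation and the map built on a frame from z and an orientation o of the level loops.
module Pair {N : ℕ} (F : Frame N) {z : Fin N → Fin N} (m : Frame.QuadMatching F z)
  {o : Fin N → Bool} (O : Frame.Orientation F o) where

  open Frame F
  open FrameV F
  open FrameMaps F
  open Matching m
  open Twist O
  open Orientation O renaming (flip-a to o-a; flip-b to o-τ)
  open TwistMatching O {ρ′ = τ} {σ′ = seg} m θ-seg θ-τ public using (t) renaming (matching to mt)
  module T = Matching mt
  open Quad m

  M Q : CMap
  M = mapM mt
  Q = mapQ

  open CMap Q using () renaming (SameV to SameVQ; SameF to SameFQ; SameE to SameEQ)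
  open CMap M using () renaming (SameF to SameFM; SameE to SameEM)
  open Distances.OnQuad F m

  t-fall : ∀ {x} → slope x ≡ fall → t x ≡ θ o (z x)
  t-fall = twist-fall

  -- On low flags `z` at a fall is a composite of two generators and keeps the colour, whereas `τ`
  -- and `seg` are odd. Hence `t`, which is `z` followed by one of them, flips it.
  orientable⇒ : CMap.Orientable Q → CMap.Orientable M
  orientable⇒ (c , c₀ , c₁ , c₂) = c′ ,
    (λ x p → not-≢ _ (sym (flip-t x) ∙ p)) ,
    (λ x p → not-≢ _ (sym (flip-a x) ∙ p)) , (λ x p → not-≢ _ (sym (flip-v x) ∙ p))
    where
    c′ : Fin N → Bool
    c′ x = c (lo x)
    flip₁ : ∀ {p q} → β₁ p ≡ q → c q ≡ not (c p)
    flip₁ {p} eq = cong c (sym eq) ∙ flip-≡ (c₁ p)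
    c-up : ∀ x → c (up x) ≡ not (c′ x)
    c-up x = cong c (sym (β₀-lo x)) ∙ flip-≡ (c₀ (lo x))
    flip-a : ∀ x → c′ (a x) ≡ not (c′ x)
    flip-a x = cong c (sym (β₂-lo x)) ∙ flip-≡ (c₂ (lo x))
    keep-z : ∀ {x} → slope x ≡ fall → c′ (z x) ≡ c′ x
    keep-z {x} eq = not-injective (sym (c-up (z x)) ∙ flip₁ (β₁-lo fall eq))
    up-τ : ∀ {x} → c (up (τ x)) ≡ not (c (up x)) → c′ (τ x) ≡ not (c′ x)
    up-τ {x} eq = not-injective (sym (c-up (τ x)) ∙ eq ∙ cong not (c-up x))
    flip-τ : ∀ x → c′ (τ x) ≡ not (c′ x)
    flip-τ x = slope-cases x
      (λ eq → up-τ (flip₁ (β₁-up flat eq)))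
      (λ eq → cong c′ (τ-rise eq) ∙ flip₁ (β₁-lo rise eq))
      (λ eq → up-τ (flip₁ (β₁-up fall eq)))
    C : Orientation c′
    C = record { flip-a = flip-a ; flip-b = flip-τ }
    flip-v : ∀ x → c′ (v x) ≡ not (c′ x)
    flip-v x = slope-cases x (λ eq → flip₁ (β₁-lo flat eq)) (λ eq → flip₁ (β₁-lo rise eq))
      (λ eq → sym (keep-z (v-slope eq)) ∙ cong c′ (mv eq) ∙
        seg-o C (fall⇒rise eq) ∙ cong not (keep-z eq))
    flip-θ : ∀ {u} → Rise u → c′ (θ o u) ≡ not (c′ u)
    flip-θ {u} r with o u
    ... | true  = flip-τ u
    ... | false = seg-o C r
    flip-fall : ∀ {x} → slope x ≡ fall → c′ (t x) ≡ not (c′ x)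
    flip-fall eq = cong c′ (t-fall eq) ∙ flip-θ (fall⇒rise eq) ∙ cong not (keep-z eq)
    flip-t : ∀ x → c′ (t x) ≡ not (c′ x)
    flip-t x = slope-cases x (λ eq → cong c′ (T.on-flat eq) ∙ flip-τ x)
      (λ eq → sym (not-involutive _) ∙
        cong not (sym (flip-fall (T.rise⇒fall eq)) ∙ cong c′ (T.inv x)))
      flip-fall

  -- `τ` is not a generator of `M`: it equals `t` at flat flags and `v` at rises, and at a fall `t`
  -- conjugates it to a segment one level lower. It is therefore shown to flip the colour by
  -- induction on the level.
  orientable⇐ : CMap.Orientable M → CMap.Orientable Q
  orientable⇐ (c , c₀ , c₁ , c₂) = c′ ,
    flag-elim _
      (λ x → flipped (β₀-lo x) (on-up c (not ∘ c) x ∙ cong not (sym (on-lo c (not ∘ c) x))))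
      (λ x → flipped (β₀-up x) (on-lo c (not ∘ c) x ∙
               sym (not-involutive _) ∙ cong not (sym (on-up c (not ∘ c) x)))) ,
    flag-elim _
      (λ x → slope-cases x
        (λ eq → flipped (β₁-lo flat eq) (lo-lo (flip-≡ (c₂ x))))
        (λ eq → flipped (β₁-lo rise eq) (lo-lo (flip-≡ (c₂ x))))
        (λ eq → flipped (β₁-lo fall eq) (on-up c (not ∘ c) _ ∙
          cong not (keep-z eq ∙ sym (on-lo c (not ∘ c) x)))))
      (λ x → slope-cases x
        (λ eq → flipped (β₁-up flat eq) (up-up (flip-τ _ x refl)))
        (λ eq → flipped (β₁-up rise eq) (on-lo c (not ∘ c) _ ∙
          sym (keep-z (rise⇒fall eq)) ∙ cong c (inv x) ∙
            sym (not-involutive _) ∙ cong not (sym (on-up c (not ∘ c) x))))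
        (λ eq → flipped (β₁-up fall eq) (up-up (flip-τ _ x refl)))) ,
    flag-elim _
      (λ x → flipped (β₂-lo x) (lo-lo (flip-≡ (c₁ x))))
      (λ x → flipped (β₂-up x) (up-up (flip-≡ (c₁ x))))
    where
    c′ : Fin (N + N) → Bool
    c′ = onFlags c (not ∘ c)
    flipped : ∀ {p p′ q} → p ≡ q → c′ q ≡ not (c′ p′) → c′ p ≢ c′ p′
    flipped eq f p = not-≢ _ (sym f ∙ cong c′ (sym eq) ∙ p)
    lo-lo : ∀ {x y} → c y ≡ not (c x) → c′ (lo y) ≡ not (c′ (lo x))
    lo-lo eq = on-lo c (not ∘ c) _ ∙ eq ∙ cong not (sym (on-lo c (not ∘ c) _))
    up-up : ∀ {x y} → c y ≡ not (c x) → c′ (up y) ≡ not (c′ (up x))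
    up-up eq = on-up c (not ∘ c) _ ∙ cong not (eq ∙ sym (on-up c (not ∘ c) _))
    flip-τ : ∀ n x → ℓ x ≡ n → c (τ x) ≡ not (c x)
    flip-fall : ∀ n x → ℓ x ≡ n → slope x ≡ fall → c (τ x) ≡ not (c x)
    flip-τ n x eq = slope-cases x
      (λ s → cong c (sym (T.on-flat s)) ∙ flip-≡ (c₀ x))
      (λ s → cong c (τ-rise s) ∙ flip-≡ (c₂ x))
      (flip-fall n x eq)
    flip-fall zero x eq s = ⊥-elim (ℕ.0≢1+n (sym eq ∙ T.drop s))
    flip-fall (suc n) x eq s = not-injective (sym (flip-≡ (c₀ (τ x))) ∙
      cong c (T.mτ s) ∙ Seg-flip c (λ y → ℓ y ≡ n) (trans (ℓ-a _)) (trans (ℓ-τ _)) (λ {y} _ → flip-≡ (c₁ y))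
          (λ {y} i → flip-τ n y i) (ℕ.suc-injective (sym (T.drop s) ∙ eq))
          (seg-Seg (T.fall⇒rise s)) ∙
        cong not (flip-≡ (c₀ x)))
    C : Orientation c
    C = record { flip-a = λ x → flip-≡ (c₁ x) ; flip-b = λ x → flip-τ _ x refl }
    flip-θ : ∀ {u} → Rise u → c (θ o u) ≡ not (c u)
    flip-θ {u} r with o u
    ... | true  = flip-τ _ u refl
    ... | false = seg-o C r
    keep-z : ∀ {x} → slope x ≡ fall → c (z x) ≡ c x
    keep-z {x} eq = not-injective (sym (flip-θ (fall⇒rise eq)) ∙
      cong c (sym (t-fall eq)) ∙ flip-≡ (c₀ x))

  -- Faces of Q and edges of M are both represented by the flags in Key: flat ones, and one of
  -- the two falling flags x, τ x of a face, one of the two falling flags x, v x of an edge.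
  Key : Fin N → Set
  Key x = slope x ≡ flat ⊎ (slope x ≡ fall × o (z x) ≡ true)

  t-E : ∀ {x} → SameEM x (t x)
  t-E = inj₁ refl ◅ ε

  v-E : ∀ {x} → SameEM x (v x)
  v-E = inj₂ refl ◅ ε

  -- `z` carries `v` to `seg` and `τ` to `τ`, and both reverse `o`; so `o ∘ z` separates `x` from
  -- `v x` and also from `τ x`. One condition thus gives a transversal for edges and for faces at
  -- once.
  key-unique : ∀ {x y} → slope x ≡ fall → o (z x) ≡ true → Key y →
    y ≡ x ⊎ y ≡ v x ⊎ y ≡ τ x ⊎ Rise y → y ≡ x
  key-unique s oz k (inj₁ eq) = eq
  key-unique {x} s oz (inj₁ f) (inj₂ (inj₁ refl)) = ⊥-elim (flat≢fall (sym (slope-v x) ∙ f) s)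
  key-unique {x} s oz (inj₂ (_ , oz′)) (inj₂ (inj₁ refl)) =
    ⊥-elim (not-≢ true (sym (cong o (mv s) ∙ seg-o O (fall⇒rise s) ∙ cong not oz) ∙ oz′))
  key-unique {x} s oz (inj₁ f) (inj₂ (inj₂ (inj₁ refl))) = ⊥-elim (flat≢fall (sym (slope-τ x) ∙ f) s)
  key-unique {x} s oz (inj₂ (_ , oz′)) (inj₂ (inj₂ (inj₁ refl))) =
    ⊥-elim (not-≢ true (sym (cong o (mτ s) ∙ o-τ _ ∙ cong not oz) ∙ oz′))
  key-unique s oz (inj₁ f) (inj₂ (inj₂ (inj₂ r))) = ⊥-elim (flat≢rise f r)
  key-unique s oz (inj₂ (f , _)) (inj₂ (inj₂ (inj₂ r))) = ⊥-elim (fall≢rise f r)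

  edges : SetoidEquivalence SameEM Key SameEM (λ _ → ⊤) id
  edges = record
    { preserves = λ _ → tt ; respects = λ _ _ s → s ; reflects = λ _ _ s → s
    ; covers = λ {x} _ → slope-cases x (λ s → x , inj₁ s , ε)
        (λ s → let (y , k , e) = falling (T.rise⇒fall s) in y , k , t-E ◅◅ e)
        falling }
    where
    falling : ∀ {x} → slope x ≡ fall → ∃[ y ] (Key y × SameEM x y)
    falling {x} s with o (z x) in eq
    ... | true  = x , inj₂ (s , eq) , ε
    ... | false = v x , inj₂ (v-slope s ,
                    cong o (mv s) ∙ seg-o O (fall⇒rise s) ∙ cong not eq) , v-E

  faces : SetoidEquivalence SameEM Key SameFQ (λ _ → ⊤) lo
  faces = record
    { preserves = λ _ → tt ; respects = respects ; reflects = reflects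
    ; covers = λ {p} _ → flag-elim (λ p → ∃[ y ] (Key y × SameFQ p (lo y)))
        covers-lo (λ x → let (y , k , s) = covers-lo x in y , k , β₀-to (β₀-up x) ◅◅ s) p }
    where
    β₀-to : ∀ {p q} → β₀ p ≡ q → SameFQ p q
    β₀-to eq = inj₁ (sym eq) ◅ ε
    β₁-to : ∀ {p q} → β₁ p ≡ q → SameFQ p q
    β₁-to eq = inj₂ (sym eq) ◅ ε
    turn-τ : ∀ {x} → ¬ Rise x → SameFQ (lo x) (lo (τ x))
    turn-τ {x} ¬r = β₀-to (β₀-lo x) ◅◅ β₁-to (β₁-up-¬rise ¬r) ◅◅ β₀-to (β₀-up (τ x))
    covers-fall : ∀ {x} → slope x ≡ fall → ∃[ y ] (Key y × SameFQ (lo x) (lo y))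
    covers-fall {x} s with o (z x) in eq
    ... | true  = x , inj₂ (s , eq) , ε
    ... | false = τ x , inj₂ (τ-slope s ,
                    cong o (mτ s) ∙ o-τ _ ∙ cong not eq) , turn-τ (fall≢rise s)
    covers-lo : ∀ x → ∃[ y ] (Key y × SameFQ (lo x) (lo y))
    covers-lo x = slope-cases x (λ s → x , inj₁ s , ε)
      (λ s → let (y , k , e) = covers-fall (rise⇒fall s) in
         y , k , β₀-to (β₀-lo x) ◅◅ β₁-to (β₁-up rise s) ◅◅ e)
      covers-fall

    open EdgeFlags M using (sameE⇒nth; nth)

    respects : ∀ {x y} → Key x → Key y → SameEM x y → SameFQ (lo x) (lo y)
    respects {x} (inj₂ (s , oz)) ky e with sameE⇒nth e
    ... | i , refl = subst (λ y → SameFQ (lo x) (lo y)) (sym (key-unique s oz ky (which i))) ε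
      where
      which : ∀ i → nth x i ≡ x ⊎ nth x i ≡ v x ⊎ nth x i ≡ τ x ⊎ Rise (nth x i)
      which zero = inj₁ refl
      which (suc zero) = inj₂ (inj₁ refl)
      which (suc (suc zero)) = inj₂ (inj₂ (inj₂ (T.fall⇒rise s)))
      which (suc (suc (suc zero))) = inj₂ (inj₂ (inj₂ (T.fall⇒rise (v-slope s))))
    respects {x} (inj₁ s) ky e with sameE⇒nth e
    ... | i , refl = which i
      where
      turn-t : ∀ {w} → slope w ≡ flat → SameFQ (lo w) (lo (t w))
      turn-t {w} s = subst (λ y → SameFQ (lo w) (lo y)) (sym (T.on-flat s)) (turn-τ (flat≢rise s))
      which : ∀ i → SameFQ (lo x) (lo (nth x i))
      which zero = ε
      which (suc zero) = β₁-to (β₁-lo flat s)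
      which (suc (suc zero)) = turn-t s
      which (suc (suc (suc zero))) = β₁-to (β₁-lo flat s) ◅◅ turn-t (v-slope s)

    -- A face is followed through its projection to the frame: a set closed under the projected
    -- turns is never left.
    prStep : (I : Fin N → Set) → (∀ {w} → I w → slope w ≢ fall → I (v w)) →
      (∀ {w} → I w → slope w ≢ flat → I (z w)) → (∀ {w} → I w → ¬ Rise w → I (τ w)) →
      ∀ {p q} → SameFQ p q → I (pr p) → I (pr q)
    prStep I Iv Iz Iτ ε i = i
    prStep I Iv Iz Iτ {p} (inj₁ refl ◅ s) i = prStep I Iv Iz Iτ s (subst I (pr-β₀ p) i)
      where
      pr-β₀ : ∀ p → pr p ≡ pr (β₀ p)
      pr-β₀ = flag-elim _
        (λ x → on-lo id id x ∙ sym (cong pr (β₀-lo x) ∙ on-up id id x))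
        (λ x → on-up id id x ∙ sym (cong pr (β₀-up x) ∙ on-lo id id x))
    prStep I Iv Iz Iτ {p} (inj₂ refl ◅ s) i = prStep I Iv Iz Iτ s (pr-β₁ p i)
      where
      to-lo : ∀ {q w} → q ≡ lo w → I w → I (pr q)
      to-lo refl = subst I (sym (on-lo id id _))
      to-up : ∀ {q w} → q ≡ up w → I w → I (pr q)
      to-up refl = subst I (sym (on-up id id _))
      rise≢fall : ∀ {s} → s ≡ rise → s ≢ fall
      rise≢fall refl ()
      rise≢flat : ∀ {s} → s ≡ rise → s ≢ flat
      rise≢flat refl ()
      fall≢flat : ∀ {s} → s ≡ fall → s ≢ flat
      fall≢flat refl ()
      pr-β₁ : ∀ p → I (pr p) → I (pr (β₁ p))
      pr-β₁ = flag-elim _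
        (λ x i → let i′ = subst I (on-lo id id x) i in slope-cases x
          (λ s → to-lo (β₁-lo flat s) (Iv i′ (flat≢fall s)))
          (λ s → to-lo (β₁-lo rise s) (Iv i′ (rise≢fall s)))
          (λ s → to-up (β₁-lo fall s) (Iz i′ (fall≢flat s))))
        (λ x i → let i′ = subst I (on-up id id x) i in slope-cases x
          (λ s → to-up (β₁-up flat s) (Iτ i′ (flat≢rise s)))
          (λ s → to-lo (β₁-up rise s) (Iz i′ (rise≢flat s)))
          (λ s → to-up (β₁-up fall s) (Iτ i′ (fall≢rise s))))

    reflects : ∀ {x y} → Key x → Key y → SameFQ (lo x) (lo y) → SameEM x y
    reflects {x} {y} (inj₁ f) ky s = proj₂ (subst I (on-lo id id y)
      (prStep I (λ (g , e) _ → v-slope g , e ◅◅ v-E) (λ (g , _) n → ⊥-elim (n g))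
        (λ {w} (g , e) _ → τ-slope g , e ◅◅ inj₁ (sym (T.on-flat g)) ◅ ε) s
        (subst I (sym (on-lo id id x)) (f , ε))))
      where
      I : Fin N → Set
      I w = slope w ≡ flat × SameEM x w
    reflects {x} {y} (inj₂ (f , oz)) ky s = subst (SameEM x) (sym (key-unique f oz ky which)) ε
      where
      I : Fin N → Set
      -- The low flags of a face `(i, i+1, i+2, i+1)`: two falling flags and, one level below, two
      -- rising ones.
      I w = (w ≡ x ⊎ w ≡ τ x) ⊎ (w ≡ z x ⊎ w ≡ τ (z x))
      Iv : ∀ {w} → I w → slope w ≢ fall → I (v w)
      Iv (inj₁ (inj₁ refl)) n = ⊥-elim (n f)
      Iv (inj₁ (inj₂ refl)) n = ⊥-elim (n (τ-slope f))
      Iv (inj₂ (inj₁ refl)) _ = inj₂ (inj₂ (sym (τ-rise (fall⇒rise f))))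
      Iv (inj₂ (inj₂ refl)) _ = inj₂ (inj₁ (sym (τ-rise (τ-slope (fall⇒rise f))) ∙ τ-inv _))
      Iz : ∀ {w} → I w → slope w ≢ flat → I (z w)
      Iz (inj₁ (inj₁ refl)) _ = inj₂ (inj₁ refl)
      Iz (inj₁ (inj₂ refl)) _ = inj₂ (inj₂ (mτ f))
      Iz (inj₂ (inj₁ refl)) _ = inj₁ (inj₁ (inv x))
      Iz (inj₂ (inj₂ refl)) _ = inj₁ (inj₂ (cong z (sym (mτ f)) ∙ inv (τ x)))
      Iτ : ∀ {w} → I w → ¬ Rise w → I (τ w)
      Iτ (inj₁ (inj₁ refl)) _ = inj₁ (inj₂ refl)
      Iτ (inj₁ (inj₂ refl)) _ = inj₁ (inj₁ (τ-inv x))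
      Iτ (inj₂ (inj₁ refl)) n = ⊥-elim (n (fall⇒rise f))
      Iτ (inj₂ (inj₂ refl)) n = ⊥-elim (n (τ-slope (fall⇒rise f)))
      narrow : I y → y ≡ x ⊎ y ≡ v x ⊎ y ≡ τ x ⊎ Rise y
      narrow (inj₁ (inj₁ eq)) = inj₁ eq
      narrow (inj₁ (inj₂ eq)) = inj₂ (inj₂ (inj₁ eq))
      narrow (inj₂ (inj₁ refl)) = inj₂ (inj₂ (inj₂ (fall⇒rise f)))
      narrow (inj₂ (inj₂ refl)) = inj₂ (inj₂ (inj₂ (τ-slope (fall⇒rise f))))
      which : y ≡ x ⊎ y ≡ v x ⊎ y ≡ τ x ⊎ Rise y
      which = narrow (subst I (on-lo id id y)
        (prStep I Iv Iz Iτ s (subst I (sym (on-lo id id x)) (inj₁ (inj₁ refl)))))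

  -- A level curve in a face of M climbs until it closes up around an extremal vertex.
  Summit : Fin N → Set
  Summit x = ∀ u → Conn x u → ¬ Rise u

  Extreme : Fin (N + N) → Set
  Extreme p = ∀ y → ¬ SameVQ p (lo y)

  module ClassesFM = Classes SameFM (MapFacts.sameF-sym M) _◅◅_
  module ClassesVQ = Classes SameVQ (MapFacts.sameV-sym Q) _◅◅_

  mutual
    conn⇒F : ∀ n {x y} → ℓ x ≡ n → Conn x y → SameFM x y
    conn⇒F n eq ε = ε
    conn⇒F n eq (inj₁ refl ◅ c) = inj₂ refl ◅ conn⇒F n (ℓ-a _ ∙ eq) c
    conn⇒F n eq (inj₂ (¬r , refl) ◅ c) = τ-F n eq ¬r ◅◅ conn⇒F n (ℓ-τ _ ∙ eq) c

    τ-F : ∀ n {x} → ℓ x ≡ n → ¬ Rise x → SameFM x (τ x)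
    τ-F n {x} eq ¬r = slope-cases x
      (λ s → inj₁ (sym (T.on-flat s)) ◅ ε) (λ r → ⊥-elim (¬r r)) (τ-F-fall n eq)

    -- Since `t` carries `τ` to `seg`, the curve at a fall can be replaced by a path in the face of
    -- `M` that goes down along `t`, follows a segment one level lower and comes back up.
    τ-F-fall : ∀ n {x} → ℓ x ≡ n → slope x ≡ fall → SameFM x (τ x)
    τ-F-fall zero eq s = ⊥-elim (ℕ.0≢1+n (sym eq ∙ T.drop s))
    τ-F-fall (suc n) {x} eq s = inj₁ refl ◅
      (conn⇒F n (ℕ.suc-injective (sym (T.drop s) ∙ eq)) (Seg⇒Conn (seg-Seg (T.fall⇒rise s)))
        ◅◅ inj₁ (sym (T.inv (τ x)) ∙ cong t (T.mτ s)) ◅ ε)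

  data Top : Fin N → Fin N → Set where
    stop  : ∀ {x y} → Summit x → Conn x y → Top x y
    climb : ∀ {x u y} → Conn x u → Rise u → Top (t u) y → Top x y

  top-exists : ∀ x → ∃[ y ] Top x y
  -- Each climb raises the label by one, so the largest label is enough fuel.
  top-exists x = go (proj₁ (bounded ℓ)) x (ℕ.m≤n+m _ (ℓ x))
    where
    B = proj₁ (bounded ℓ)
    rising? : ∀ x → Dec (∃[ u ] (Conn x u × Rise u))
    rising? x = any? (λ u → conn? x u ×-dec (slope u ≟ₛ rise))
    conn-ℓ : ∀ {x y} → Conn x y → ℓ y ≡ ℓ x
    conn-ℓ ε = refl
    conn-ℓ (inj₁ refl ◅ c) = conn-ℓ c ∙ ℓ-a _
    conn-ℓ (inj₂ (_ , refl) ◅ c) = conn-ℓ c ∙ ℓ-τ _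
    go : ∀ k x → B ≤ ℓ x + k → ∃[ y ] Top x y
    go k x le with rising? x
    ... | no ¬r = x , stop (λ u c r → ¬r (u , c , r)) ε
    ... | yes (u , c , r) = continue k le
      where
      ℓ-tu : ℓ (t u) ≡ suc (ℓ x)
      ℓ-tu = T.drop (T.rise⇒fall r) ∙ cong suc (cong ℓ (T.inv u) ∙ conn-ℓ c)
      continue : ∀ k → B ≤ ℓ x + k → ∃[ y ] Top x y
      continue zero le = ⊥-elim (ℕ.1+n≰n (ℕ.≤-trans (ℕ.≤-reflexive (sym ℓ-tu))
        (ℕ.≤-trans (proj₂ (bounded ℓ) (t u)) (ℕ.≤-trans le (ℕ.≤-reflexive (ℕ.+-identityʳ _))))))
      continue (suc k) le with go k (t u) (ℕ.≤-trans le (ℕ.≤-reflexive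
        (ℕ.+-suc (ℓ x) k ∙ cong (_+ k) (sym ℓ-tu))))
      ... | y , T = y , climb c r T

  top-summit : ∀ {x y} → Top x y → Summit y
  top-summit (stop s c) u c′ = s u (c ◅◅ c′)
  top-summit (climb _ _ T) = top-summit T

  top⇒F : ∀ {x y} → Top x y → SameFM x y
  top⇒F (stop s c) = conn⇒F _ refl c
  top⇒F (climb c r T) = conn⇒F _ refl c ◅◅ inj₁ refl ◅ top⇒F T

  top-conn : ∀ {x x′ y} → Conn x x′ → Top x′ y → Top x y
  top-conn c (stop s c′) = stop (λ u c″ → s u (conn-sym c ◅◅ c″)) (c ◅◅ c′)
  top-conn c (climb c′ r T) = climb (c ◅◅ c′) r T

  -- The two ends of a piece lead into the same piece one level higher, since `t` carries `seg` back
  -- to `τ`. Hence the climb does not depend on the end chosen.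
  t-conn : ∀ {u u′} → Rise u → Rise u′ → Conn u u′ → Conn (t u′) (t u)
  t-conn {u} r r′ c with conn-end r r′ c
  ... | inj₁ refl = ε
  ... | inj₂ refl = conn-sym (inj₂ (fall≢rise (T.rise⇒fall r) , t-seg) ◅ ε)
    where
    t-seg : t (seg u) ≡ τ (t u)
    t-seg = cong (t ∘ seg) (sym (T.inv u)) ∙
      cong t (sym (T.mτ (T.rise⇒fall r))) ∙ T.inv _

  top-unique : ∀ {x y y′} → Top x y → Top x y′ → Conn y y′
  top-unique (stop s c) (stop s′ c′) = conn-sym c ◅◅ c′
  top-unique (stop s c) (climb c′ r _) = ⊥-elim (s _ c′ r)
  top-unique (climb c r _) (stop s′ _) = ⊥-elim (s′ _ c r)
  top-unique (climb c r T) (climb c′ r′ T′) =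
    top-unique T (top-conn (conn-sym (t-conn r r′ (conn-sym c ◅◅ c′))) T′)

  top-step : ∀ {x y} → Top x y → Top (t x) y
  top-step {x} {y} T = slope-cases x
    (λ s → top-conn (conn-sym (inj₂ (flat≢rise s , T.on-flat s) ◅ ε)) T)
    (λ r → rising r T)
    (λ s → climb ε (T.fall⇒rise s) (subst (λ w → Top w y) (sym (T.inv x)) T))
    where
    rising : Rise x → Top x y → Top (t x) y
    rising r (stop s c) = ⊥-elim (s x ε r)
    rising r (climb c r′ T) = top-conn (conn-sym (t-conn r r′ c)) T

  top-F : ∀ {x x′ y} → SameFM x x′ → Top x y → Top x′ y
  top-F ε T = T
  top-F (inj₁ refl ◅ s) T = top-F s (top-step T)
  top-F {x} (inj₂ refl ◅ s) T = top-F s (top-conn (conn-sym (inj₁ refl ◅ ε)) T)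

  summits-faces : SetoidEquivalence Conn Summit SameFM (λ _ → ⊤) id
  summits-faces = record
    { preserves = λ _ → tt
    ; respects = λ _ _ → conn⇒F _ refl
    ; reflects = λ sx sy s → top-unique (top-F s (stop sx ε)) (stop sy ε)
    ; covers = λ {x} _ → let (y , T) = top-exists x in y , top-summit T , top⇒F T }

  -- Without a rise in the piece, turning around the vertex never reaches a low flag, so the piece
  -- is the whole vertex.
  summit-vertex : ∀ {x q} → Summit x → SameVQ (up x) q → ∃[ u ] (q ≡ up u × Conn x u)
  summit-vertex {x} s w = go w (x , refl , ε)
    where
    go : ∀ {p q} → SameVQ p q → ∃[ u ] (p ≡ up u × Conn x u) → ∃[ u ] (q ≡ up u × Conn x u)
    go ε r = r
    go (inj₁ refl ◅ w) (u , refl , c) =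
      go w (τ u , β₁-up-¬rise (s u c) , c ◅◅ inj₂ (s u c , refl) ◅ ε)
    go (inj₂ refl ◅ w) (u , refl , c) = go w (a u , β₂-up u , c ◅◅ inj₁ refl ◅ ε)

  summits-vertices : SetoidEquivalence Conn Summit SameVQ Extreme up
  summits-vertices = record
    { preserves = λ s y w → let (u , eq , _) = summit-vertex s w in up≢lo (sym eq)
    ; respects = λ _ _ → conn⇒sameV
    ; reflects = λ {x} sx _ w → let (u , eq , c) = summit-vertex sx w in
        subst (Conn x) (sym (up-inj eq)) c
    ; covers = λ {p} → flag-elim (λ p → Extreme p → ∃[ y ] (Summit y × SameVQ p (up y)))
        (λ x e → ⊥-elim (e x ε))
        (λ x e → x , (λ u c r → e (z u) (conn⇒sameV c ◅◅ α₁-to (β₁-up rise r))) , ε) p }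

  vertices : SetoidEquivalence SameV (λ _ → ⊤) SameVQ (λ p → ∃[ y ] SameVQ p (lo y)) lo
  vertices = record
    { preserves = λ {x} _ → x , ε ; respects = λ _ _ → sameV⇒ ; reflects = λ _ _ → sameV⇐
    ; covers = λ (y , s) → y , tt , s }

  numFaces⇒numEdges : ∀ {k} → CMap.NumFaces Q k → CMap.NumEdges M k
  numFaces⇒numEdges c = Classes.count-forward SameEM (MapFacts.sameE-sym M) _◅◅_ edges
    (Classes.count-backward SameFQ (MapFacts.sameF-sym Q) _◅◅_ faces c)

  numEdges⇒numFaces : ∀ {k} → CMap.NumEdges M k → CMap.NumFaces Q k
  numEdges⇒numFaces c = Classes.count-forward SameFQ (MapFacts.sameF-sym Q) _◅◅_ faces
    (Classes.count-backward SameEM (MapFacts.sameE-sym M) _◅◅_ edges c)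

  extreme⇒numFaces : ∀ {k} → ClassCount SameVQ Extreme k → CMap.NumFaces M k
  extreme⇒numFaces c = ClassesFM.count-forward summits-faces (ClassesVQ.count-backward summits-vertices c)

  numFaces⇒extreme : ∀ {k} → CMap.NumFaces M k → ClassCount SameVQ Extreme k
  numFaces⇒extreme c = ClassesVQ.count-forward summits-vertices (ClassesFM.count-backward summits-faces c)

  -- A vertex of `Q` with a low flag is a vertex of `M`; a vertex without one corresponds to the
  -- face of `M` whose level curves close up around it.
  numVertices-sum : ∀ {j k} → CMap.NumVertices M j → CMap.NumFaces M k → CMap.NumVertices Q (j + k)
  numVertices-sum c c′ = ClassesVQ.count-sum either (λ (y , s) e w → e y (MapFacts.sameV-sym Q w ◅◅ s))
    (ClassesVQ.count-forward vertices c) (numFaces⇒extreme c′)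
    where
    either : ∀ p → (∃[ y ] SameVQ p (lo y)) ⊎ Extreme p
    either p with any? (λ y → MapFacts.sameV? Q p (lo y))
    ... | yes r = inj₁ r
    ... | no ¬r = inj₂ (λ y s → ¬r (y , s))

-- Surfaces and isomorphisms

-- `v`, `e`, `f` are the counts for the map; the quadrangulation has `v + f` vertices, `e + e` edges
-- and `e` faces.
euler-identity : ∀ v e f → (+ (v + f) ℤ.- + (e + e)) ℤ.+ + e ≡ (+ v ℤ.- + e) ℤ.+ + f
euler-identity v e f = cong₂ (λ x y → (x ℤ.- y) ℤ.+ + e) (ℤ.pos-+ v f) (ℤ.pos-+ e e) ∙
  solve 3 (λ v e f → (v :+ f :- (e :+ e)) :+ e := (v :- e) :+ f) refl (+ v) (+ e) (+ f)
  where open +-*-Solver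

OrientedAs : CMap → Surface → Set
OrientedAs C (orientable _)    = CMap.Orientable C
OrientedAs C (nonorientable _) = ¬ CMap.Orientable C

EulerCharacteristic : CMap → Surface → Set
EulerCharacteristic C S = Σ[ v ∈ ℕ ] Σ[ e ∈ ℕ ] Σ[ f ∈ ℕ ]
  (CMap.NumVertices C v × CMap.NumEdges C e × CMap.NumFaces C f ×
   ((+ v ℤ.- + e) ℤ.+ + f ≡ eulerChar S))

surface-intro : ∀ {C} S → OrientedAs C S → EulerCharacteristic C S → OnSurface C S
surface-intro (orientable _)    or χ = or , χ
surface-intro (nonorientable _) or χ = or , χ

surface-oriented : ∀ {C} S → OnSurface C S → OrientedAs C S
surface-oriented (orientable _)    = proj₁
surface-oriented (nonorientable _) = proj₁

oriented-map : ∀ {C C′} S → (CMap.Orientable C → CMap.Orientable C′) →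
  (CMap.Orientable C′ → CMap.Orientable C) → OrientedAs C S → OrientedAs C′ S
oriented-map (orientable _)    to from = to
oriented-map (nonorientable _) to from = _∘ from

module PairSurface {N : ℕ} (F : Frame N) {z : Fin N → Fin N} (m : Frame.QuadMatching F z)
  {o : Fin N → Bool} (O : Frame.Orientation F o) where

  open Pair F m O

  -- Both have four flags per edge, and each flag of the map accounts for a low and an upper flag of
  -- the quadrangulation.
  edges-double : ∀ {e e′} → CMap.NumEdges Q e → CMap.NumEdges M e′ → e ≡ e′ + e′
  edges-double {e} {e′} c c′ = ℕ.*-cancelʳ-≡ e (e′ + e′) 4 (sym (EdgeFlags.edges*4 Q c) ∙
    cong (λ n → n + n) (EdgeFlags.edges*4 M c′) ∙ sym (ℕ.*-distribʳ-+ 4 e′ e′))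

  euler-transfer : ∀ {v e f eQ S} → CMap.NumEdges Q eQ → CMap.NumEdges M e →
    (+ (v + f) ℤ.- + eQ) ℤ.+ + e ≡ eulerChar S → (+ v ℤ.- + e) ℤ.+ + f ≡ eulerChar S
  euler-transfer {v} {e} {f} cQ cM eq =
    sym (euler-identity v e f) ∙ subst (λ n → (+ (v + f) ℤ.- + n) ℤ.+ + e ≡ _) (edges-double cQ cM) eq

  surface⇒ : ∀ S → OnSurface Q S → OnSurface M S
  surface⇒ S q@(_ , vQ , eQ , fQ , cv , ce , cf , χ)
    with Classes.count-exists _ (MapFacts.sameV-sym M) _◅◅_ (MapFacts.sameV? M) ε
       | Classes.count-exists _ (MapFacts.sameF-sym M) _◅◅_ (MapFacts.sameF? M) ε
  ... | v , dv | f , df = surface-intro S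
    (oriented-map S orientable⇒ orientable⇐ (surface-oriented S q))
    (v , fQ , f , dv , numFaces⇒numEdges cf , df ,
      euler-transfer {S = S} ce (numFaces⇒numEdges cf)
        (subst (λ n → (+ n ℤ.- + eQ) ℤ.+ + fQ ≡ eulerChar S) (ClassesVQ.count-unique cv (numVertices-sum dv df)) χ))

  surface⇐ : ∀ S → OnSurface M S → OnSurface Q S
  surface⇐ S s@(_ , v , e , f , cv , ce , cf , χ)
    with Classes.count-exists _ (MapFacts.sameE-sym Q) _◅◅_ (MapFacts.sameE? Q) ε
  ... | eQ , dE = surface-intro S
    (oriented-map S orientable⇐ orientable⇒ (surface-oriented S s))
    (v + f , eQ , e , numVertices-sum cv cf , dE , numEdges⇒numFaces ce ,
      cong (λ n → (+ (v + f) ℤ.- + n) ℤ.+ + e) (edges-double dE ce) ∙ euler-identity v e f ∙ χ)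

module PairStatistics {N : ℕ} (F : Frame N) {z : Fin N → Fin N} (m : Frame.QuadMatching F z)
  {o : Fin N → Bool} (O : Frame.Orientation F o)
  {point : Fin N} (P : FrameV.Pointed F point) where

  open Frame F using (ℓ)
  open FrameV F
  open FrameMaps F
  open Pair F m O
  open Distances.OnQuad F m
  open Quad m using (β₀; β₀-lo)
  module LM = MapFacts.Labelling {M} (Distances.OnMap.labelling F mt P)
  module LQ = MapFacts.Labelling {Q} (labelling P)
  open CMap Q using () renaming (SameV to SameVQ; Dist to DistQ; Extremal to ExtremalQ)

  dist-label : ∀ {p i} → DistQ p (lo point) i → i ≡ label p
  dist-label d = MapFacts.dist-unique Q d (LQ.isDist _)

  -- All flags at such a vertex are upper ends, so every edge leaving it descends.
  extreme⇒extremal : ∀ {p} → Extreme p → ExtremalQ (lo point) p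
  extreme⇒extremal {p} e q i j (CMap.there {x' = p′} s (CMap.here s′)) d d′ =
    ℕ.≤-reflexive (cong suc (dist-label d′ ∙ sym (LQ.d-V s′)) ∙
      flag-elim (λ p′ → SameVQ p p′ → suc (label (β₀ p′)) ≡ label p′)
          (λ x s → ⊥-elim (e x s))
          (λ x _ → cong suc (label-β₀-up x) ∙ sym (label-up x)) p′ s ∙
        sym (LQ.d-V s) ∙ sym (dist-label d))

  extremal⇒extreme : ∀ {p} → ExtremalQ (lo point) p → Extreme p
  extremal⇒extreme {p} ext y s = ℕ.1+n≰n (ℕ.≤-trans (ℕ.n≤1+n _)
    (subst₂ (λ i j → suc j ≤ i) (LQ.d-V s ∙ label-lo y) (label-β₀-lo y)
      (ext (β₀ (lo y)) (label p) (label (β₀ (lo y))) (CMap.there s (CMap.here ε)) (LQ.isDist p) (LQ.isDist _))))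

  layer : ∀ i → SetoidEquivalence SameV (λ x → CMap.Dist M x point i)
    SameVQ (λ p → DistQ p (lo point) i × ¬ ExtremalQ (lo point) p) lo
  layer i = record
    { preserves = λ {x} d → subst (DistQ (lo x) (lo point))
          (label-lo x ∙ MapFacts.dist-unique M (LM.isDist x) d) (LQ.isDist (lo x)) ,
        λ ext → extremal⇒extreme ext x ε
    ; respects = λ _ _ → sameV⇒ ; reflects = λ _ _ → sameV⇐
    ; covers = covers }
    where
    covers : ∀ {p} → DistQ p (lo point) i × ¬ ExtremalQ (lo point) p →
             ∃[ y ] (CMap.Dist M y point i × SameVQ p (lo y))
    covers {p} (d , ¬ext) with any? (λ y → MapFacts.sameV? Q p (lo y))
    ... | no ¬y = ⊥-elim (¬ext (extreme⇒extremal (λ y s → ¬y (y , s))))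
    ... | yes (y , s) = y , subst (CMap.Dist M y point)
      (sym (label-lo y) ∙ sym (LQ.d-V s) ∙ sym (dist-label d)) (LM.isDist y) , s

  count-layer : ∀ {i c} → ClassCount SameVQ (λ p → DistQ p (lo point) i × ¬ ExtremalQ (lo point) p) c →
    ClassCount SameV (λ x → CMap.Dist M x point i) c
  count-layer {i} = ClassesVQ.count-backward (layer i)

  count-extremal : ∀ {k} → ClassCount SameVQ (ExtremalQ (lo point)) k → CMap.NumFaces M k
  count-extremal c = extreme⇒numFaces (ClassesVQ.count-cong extremal⇒extreme extreme⇒extremal c)

module Iso {A B : RPMap} (i : A ≅ B) where
  module A = RPMap A
  module B = RPMap B

  f : Fin A.N → Fin B.N
  f = proj₁ i
  g : Fin B.N → Fin A.N
  g = proj₁ (proj₂ i)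
  gf : ∀ x → g (f x) ≡ x
  gf = proj₁ (proj₂ (proj₂ i))
  fg : ∀ y → f (g y) ≡ y
  fg = proj₁ (proj₂ (proj₂ (proj₂ i)))
  f₀ : ∀ x → f (A.α₀ x) ≡ B.α₀ (f x)
  f₀ = proj₁ (proj₂ (proj₂ (proj₂ (proj₂ i))))
  f₁ : ∀ x → f (A.α₁ x) ≡ B.α₁ (f x)
  f₁ = proj₁ (proj₂ (proj₂ (proj₂ (proj₂ (proj₂ i)))))
  f₂ : ∀ x → f (A.α₂ x) ≡ B.α₂ (f x)
  f₂ = proj₁ (proj₂ (proj₂ (proj₂ (proj₂ (proj₂ (proj₂ i))))))
  f-root : f A.root ≡ B.root
  f-root = proj₁ (proj₂ (proj₂ (proj₂ (proj₂ (proj₂ (proj₂ (proj₂ i)))))))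
  f-point : B.SameV (f A.point) B.point
  f-point = proj₂ (proj₂ (proj₂ (proj₂ (proj₂ (proj₂ (proj₂ (proj₂ i)))))))

  f-injective : ∀ {x y} → f x ≡ f y → x ≡ y
  f-injective eq = sym (gf _) ∙ cong g eq ∙ gf _

  transpose : ∀ {α : Fin A.N → Fin A.N} {β : Fin B.N → Fin B.N} →
    (∀ x → f (α x) ≡ β (f x)) → ∀ y → g (β y) ≡ α (g y)
  transpose {α} {β} c y = cong (g ∘ β) (sym (fg y)) ∙ cong g (sym (c (g y))) ∙ gf _

  f-star : ∀ {α α′ : Fin A.N → Fin A.N} {β β′ : Fin B.N → Fin B.N} →
    (∀ x → f (α x) ≡ β (f x)) → (∀ x → f (α′ x) ≡ β′ (f x)) →
    ∀ {x y} → Star (λ x y → y ≡ α x ⊎ y ≡ α′ x) x y → Star (λ x y → y ≡ β x ⊎ y ≡ β′ x) (f x) (f y)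
  f-star c c′ = Star.gmap f λ where
    (inj₁ refl) → inj₁ (c _)
    (inj₂ refl) → inj₂ (c′ _)

  f-V : ∀ {x y} → A.SameV x y → B.SameV (f x) (f y)
  f-V = f-star f₁ f₂

  f-walk : ∀ {x y k} → A.Walk x y k → B.Walk (f x) (f y) k
  f-walk (A.here s) = B.here (f-V s)
  f-walk {y = y} {suc k} (A.there s w) =
    B.there (f-V s) (subst (λ p → B.Walk p (f y) k) (f₀ _) (f-walk w))

≅-refl : ∀ {A} → A ≅ A
≅-refl = id , id , (λ _ → refl) , (λ _ → refl) , (λ _ → refl) , (λ _ → refl) , (λ _ → refl) , refl , ε

≅-sym : ∀ {A B} → A ≅ B → B ≅ A
≅-sym {A} {B} i = g , f , fg , gf , transpose f₀ , transpose f₁ , transpose f₂ ,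
  cong g (sym f-root) ∙ gf _ ,
  subst (A.SameV (g B.point)) (gf A.point)
    (Star.gmap g (λ where
      (inj₁ refl) → inj₁ (transpose f₁ _)
      (inj₂ refl) → inj₂ (transpose f₂ _)) (MapFacts.sameV-sym (RPMap.map B) f-point))
  where open Iso {A} {B} i

≅-trans : ∀ {A B C} → A ≅ B → B ≅ C → A ≅ C
≅-trans {A} {B} {C} i j = J.f ∘ I.f , I.g ∘ J.g ,
  (λ x → cong I.g (J.gf _) ∙ I.gf x) , (λ y → cong J.f (I.fg _) ∙ J.fg y) ,
  (λ x → cong J.f (I.f₀ x) ∙ J.f₀ _) ,
  (λ x → cong J.f (I.f₁ x) ∙ J.f₁ _) ,
  (λ x → cong J.f (I.f₂ x) ∙ J.f₂ _) ,
  cong J.f I.f-root ∙ J.f-root , J.f-V I.f-point ◅◅ J.f-point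
  where
  module I = Iso {A} {B} i
  module J = Iso {B} {C} j

module IsoTransfer {A B : RPMap} (i : A ≅ B) where
  open Iso {A} {B} i
  module J = Iso {B} {A} (≅-sym {A} {B} i)

  V⁻ : ∀ {x y} → B.SameV (f x) (f y) → A.SameV x y
  V⁻ {x} {y} s = subst₂ A.SameV (gf x) (gf y) (J.f-V s)

  dist : ∀ {x k} → A.Dist x A.point k → B.Dist (f x) B.point k
  dist {x} {k} (w , min) =
    MapFacts.walk-respʳ (RPMap.map B) (f-walk w) f-point ,
    λ j w′ → min j (subst (λ y → A.Walk y A.point j) (gf x)
      (MapFacts.walk-respʳ (RPMap.map A) (J.f-walk w′) J.f-point))

  dist⁻ : ∀ {y k} → B.Dist y B.point k → A.Dist (g y) A.point k
  dist⁻ {y} {k} (w , min) =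
    MapFacts.walk-respʳ (RPMap.map A) (J.f-walk w) J.f-point ,
    λ j w′ → min j (subst (λ x → B.Walk x B.point j) (fg y)
      (MapFacts.walk-respʳ (RPMap.map B) (f-walk w′) f-point))

  extremal : ∀ {u} → A.Extremal A.point u → B.Extremal B.point (f u)
  extremal {u} ext w j k adj d d′ = ext (g w) j k
    (subst (λ x → A.Walk x (g w) 1) (gf u) (J.f-walk adj))
    (subst (λ x → A.Dist x A.point j) (gf u) (dist⁻ d)) (dist⁻ d′)

  vertex-classes : {P : Fin A.N → Set} {P′ : Fin B.N → Set} →
    (∀ {x} → P x → P′ (f x)) → (∀ {y} → P′ y → P (g y)) →
    SetoidEquivalence A.SameV P B.SameV P′ f
  vertex-classes to from = record
    { preserves = to ; respects = λ _ _ → f-V ; reflects = λ _ _ → V⁻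
    ; covers = λ {y} p → g y , from p , subst (B.SameV y) (sym (fg y)) ε }

  step-classes : (α α′ : Fin A.N → Fin A.N) (β β′ : Fin B.N → Fin B.N) →
    (∀ x → f (α x) ≡ β (f x)) → (∀ x → f (α′ x) ≡ β′ (f x)) →
    SetoidEquivalence (Star (λ x y → y ≡ α x ⊎ y ≡ α′ x)) (λ _ → ⊤)
      (Star (λ x y → y ≡ β x ⊎ y ≡ β′ x)) (λ _ → ⊤) f
  step-classes α α′ β β′ c c′ = record
    { preserves = λ _ → tt ; respects = λ _ _ → f-star c c′
    ; reflects = λ {x} {y} _ _ s → subst₂ (Star (λ x y → y ≡ α x ⊎ y ≡ α′ x)) (gf x) (gf y)
        (J.f-star (transpose c) (transpose c′) s)
    ; covers = λ {y} _ → g y , tt , subst (Star _ y) (sym (fg y)) ε }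

  numEdges : ∀ {k} → A.NumEdges k → B.NumEdges k
  numEdges = Classes.count-forward _ (MapFacts.sameE-sym (RPMap.map B)) _◅◅_
    (step-classes A.α₀ A.α₂ B.α₀ B.α₂ f₀ f₂)

  numFaces : ∀ {k} → A.NumFaces k → B.NumFaces k
  numFaces = Classes.count-forward _ (MapFacts.sameF-sym (RPMap.map B)) _◅◅_
    (step-classes A.α₀ A.α₁ B.α₀ B.α₁ f₀ f₁)

  numVertices : ∀ {k} → A.NumVertices k → B.NumVertices k
  numVertices = Classes.count-forward _ (MapFacts.sameV-sym (RPMap.map B)) _◅◅_
    (step-classes A.α₁ A.α₂ B.α₁ B.α₂ f₁ f₂)

  orientable⁻ : B.Orientable → A.Orientable
  orientable⁻ (c , c₀ , c₁ , c₂) = c ∘ f , pull f₀ c₀ , pull f₁ c₁ , pull f₂ c₂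
    where
    pull : ∀ {α : Fin A.N → Fin A.N} {β : Fin B.N → Fin B.N} → (∀ x → f (α x) ≡ β (f x)) →
      (∀ y → c (β y) ≢ c y) → ∀ x → c (f (α x)) ≢ c (f x)
    pull e n x p = n (f x) (cong c (sym (e x)) ∙ p)

≅-surface : ∀ {A B} → A ≅ B → ∀ S → OnSurface (RPMap.map A) S → OnSurface (RPMap.map B) S
≅-surface {A} {B} i S s@(_ , v , e , f , cv , ce , cf , χ) = surface-intro S
  (oriented-map S (IsoTransfer.orientable⁻ {B} {A} (≅-sym {A} {B} i)) (IsoTransfer.orientable⁻ {A} {B} i) (surface-oriented S s))
  (v , e , f , IsoTransfer.numVertices {A} {B} i cv , IsoTransfer.numEdges {A} {B} i ce , IsoTransfer.numFaces {A} {B} i cf , χ)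

-- Canonical orientations

-- Words in three letters, enumerated by bijective numeration in base three: the successor
-- of a word is obtained by carrying from its first letter.
next : List (Fin 3) → List (Fin 3)
next []                       = zero ∷ []
next (zero ∷ w)               = suc zero ∷ w
next (suc zero ∷ w)           = suc (suc zero) ∷ w
next (suc (suc zero) ∷ w)     = zero ∷ next w

decode : ℕ → List (Fin 3)
decode zero    = []
decode (suc k) = next (decode k)

triple : ℕ → ℕ
triple zero    = zero
triple (suc k) = suc (suc (suc (triple k)))

-- Three successors turn the first letter once round and pass a single carry to the rest.
decode-triple : ∀ k → decode (suc (triple k)) ≡ zero ∷ decode k
decode-triple zero    = refl
decode-triple (suc k) = cong (next ∘ next ∘ next) (decode-triple k)

decode-onto : ∀ w → ∃[ k ] decode k ≡ w
decode-onto [] = 0 , refl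
decode-onto (j ∷ w) with decode-onto w
decode-onto (zero ∷ w)           | k , refl = suc (triple k) , decode-triple k
decode-onto (suc zero ∷ w)       | k , refl = suc (suc (triple k)) , cong next (decode-triple k)
decode-onto (suc (suc zero) ∷ w) | k , refl = suc (suc (suc (triple k))) , cong (next ∘ next) (decode-triple k)

-- Every nonempty word is a letter put before a word enumerated earlier. This lets two explorations
-- be compared by induction on the index.
decode-suc : ∀ k → Σ[ j ∈ Fin 3 ] Σ[ i ∈ ℕ ] (i ≤ k × decode (suc k) ≡ j ∷ decode i)
decode-suc zero = zero , 0 , z≤n , refl
decode-suc (suc k) with decode-suc k
... | zero               , i , le , eq = suc zero , i , ℕ.m≤n⇒m≤1+n le , cong next eq
... | suc zero           , i , le , eq = suc (suc zero) , i , ℕ.m≤n⇒m≤1+n le , cong next eq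
... | suc (suc zero)     , i , le , eq = zero , suc i , s≤s le , cong next eq

module Words {K : ℕ} (G : Fin 3 → Fin K → Fin K) (r : Fin K) where

  act : List (Fin 3) → Fin K
  act []      = r
  act (j ∷ w) = G j (act w)

  word : ℕ → Fin K
  word k = act (decode k)

generator : (C : CMap) → Fin 3 → Fin (CMap.N C) → Fin (CMap.N C)
generator C zero             = CMap.α₀ C
generator C (suc zero)       = CMap.α₁ C
generator C (suc (suc zero)) = CMap.α₂ C

module MapWords (C : CMap) (r : Fin (CMap.N C)) where
  open Words (generator C) r public

  reached : ∀ {x y} → Star (CMap.AllStep C) x y → ∀ w → act w ≡ x → ∃[ w′ ] act w′ ≡ y
  reached ε w eq = w , eq
  reached (inj₁ refl ◅ s) w eq = reached s (zero ∷ w) (cong (CMap.α₀ C) eq)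
  reached (inj₂ (inj₁ refl) ◅ s) w eq = reached s (suc zero ∷ w) (cong (CMap.α₁ C) eq)
  reached (inj₂ (inj₂ refl) ◅ s) w eq = reached s (suc (suc zero) ∷ w) (cong (CMap.α₂ C) eq)

  word-onto : Connected C → ∀ y → ∃[ k ] word k ≡ y
  word-onto conn y with reached (conn r y) [] refl
  ... | w , refl with decode-onto w
  ... | k , eq = k , cong act eq

record FrameMap {N N′ : ℕ} (F : Frame N) (F′ : Frame N′) (f : Fin N → Fin N′) : Set where
  private
    module F  = Frame F
    module F′ = Frame F′
  field
    f-inj   : ∀ {x y} → f x ≡ f y → x ≡ y
    f-slope : ∀ x → F′.slope (f x) ≡ F.slope x
    f-a     : ∀ x → f (F.a x) ≡ F′.a (f x)
    f-τ     : ∀ x → f (F.τ x) ≡ F′.τ (f x)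

  f-rise : ∀ {x} → F.Rise x → F′.Rise (f x)
  f-rise = trans (f-slope _)

  f-seg : ∀ {x} → F.Rise x → f (F.seg x) ≡ F′.seg (f x)
  f-seg {x} r = sym (F′.Seg⇒seg (f-rise r)
    (Seg-map f (λ _ → ⊤) id id f-rise (trans (sym (f-slope _))) (λ _ → f-a _) (λ _ → f-τ _) tt
      (F.seg-Seg r)))

  f-θ : ∀ o o′ {x} → F.Rise x → o x ≡ o′ (f x) → f (F.θ o x) ≡ F′.θ o′ (f x)
  f-θ o o′ {x} r eq with o x | o′ (f x)
  f-θ o o′ r refl | true  | true  = f-τ _
  f-θ o o′ r refl | false | false = f-seg r

  f-loop⁻ : ∀ {x q} → F′.Loop (f x) q → ∃[ y ] (q ≡ f y × F.Loop x y)
  f-loop⁻ l = go l (_ , refl , ε)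
    where
    go : ∀ {x p q} → F′.Loop p q → ∃[ y ] (p ≡ f y × F.Loop x y) → ∃[ y ] (q ≡ f y × F.Loop x y)
    go ε r = r
    go (inj₁ refl ◅ l) (y , refl , l′) = go l (F.a y , sym (f-a y) , l′ ◅◅ F.loop-a)
    go (inj₂ refl ◅ l) (y , refl , l′) = go l (F.τ y , sym (f-τ y) , l′ ◅◅ F.loop-b)

  f-loop-reflect : ∀ {x y} → F′.Loop (f x) (f y) → F.Loop x y
  f-loop-reflect {x} l with f-loop⁻ l
  ... | y , eq , l′ = subst (F.Loop x) (sym (f-inj eq)) l′

  pull-orientation : ∀ {o′} → F′.Orientation o′ → F.Orientation (o′ ∘ f)
  pull-orientation {o′} O = record
    { flip-a = λ x → cong o′ (f-a x) ∙ F′.Orientation.flip-a O _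
    ; flip-b = λ x → cong o′ (f-τ x) ∙ F′.Orientation.flip-b O _ }

-- Orientations that only depend on the order in which the words visit the loops.
module FirstVisits {N N′ : ℕ} {F : Frame N} {F′ : Frame N′} {f : Fin N → Fin N′}
  (fm : FrameMap F F′ f) {b : Bool} {s : ℕ → Fin N} {s′ : ℕ → Fin N′}
  {o : Fin N → Bool} {o′ : Fin N′ → Bool}
  (O : Frame.Orientation F o) (O′ : Frame.Orientation F′ o′)
  (first : Frame.First F b s o) (first′ : Frame.First F′ b s′ o′) where

  open FrameMap fm
  private
    module F  = Frame F
    module F′ = Frame F′

  loop-agrees : ∀ {x y} → F.Loop x y → o x ≡ o′ (f x) → o y ≡ o′ (f y)
  loop-agrees = F.orientation-unique O (pull-orientation O′)

  -- At the first visit `l` of the loop of `s k`, both orientations have the value `b`, and this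
  -- propagates along the loop. As `l ≤ k`, only the visits up to `k` have to correspond.
  agrees : ∀ k → (∀ j → j ≤ k → f (s j) ≡ s′ j) → o (s k) ≡ o′ (f (s k))
  agrees k eq with least (λ l → F.loop? (s k) (s l)) k ε
  ... | l , l≤k , lp , min = loop-agrees (F.loop-sym lp)
    (first l (λ j lt q → min j lt (lp ◅◅ q)) ∙
      sym (first′ l λ j lt q → min j lt (lp ◅◅ f-loop-reflect
          (subst₂ F′.Loop (sym (eq l l≤k)) (sym (eq j (ℕ.≤-trans (ℕ.<⇒≤ lt) l≤k))) q))) ∙
        cong o′ (sym (eq l l≤k)))

-- `f` is known to commute with `z`; the structure to be compared is the twist of `z`, and its
-- generators `G` do the exploring. By `h-G` a generator either commutes with `h` outright or moves
-- by the twist. In both uses `b` is `false`, since twisting back takes the reversed orientation.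
module Comparison {N N′ : ℕ} {F : Frame N} {F′ : Frame N′} {f : Fin N → Fin N′}
  (fm : FrameMap F F′ f) {b : Bool} {o : Fin N → Bool} {o′ : Fin N′ → Bool}
  (O : Frame.Orientation F o) (O′ : Frame.Orientation F′ o′)
  {ρ σ z : Fin N → Fin N} (m : Frame.Matching F ρ σ z)
  {ρ′ σ′ z′ : Fin N′ → Fin N′} (m′ : Frame.Matching F′ ρ′ σ′ z′)
  (f-z : ∀ x → f (z x) ≡ z′ (f x))
  {K K′ : ℕ} (pr : Fin K → Fin N) (pr′ : Fin K′ → Fin N′)
  (G : Fin 3 → Fin K → Fin K) (G′ : Fin 3 → Fin K′ → Fin K′) (r : Fin K) (r′ : Fin K′)
  (h : Fin K → Fin K′) (h-pr : ∀ y → pr′ (h y) ≡ f (pr y)) (h-r : h r ≡ r′)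
  (first : Frame.First F b (pr ∘ Words.word G r) o)
  (first′ : Frame.First F′ b (pr′ ∘ Words.word G′ r′) o′)
  (h-G : ∀ j y → h (G j y) ≡ G′ j (h y) ⊎
     (pr (G j y) ≡ Frame.twist F o z (pr y) ×
      pr′ (G′ j (h y)) ≡ Frame.twist F′ o′ z′ (f (pr y)) ×
      (f (Frame.twist F o z (pr y)) ≡ Frame.twist F′ o′ z′ (f (pr y)) → h (G j y) ≡ G′ j (h y))))
  where

  open FrameMap fm
  open Words
  open FirstVisits fm O O′ first first′
  private
    module F  = Frame F
    module F′ = Frame F′
    module m  = F.Matching m
    module T  = F.Twist O
    module T′ = F′.Twist O′
    t  = F.twist o z
    t′ = F′.twist o′ z′
    w  = word G r
    w′ = word G′ r′

  f-slope-at : ∀ {x s} → F.slope x ≡ s → F′.slope (f x) ≡ s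
  f-slope-at = trans (f-slope _)

  Agree : ℕ → Set
  Agree k = ∀ j → j ≤ k → h (w j) ≡ w′ j

  agree-pr : ∀ {k} → Agree k → ∀ j → j ≤ k → f (pr (w j)) ≡ pr′ (w′ j)
  agree-pr A j le = sym (h-pr (w j)) ∙ cong pr′ (A j le)

  agree-o : ∀ {k} → Agree k → ∀ j → j ≤ k → o (pr (w j)) ≡ o′ (f (pr (w j)))
  agree-o A j le = agrees j (λ i le′ → agree-pr A i (ℕ.≤-trans le′ le))

  -- At a rise the orientation is consulted at a flag already visited. At a fall it is consulted at
  -- `z p`, whose loop may be new. Then the step arrives at the first visited flag of that loop on
  -- both sides, where the value is `b`; as the shift flips the orientation, both values at the
  -- start of the shift are `not b`.
  twist-agrees : ∀ k i j → Agree k → i ≤ k → w (suc k) ≡ G j (w i) → w′ (suc k) ≡ G′ j (w′ i) →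
    pr (G j (w i)) ≡ t (pr (w i)) → pr′ (G′ j (h (w i))) ≡ t′ (f (pr (w i))) →
    f (t (pr (w i))) ≡ t′ (f (pr (w i)))
  twist-agrees k i j A i≤k eq eq′ pr-eq pr-eq′ = F.slope-cases p
    (λ s → cong f (F.twist-flat s) ∙ f-z p ∙ sym (F′.twist-flat (f-slope-at s)))
    (λ s → cong f (F.twist-rise s) ∙ f-z _ ∙
      cong z′ (f-θ (not ∘ o) (not ∘ o′) s (cong not (agree-o A i i≤k))) ∙
        sym (F′.twist-rise (f-slope-at s)))
    (λ s → cong f (F.twist-fall s) ∙ f-θ o o′ (m.fall⇒rise s) (choice s) ∙
      cong (F′.θ o′) (f-z p) ∙ sym (F′.twist-fall (f-slope-at s)))
    where
    p = pr (w i)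
    choice : F.slope p ≡ fall → o (z p) ≡ o′ (f (z p))
    choice s with any? (λ (l : Fin (suc k)) → F.loop? (z p) (pr (w (toℕ l))))
    ... | yes (l , lp) = loop-agrees (F.loop-sym lp)
      (agree-o A (toℕ l) (ℕ.≤-pred (toℕ<n l)))
    ... | no none = T.θ-o⁻ rz (cong o here ∙ first (suc k) unvisited) ∙
      sym (T′.θ-o⁻ (f-rise rz) (cong o′ here′ ∙ first′ (suc k) unvisited′))
      where
      rz : F.Rise (z p)
      rz = m.fall⇒rise s
      here : F.θ o (z p) ≡ pr (w (suc k))
      here = sym (F.twist-fall s) ∙ sym pr-eq ∙ cong pr (sym eq)
      here′ : F′.θ o′ (f (z p)) ≡ pr′ (w′ (suc k))
      here′ = cong (F′.θ o′) (f-z p) ∙ sym (F′.twist-fall (f-slope-at s)) ∙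
        sym pr-eq′ ∙ cong pr′ (cong (G′ j) (A i i≤k) ∙ sym eq′)
      fresh : ∀ j → j < suc k → ¬ F.Loop (z p) (pr (w j))
      fresh j lt l = none (fromℕ< lt ,
        subst (λ n → F.Loop (z p) (pr (w n))) (sym (toℕ-fromℕ< lt)) l)
      unvisited : ∀ j → j < suc k → ¬ F.Loop (pr (w (suc k))) (pr (w j))
      unvisited j lt l = fresh j lt (F.θ-loop o rz ◅◅ subst (λ x → F.Loop x (pr (w j))) (sym here) l)
      unvisited′ : ∀ j → j < suc k → ¬ F′.Loop (pr′ (w′ (suc k))) (pr′ (w′ j))
      unvisited′ j lt l = fresh j lt (f-loop-reflect (F′.θ-loop o′ (f-rise rz) ◅◅
        subst₂ F′.Loop (sym here′) (sym (agree-pr A j (ℕ.≤-pred lt))) l))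

  agree : ∀ k → Agree k
  agree zero zero z≤n = h-r
  agree (suc k) j le with ℕ.m≤n⇒m<n∨m≡n le
  ... | inj₁ lt = agree k j (ℕ.≤-pred lt)
  ... | inj₂ refl with decode-suc k
  ... | l , i , i≤k , eq = cong h (cong (act G r) eq) ∙
      commutes (h-G l (w i)) ∙ cong (G′ l) (agree k i i≤k) ∙ sym (cong (act G′ r′) eq)
    where
    commutes : _ → h (G l (w i)) ≡ G′ l (h (w i))
    commutes (inj₁ e) = e
    commutes (inj₂ (e , e′ , c)) =
      c (twist-agrees k i l (agree k) i≤k (cong (act G r) eq) (cong (act G′ r′) eq) e e′)

  h-word : ∀ k → h (w k) ≡ w′ k
  h-word k = agree k k ℕ.≤-refl

  -- A letter applied to an enumerated word is again an enumerated word, so agreement on all words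
  -- is equivariance.
  h-commutes : (∀ y → ∃[ k ] w k ≡ y) → ∀ j y → h (G j y) ≡ G′ j (h y)
  h-commutes onto j y with onto y
  ... | k , refl with decode-onto (j ∷ decode k)
  ... | n , eq = cong h (cong (act G r) (sym eq)) ∙ h-word n ∙
    cong (act G′ r′) eq ∙ cong (G′ j) (sym (h-word k))

-- The frame of a quadrangulation

module FrameOfQuad {N : ℕ} (a τ z η : Fin N → Fin N) (slope : Fin N → Slope) (ℓ : Fin N → ℕ)
  (a-inv : ∀ x → a (a x) ≡ x) (τ-inv : ∀ x → τ (τ x) ≡ x) (z-inv : ∀ x → z (z x) ≡ x)
  (a-fpf : ∀ x → a x ≢ x) (τ-fpf : ∀ x → τ x ≢ x)
  (slope-τ : ∀ x → slope (τ x) ≡ slope x) (slope-z : ∀ x → slope (z x) ≡ opp (slope x))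
  (ℓ-a : ∀ x → ℓ (a x) ≡ ℓ x) (ℓ-τ : ∀ x → ℓ (τ x) ≡ ℓ x)
  (drop : ∀ {x} → slope x ≡ fall → ℓ x ≡ suc (ℓ (z x)))
  (z-flat : ∀ {x} → slope x ≡ flat → z x ≡ τ x)
  (z-τ : ∀ {x} → slope x ≡ fall → z (τ x) ≡ τ (z x))
  (η-inv : ∀ {x} → slope x ≡ flat → η (η x) ≡ x)
  (η-fpf : ∀ {x} → slope x ≡ flat → η x ≢ x)
  (slope-η : ∀ {x} → slope x ≡ flat → slope (η x) ≡ flat)
  (ℓ-η : ∀ {x} → slope x ≡ flat → ℓ (η x) ≡ ℓ x)
  (η-τ : ∀ {x} → slope x ≡ flat → η (τ x) ≡ τ (η x))
  (ητ-fpf : ∀ {x} → slope x ≡ flat → η (τ x) ≢ x) where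

  Rise : Fin N → Set
  Rise x = slope x ≡ rise

  open Segment a τ a-inv τ-inv Rise (λ x → slope x ≟ₛ rise) (λ {x} p → slope-τ x ∙ p)

  -- At a fall the value is forced by the law that `z` carries `v` to `seg`: it is the next low flag
  -- beyond the edges descending from the vertex.
  vBy : Slope → Fin N → Fin N
  vBy flat x = η x
  vBy rise x = τ x
  vBy fall x = z (seg (z x))

  v : Fin N → Fin N
  v x = vBy (slope x) x

  v-at : ∀ {x} s → slope x ≡ s → v x ≡ vBy s x
  v-at {x} s = cong (λ s → vBy s x)

  cases : ∀ {A : Set} x → (slope x ≡ flat → A) → (slope x ≡ rise → A) → (slope x ≡ fall → A) → A
  cases x = onSlope (slope x)

  z-rise : ∀ {x} → slope x ≡ fall → Rise (z x)
  z-rise eq = slope-z _ ∙ cong opp eq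

  seg-fall : ∀ {x} → slope x ≡ fall → slope (z (seg (z x))) ≡ fall
  seg-fall eq = slope-z _ ∙ cong opp (seg-P (z-rise eq))

  seg-ℓ : ∀ {x} → Rise x → ℓ (seg x) ≡ ℓ x
  seg-ℓ {x} p = Seg-inv (λ y → ℓ y ≡ ℓ x) (trans (ℓ-a _)) (trans (ℓ-τ _)) refl (seg-Seg p)

  frame : Frame N
  frame = record
    { a = a ; v = v ; τ = τ ; slope = slope ; ℓ = ℓ
    ; a-inv = a-inv ; τ-inv = τ-inv ; a-fpf = a-fpf ; τ-fpf = τ-fpf ; slope-τ = slope-τ
    ; v-inv = λ x → cases x
        (λ s → v-at flat (cong slope (v-at flat s) ∙ slope-η s) ∙
                 cong η (v-at flat s) ∙ η-inv s)
        (λ s → v-at rise (cong slope (v-at rise s) ∙ slope-τ x ∙ s) ∙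
                 cong τ (v-at rise s) ∙ τ-inv x)
        (λ s → v-at fall (cong slope (v-at fall s) ∙ seg-fall s) ∙
                 cong (z ∘ seg ∘ z) (v-at fall s) ∙
                   cong (z ∘ seg) (z-inv _) ∙
                     cong z (seg-inv (z-rise s)) ∙ z-inv x)
    ; v-fpf = λ x p → cases x
        (λ s → η-fpf s (sym (v-at flat s) ∙ p))
        (λ s → τ-fpf x (sym (v-at rise s) ∙ p))
        (λ s → seg-fpf (λ _ → ⊤) id id (λ {x} _ → a-fpf x) (λ {x} _ → τ-fpf x) (z-rise s) tt
                 (sym (z-inv _) ∙ cong z (sym (v-at fall s) ∙ p)))
    ; slope-v = λ x → cases x
        (λ s → cong slope (v-at flat s) ∙ slope-η s ∙ sym s)
        (λ s → cong slope (v-at rise s) ∙ slope-τ x)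
        (λ s → cong slope (v-at fall s) ∙ seg-fall s ∙ sym s)
    ; ℓ-a = ℓ-a
    ; ℓ-v = λ x → cases x
        (λ s → cong ℓ (v-at flat s) ∙ ℓ-η s)
        (λ s → cong ℓ (v-at rise s) ∙ ℓ-τ x)
        (λ s → cong ℓ (v-at fall s) ∙ drop (seg-fall s) ∙
          cong (suc ∘ ℓ) (z-inv _) ∙ cong suc (seg-ℓ (z-rise s)) ∙ sym (drop s))
    ; ℓ-τ = ℓ-τ
    ; τ-rise = λ s → sym (v-at rise s)
    ; flat-comm = λ {x} s → v-at flat (slope-τ x ∙ s) ∙
        η-τ s ∙ cong τ (sym (v-at flat s))
    ; flat-fpf = λ {x} s p → ητ-fpf s (sym (v-at flat (slope-τ x ∙ s)) ∙ p)
    }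

  matching : Frame.QuadMatching frame z
  matching = record
    { inv = z-inv ; slopes = slope-z ; on-flat = z-flat ; drop = drop
    ; mv = λ s → cong z (v-at fall s) ∙ z-inv _
    ; mτ = z-τ }

module DistanceFunction (C : CMap) (conn : Connected C) where
  open CMap C
  open MapFacts C

  walk? : ∀ k x y → Dec (Walk x y k)
  walk? zero x y = map′ here (λ { (here s) → s }) (sameV? x y)
  walk? (suc k) x y = map′ (λ (x′ , s , w) → there s w) (λ { (there s w) → _ , s , w })
    (any? (λ x′ → sameV? x x′ ×-dec walk? k (α₀ x′) y))

  steps⇒walk : ∀ {x y} → Star AllStep x y → ∃[ k ] Walk x y k
  steps⇒walk ε = 0 , here ε
  steps⇒walk (inj₁ refl ◅ s) = let (k , w) = steps⇒walk s in suc k , there ε w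
  steps⇒walk (inj₂ (inj₁ refl) ◅ s) = let (k , w) = steps⇒walk s in k , walk-resp α₁-V w
  steps⇒walk (inj₂ (inj₂ refl) ◅ s) = let (k , w) = steps⇒walk s in k , walk-resp α₂-V w

  opaque
    dist-exists : ∀ x y → ∃[ k ] Dist x y k
    dist-exists x y with steps⇒walk (conn x y)
    ... | k , w with least (λ k → walk? k x y) k w
    ... | l , _ , w′ , min = l , w′ , λ j w″ → ℕ.≮⇒≥ (λ lt → min j lt w″)

  module From (p : Fin N) where

    d : Fin N → ℕ
    d x = proj₁ (dist-exists x p)

    d-dist : ∀ x → Dist x p (d x)
    d-dist x = proj₂ (dist-exists x p)

    d-V : ∀ {x y} → SameV x y → d y ≡ d x
    d-V s = dist-unique (d-dist _) (dist-resp s (d-dist _))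

    d-α₁ : ∀ x → d (α₁ x) ≡ d x
    d-α₁ x = d-V α₁-V

    d-α₂ : ∀ x → d (α₂ x) ≡ d x
    d-α₂ x = d-V α₂-V

    d-α₀ : ∀ x → d (α₀ x) ≤ suc (d x)
    d-α₀ x = proj₂ (d-dist (α₀ x)) _ (there ε (subst (λ y → Walk y p (d x)) (sym (inv₀ x)) (proj₁ (d-dist x))))

    d-point : d p ≡ 0
    d-point = ℕ.n≤0⇒n≡0 (proj₂ (d-dist p) 0 (here ε))

    d-zero : ∀ x → d x ≡ 0 → SameV x p
    d-zero x eq = zero-walk (subst (Walk x p) eq (proj₁ (d-dist x)))
      where
      zero-walk : ∀ {y} → Walk x y 0 → SameV x y
      zero-walk (here s) = s

    d-suc : ∀ x k → d x ≡ suc k → ∃[ y ] (SameV x y × d (α₀ y) ≡ k)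
    d-suc x k eq = first-step (subst (Walk x p) eq (proj₁ (d-dist x)))
      where
      first-step : Walk x p (suc k) → ∃[ y ] (SameV x y × d (α₀ y) ≡ k)
      first-step (there {x' = y} s w) = y , s , ℕ.≤-antisym (proj₂ (d-dist (α₀ y)) k w)
        (ℕ.≤-pred (ℕ.≤-trans (ℕ.≤-reflexive (sym eq ∙ sym (d-V s) ∙ cong d (sym (inv₀ y))))
          (d-α₀ (α₀ y))))

    -- The colour changes at each step of a walk, so the parity of the distance determines it, and
    -- `α₀` changes the colour.
    d-bipartite : IsBipartite → ∀ x → d (α₀ x) ≢ d x
    d-bipartite (c , c₁ , c₂ , c₀) x eq = c₀ x (walk-color (proj₁ (d-dist (α₀ x))) ∙
      cong (λ k → if even k then c p else not (c p)) eq ∙ sym (walk-color (proj₁ (d-dist x))))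
      where
      V-color : ∀ {x y} → SameV x y → c x ≡ c y
      V-color ε = refl
      V-color (inj₁ refl ◅ s) = sym (c₁ _) ∙ V-color s
      V-color (inj₂ refl ◅ s) = sym (c₂ _) ∙ V-color s
      flip-if : ∀ b (q : Bool) → not (if b then q else not q) ≡ (if not b then q else not q)
      flip-if true  q = refl
      flip-if false q = not-involutive q
      walk-color : ∀ {x y k} → Walk x y k → c x ≡ (if even k then c y else not (c y))
      walk-color (here s) = V-color s
      walk-color {k = suc k} (there {x' = x′} s w) = V-color s ∙
        cong c (sym (inv₀ x′)) ∙ flip-≡ (c₀ (α₀ x′)) ∙
          cong not (walk-color w) ∙ flip-if (even k) _

record QuadData : Set where
  no-eta-equality
  field
    N        : ℕ
    frame    : Frame N
    z        : Fin N → Fin N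
    matching : Frame.QuadMatching frame z
    root     : Fin N
    point    : Fin N
    pointed  : FrameV.Pointed frame point

  open FrameMaps frame public using (lo; up; pr)

  rp : RPMap
  rp = record
    { map = FrameMaps.Quad.mapQ frame matching
    ; conn = MapFacts.Labelling.connected (Distances.OnQuad.labelling frame matching pointed)
    ; root = lo root ; point = lo point }

module ReadQuad (q : RPMap) (quad : RPMap.IsQuadrangulation q) (bip : RPMap.IsBipartite q) where
  open RPMap q
  open DistanceFunction map conn
  open From point

  -- Degree four in symmetric form: going half-way round the face leads to the same flag in either
  -- direction.
  face : ∀ x → α₀ (α₁ (α₀ (α₁ x))) ≡ α₁ (α₀ (α₁ (α₀ x)))
  face x = cong (α₀ ∘ α₁ ∘ α₀ ∘ α₁) (sym back) ∙ proj₁ (proj₂ (quad (α₁ (α₀ (α₁ (α₀ x))))))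
    where
    back : α₀ (α₁ (α₀ (α₁ (α₁ (α₀ (α₁ (α₀ x))))))) ≡ x
    back = cong (α₀ ∘ α₁ ∘ α₀) (inv₁ _) ∙ cong (α₀ ∘ α₁) (inv₀ _) ∙ cong α₀ (inv₁ _) ∙ inv₀ x

  Low : Fin N → Set
  Low x = d (α₀ x) ≡ suc (d x)

  opaque
    low? : ∀ x → Dec (Low x)
    low? x = d (α₀ x) ℕ.≟ suc (d x)

  high : ∀ {x} → ¬ Low x → d x ≡ suc (d (α₀ x))
  high {x} ¬l = ℕ.≤-antisym
    (ℕ.≤-trans (ℕ.≤-reflexive (cong d (sym (inv₀ x)))) (d-α₀ (α₀ x)))
    (ℕ.≤∧≢⇒< (ℕ.≤-pred (ℕ.≤∧≢⇒< (d-α₀ x) ¬l)) (d-bipartite bip x))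

  high⇒low : ∀ {x} → ¬ Low x → Low (α₀ x)
  high⇒low {x} ¬l = cong d (inv₀ x) ∙ high ¬l

  low⇒high : ∀ {x} → Low x → ¬ Low (α₀ x)
  low⇒high {x} l l′ = ℕ.<-asym (ℕ.≤-reflexive (sym l)) (ℕ.≤-reflexive (sym l′ ∙ cong d (inv₀ x)))

  descends⇒high : ∀ {x} → d x ≡ suc (d (α₀ x)) → ¬ Low x
  descends⇒high eq l = ℕ.<-asym (ℕ.≤-reflexive (sym l)) (ℕ.≤-reflexive (sym eq))

  -- From a low flag x the face is explored through α₁ x and through the opposite corner w x.
  w : Fin N → Fin N
  w x = α₁ (α₀ x)

  w-opposite : ∀ x → α₁ (α₀ (w x)) ≡ α₀ (w (α₁ x))
  w-opposite x = sym (face x)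

  d-w : ∀ x → d (w x) ≡ d (α₀ x)
  d-w x = d-α₁ (α₀ x)

  d-opposite : ∀ x → d (α₀ (w x)) ≡ d (α₀ (w (α₁ x)))
  d-opposite x = sym (d-α₁ _) ∙ cong d (w-opposite x)

  -- Seen from a low flag with label `i`, the neighbour through `α₁` has label `i - 1` at a fall;
  -- otherwise the opposite corner has label `i + 2` at a rise and `i` at a flat flag.
  slopeBy : ∀ {x} → Dec (Low (α₁ x)) → Dec (Low (w x)) → Slope
  slopeBy (no _)  _       = fall
  slopeBy (yes _) (yes _) = rise
  slopeBy (yes _) (no _)  = flat

  slopeY : Fin N → Slope
  slopeY x = slopeBy (low? (α₁ x)) (low? (w x))

  is-fall : ∀ {x} → ¬ Low (α₁ x) → slopeY x ≡ fall
  is-fall {x} ¬l with low? (α₁ x)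
  ... | yes l = ⊥-elim (¬l l)
  ... | no _  = refl

  is-rise : ∀ {x} → Low (α₁ x) → Low (w x) → slopeY x ≡ rise
  is-rise {x} l l′ with low? (α₁ x) | low? (w x)
  ... | yes _ | yes _ = refl
  ... | no ¬l | _     = ⊥-elim (¬l l)
  ... | yes _ | no ¬l = ⊥-elim (¬l l′)

  is-flat : ∀ {x} → Low (α₁ x) → ¬ Low (w x) → slopeY x ≡ flat
  is-flat {x} l ¬l′ with low? (α₁ x) | low? (w x)
  ... | yes _ | no _  = refl
  ... | no ¬l | _     = ⊥-elim (¬l l)
  ... | yes _ | yes l′ = ⊥-elim (¬l′ l′)

  from-fall : ∀ {x} → slopeY x ≡ fall → ¬ Low (α₁ x)
  from-fall {x} eq with low? (α₁ x) | low? (w x)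
  from-fall eq | no ¬l | _     = ¬l
  from-fall () | yes _ | yes _
  from-fall () | yes _ | no _

  from-rise : ∀ {x} → slopeY x ≡ rise → Low (α₁ x) × Low (w x)
  from-rise {x} eq with low? (α₁ x) | low? (w x)
  from-rise () | no _  | _
  from-rise eq | yes l | yes l′ = l , l′
  from-rise () | yes _ | no _

  from-flat : ∀ {x} → slopeY x ≡ flat → Low (α₁ x) × ¬ Low (w x)
  from-flat {x} eq with low? (α₁ x) | low? (w x)
  from-flat () | no _  | _
  from-flat () | yes _ | yes _
  from-flat eq | yes l | no ¬l = l , ¬l

  slopeY-cases : ∀ {A : Set} x → (slopeY x ≡ flat → A) → (slopeY x ≡ rise → A) → (slopeY x ≡ fall → A) → A
  slopeY-cases x = onSlope (slopeY x)

  low-α₂ : ∀ {x} → Low x → Low (α₂ x)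
  low-α₂ {x} l = cong d (comm₀₂ x) ∙ d-α₂ _ ∙ l ∙ cong suc (sym (d-α₂ x))

  low-w : ∀ {x} → Low x → Low (α₁ x) → Low (w x) → Low (w (α₁ x))
  low-w {x} l l₁ lw = sym (d-opposite x) ∙ lw ∙
    cong suc (d-w x ∙ l ∙ cong suc (sym (d-α₁ x)) ∙ sym l₁ ∙ sym (d-w (α₁ x)))

  low-w⁻ : ∀ {x} → Low x → Low (α₁ x) → Low (w (α₁ x)) → Low (w x)
  low-w⁻ {x} l l₁ lw = subst (Low ∘ w) (inv₁ x)
    (low-w l₁ (subst Low (sym (inv₁ x)) l) lw)

  fall-below : ∀ {x} → ¬ Low (α₁ x) → d x ≡ suc (d (w (α₁ x)))
  fall-below {x} ¬l = sym (d-α₁ x) ∙ high ¬l ∙ cong suc (sym (d-w _))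

  -- The opposite corner would have label `i + 2` although it is adjacent to a corner with label
  -- `i - 1`.
  fall-w : ∀ {x} → Low x → ¬ Low (α₁ x) → ¬ Low (w x)
  fall-w {x} l ¬l lw = ℕ.<-irrefl refl (ℕ.≤-trans
    (ℕ.≤-reflexive (cong suc (sym lw ∙ d-opposite x)))
    (ℕ.≤-trans (s≤s (d-α₀ (w (α₁ x)))) (ℕ.≤-trans (ℕ.≤-reflexive (cong suc (sym (fall-below ¬l))))
      (ℕ.≤-trans (ℕ.≤-reflexive (sym l ∙ sym (d-w x))) (ℕ.n≤1+n _)))))

  d-τ : ∀ {x} → Low x → ¬ Low (w x) → d (α₀ (w x)) ≡ d x
  d-τ {x} l ¬l = ℕ.suc-injective (sym (high ¬l) ∙ d-w x ∙ l)

  fall-w₁ : ∀ {x} → Low x → ¬ Low (α₁ x) → Low (w (α₁ x))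
  fall-w₁ {x} l ¬l = sym (d-opposite x) ∙ d-τ l (fall-w l ¬l) ∙ fall-below ¬l

  -- The level curve turns around the lower end of the edge at a rise and around the upper end
  -- otherwise. Off flat flags, `z` joins two edges `(i, i+1)` and `(i+1, i+2)` meeting at a corner
  -- of the face.
  τBy zBy : Slope → Fin N → Fin N
  τBy flat x = α₀ (w x)
  τBy rise x = α₁ x
  τBy fall x = α₀ (w x)
  zBy flat x = α₀ (w x)
  zBy rise x = w x
  zBy fall x = α₀ (α₁ x)

  τY zY : Fin N → Fin N
  τY x = τBy (slopeY x) x
  zY x = zBy (slopeY x) x

  τY-at : ∀ {x} s → slopeY x ≡ s → τY x ≡ τBy s x
  τY-at {x} s = cong (λ s → τBy s x)

  zY-at : ∀ {x} s → slopeY x ≡ s → zY x ≡ zBy s x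
  zY-at {x} s = cong (λ s → zBy s x)

  α₁-τ : ∀ {x} → Low x → ¬ Low (w x) → Low (α₁ x) → Low (α₁ (α₀ (w x)))
  α₁-τ {x} l ¬lw l₁ = subst Low (sym (w-opposite x)) (high⇒low (λ lw → ¬lw (low-w⁻ l l₁ lw)))

  slope-τ-flat : ∀ {x} → Low x → slopeY x ≡ flat → slopeY (α₀ (w x)) ≡ flat
  slope-τ-flat {x} l s = let (l₁ , ¬lw) = from-flat s in is-flat (α₁-τ l ¬lw l₁)
    (subst (¬_ ∘ Low) (sym (cong α₁ (inv₀ _) ∙ inv₁ _)) (low⇒high l))

  slope-τ-rise : ∀ {x} → Low x → slopeY x ≡ rise → slopeY (α₁ x) ≡ rise
  slope-τ-rise {x} l s = let (l₁ , lw) = from-rise s in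
    is-rise (subst Low (sym (inv₁ x)) l) (low-w l l₁ lw)

  slope-τ-fall : ∀ {x} → Low x → slopeY x ≡ fall → slopeY (α₀ (w x)) ≡ fall
  slope-τ-fall {x} l s = let ¬l = from-fall s in is-fall
    (subst (¬_ ∘ Low) (sym (w-opposite x)) (low⇒high (fall-w₁ l ¬l)))

  slope-z-fall : ∀ {x} → Low x → slopeY x ≡ fall → slopeY (α₀ (α₁ x)) ≡ rise
  slope-z-fall {x} l s = is-rise (fall-w₁ l (from-fall s))
    (subst Low (sym (cong α₁ (inv₀ _) ∙ inv₁ x)) l)

  slope-z-rise : ∀ {x} → Low x → slopeY x ≡ rise → slopeY (w x) ≡ fall
  slope-z-rise {x} l s = is-fall (subst (¬_ ∘ Low) (sym (inv₁ _)) (low⇒high l))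

  τ-low : ∀ {x} → Low x → Low (τY x)
  τ-low {x} l = slopeY-cases x
    (λ s → subst Low (sym (τY-at flat s)) (high⇒low (proj₂ (from-flat s))))
    (λ s → subst Low (sym (τY-at rise s)) (proj₁ (from-rise s)))
    (λ s → subst Low (sym (τY-at fall s)) (high⇒low (fall-w l (from-fall s))))

  z-low : ∀ {x} → Low x → Low (zY x)
  z-low {x} l = slopeY-cases x
    (λ s → subst Low (sym (zY-at flat s)) (high⇒low (proj₂ (from-flat s))))
    (λ s → subst Low (sym (zY-at rise s)) (proj₂ (from-rise s)))
    (λ s → subst Low (sym (zY-at fall s)) (high⇒low (from-fall s)))

  αwαw : ∀ x → α₀ (w (α₀ (w x))) ≡ x
  αwαw x = cong (α₀ ∘ α₁) (inv₀ _) ∙ cong α₀ (inv₁ _) ∙ inv₀ x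

  αw-fpf : ∀ x → α₀ (w x) ≢ x
  αw-fpf x eq = fpf₁ (α₀ x) (sym (inv₀ _) ∙ cong α₀ eq)

  ηY : Fin N → Fin N
  ηY x with low? (α₁ x)
  ... | yes _ = α₁ x
  -- A default among the low flags, as `restrict` asks for; at flat flags the first case applies.
  ... | no _  = x

  ηY-low : ∀ {x} → Low (α₁ x) → ηY x ≡ α₁ x
  ηY-low {x} l with low? (α₁ x)
  ... | yes _ = refl
  ... | no ¬l = ⊥-elim (¬l l)

  η-low : ∀ {x} → Low x → Low (ηY x)
  η-low {x} l with low? (α₁ x)
  ... | yes l₁ = l₁
  ... | no _   = l

  slope-η-flat : ∀ {x} → Low x → slopeY x ≡ flat → slopeY (α₁ x) ≡ flat
  slope-η-flat {x} l s = let (l₁ , ¬lw) = from-flat s in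
    is-flat (subst Low (sym (inv₁ x)) l) (λ lw → ¬lw (low-w⁻ l l₁ lw))

  open Enumeration (enumerate low?) renaming (size to n; elt to e; holds to e-low; elt-inj to e-inj; find to ι)

  index : ∀ {x} → Low x → Fin n
  index l = proj₁ (ι _ l)

  e-index : ∀ {x} (l : Low x) → e (index l) ≡ x
  e-index l = proj₂ (ι _ l)

  opaque
    restrict : (f : Fin N → Fin N) → (∀ {x} → Low x → Low (f x)) → Fin n → Fin n
    restrict f f-low i = index (f-low (e-low i))

    e-restrict : ∀ f (f-low : ∀ {x} → Low x → Low (f x)) i → e (restrict f f-low i) ≡ f (e i)
    e-restrict f f-low i = e-index (f-low (e-low i))

  a τ z η : Fin n → Fin n
  a = restrict α₂ low-α₂
  τ = restrict τY τ-low
  z = restrict zY z-low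
  η = restrict ηY η-low

  slope : Fin n → Slope
  slope i = slopeY (e i)

  ℓ : Fin n → ℕ
  ℓ i = d (e i)

  e-a : ∀ i → e (a i) ≡ α₂ (e i)
  e-a = e-restrict α₂ low-α₂

  e-τ : ∀ {i} s → slope i ≡ s → e (τ i) ≡ τBy s (e i)
  e-τ {i} s eq = e-restrict τY τ-low i ∙ τY-at s eq

  e-z : ∀ {i} s → slope i ≡ s → e (z i) ≡ zBy s (e i)
  e-z {i} s eq = e-restrict zY z-low i ∙ zY-at s eq

  e-η : ∀ {i} → slope i ≡ flat → e (η i) ≡ α₁ (e i)
  e-η {i} eq = e-restrict ηY η-low i ∙ ηY-low (proj₁ (from-flat eq))

  cases : ∀ {A : Set} i → (slope i ≡ flat → A) → (slope i ≡ rise → A) → (slope i ≡ fall → A) → A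
  cases i = slopeY-cases (e i)

  τ-slope : ∀ {i} s → slope i ≡ s → slope (τ i) ≡ s
  τ-slope {i} flat s = cong slopeY (e-τ flat s) ∙ slope-τ-flat (e-low i) s
  τ-slope {i} rise s = cong slopeY (e-τ rise s) ∙ slope-τ-rise (e-low i) s
  τ-slope {i} fall s = cong slopeY (e-τ fall s) ∙ slope-τ-fall (e-low i) s

  z-slope : ∀ {i} s → slope i ≡ s → slope (z i) ≡ opp s
  z-slope {i} flat s = cong slopeY (e-z flat s) ∙ slope-τ-flat (e-low i) s
  z-slope {i} rise s = cong slopeY (e-z rise s) ∙ slope-z-rise (e-low i) s
  z-slope {i} fall s = cong slopeY (e-z fall s) ∙ slope-z-fall (e-low i) s

  η-slope : ∀ {i} → slope i ≡ flat → slope (η i) ≡ flat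
  η-slope {i} s = cong slopeY (e-η s) ∙ slope-η-flat (e-low i) s

  private
    τ-inv : ∀ i → τ (τ i) ≡ i
    τ-inv i = e-inj (τ (τ i)) i (cases i
      (λ s → e-τ flat (τ-slope flat s) ∙ cong (α₀ ∘ w) (e-τ flat s) ∙ αwαw (e i))
      (λ s → e-τ rise (τ-slope rise s) ∙ cong α₁ (e-τ rise s) ∙ inv₁ (e i))
      (λ s → e-τ fall (τ-slope fall s) ∙ cong (α₀ ∘ w) (e-τ fall s) ∙ αwαw (e i)))

    z-inv : ∀ i → z (z i) ≡ i
    z-inv i = e-inj (z (z i)) i (cases i
      (λ s → e-z flat (z-slope flat s) ∙ cong (α₀ ∘ w) (e-z flat s) ∙ αwαw (e i))
      (λ s → e-z fall (z-slope rise s) ∙ cong (α₀ ∘ α₁) (e-z rise s) ∙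
        cong α₀ (inv₁ _) ∙ inv₀ (e i))
      (λ s → e-z rise (z-slope fall s) ∙ cong w (e-z fall s) ∙
        cong α₁ (inv₀ _) ∙ inv₁ (e i)))

    τ-fpf : ∀ i → τ i ≢ i
    τ-fpf i p = cases i
      (λ s → αw-fpf (e i) (sym (e-τ flat s) ∙ cong e p))
      (λ s → fpf₁ (e i) (sym (e-τ rise s) ∙ cong e p))
      (λ s → αw-fpf (e i) (sym (e-τ fall s) ∙ cong e p))

    ℓ-τ : ∀ i → ℓ (τ i) ≡ ℓ i
    ℓ-τ i = cases i
      (λ s → cong d (e-τ flat s) ∙ d-τ (e-low i) (proj₂ (from-flat s)))
      (λ s → cong d (e-τ rise s) ∙ d-α₁ (e i))
      (λ s → cong d (e-τ fall s) ∙ d-τ (e-low i) (fall-w (e-low i) (from-fall s)))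

    drop : ∀ {i} → slope i ≡ fall → ℓ i ≡ suc (ℓ (z i))
    drop {i} s = sym (d-α₁ (e i)) ∙
      high (from-fall s) ∙ cong (suc ∘ d) (sym (e-z fall s))

    z-flat : ∀ {i} → slope i ≡ flat → z i ≡ τ i
    z-flat {i} s = e-inj (z i) (τ i) (e-z flat s ∙ sym (e-τ flat s))

    z-τ : ∀ {i} → slope i ≡ fall → z (τ i) ≡ τ (z i)
    z-τ {i} s = e-inj (z (τ i)) (τ (z i)) (e-z fall (τ-slope fall s) ∙ cong (α₀ ∘ α₁) (e-τ fall s) ∙
      face (α₀ (e i)) ∙ cong (α₁ ∘ α₀ ∘ α₁) (inv₀ (e i)) ∙
        sym (e-τ rise (z-slope fall s) ∙ cong α₁ (e-z fall s)))

    η-τ : ∀ {i} → slope i ≡ flat → η (τ i) ≡ τ (η i)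
    η-τ {i} s = e-inj (η (τ i)) (τ (η i)) (e-η (τ-slope flat s) ∙ cong α₁ (e-τ flat s) ∙
      w-opposite (e i) ∙ sym (e-τ flat (η-slope s) ∙ cong (α₀ ∘ w) (e-η s)))

    ητ-fpf : ∀ {i} → slope i ≡ flat → η (τ i) ≢ i
    ητ-fpf {i} s p = proj₂ (proj₂ (quad (e i))) 2 (s≤s z≤n) (s≤s (s≤s (s≤s z≤n)))
      (face (e i) ∙ sym (e-η (τ-slope flat s) ∙ cong α₁ (e-τ flat s)) ∙ cong e p)

    a-inv : ∀ i → a (a i) ≡ i
    a-inv i = e-inj (a (a i)) i (e-a (a i) ∙ cong α₂ (e-a i) ∙ inv₂ (e i))

    a-fpf : ∀ i → a i ≢ i
    a-fpf i p = fpf₂ (e i) (sym (e-a i) ∙ cong e p)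

    slope-τ : ∀ i → slope (τ i) ≡ slope i
    slope-τ i = cases i (λ s → τ-slope flat s ∙ sym s) (λ s → τ-slope rise s ∙ sym s)
      (λ s → τ-slope fall s ∙ sym s)

    slope-z : ∀ i → slope (z i) ≡ opp (slope i)
    slope-z i = cases i (λ s → z-slope flat s ∙ cong opp (sym s))
      (λ s → z-slope rise s ∙ cong opp (sym s)) (λ s → z-slope fall s ∙ cong opp (sym s))

    ℓ-a : ∀ i → ℓ (a i) ≡ ℓ i
    ℓ-a i = cong d (e-a i) ∙ d-α₂ (e i)

    η-inv : ∀ {i} → slope i ≡ flat → η (η i) ≡ i
    η-inv {i} s = e-inj (η (η i)) i (e-η (η-slope s) ∙ cong α₁ (e-η s) ∙ inv₁ (e i))

    η-fpf : ∀ {i} → slope i ≡ flat → η i ≢ i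
    η-fpf {i} s p = fpf₁ (e i) (sym (e-η s) ∙ cong e p)

    ℓ-η : ∀ {i} → slope i ≡ flat → ℓ (η i) ≡ ℓ i
    ℓ-η {i} s = cong d (e-η s) ∙ d-α₁ (e i)

  module Built = FrameOfQuad a τ z η slope ℓ a-inv τ-inv z-inv a-fpf τ-fpf slope-τ slope-z ℓ-a ℓ-τ
    drop z-flat z-τ η-inv η-fpf η-slope ℓ-η η-τ ητ-fpf

  module Flags (frame : Frame n) {z : Fin n → Fin n} (matching : Frame.QuadMatching frame z)
    (e-slope : ∀ i → Frame.slope frame i ≡ slopeY (e i)) (e-ℓ : ∀ i → Frame.ℓ frame i ≡ d (e i))
    (e-a′ : ∀ i → e (Frame.a frame i) ≡ α₂ (e i))
    (e-flat : ∀ {i} → Frame.slope frame i ≡ flat → e (Frame.v frame i) ≡ α₁ (e i))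
    (e-rise : ∀ {i} → Frame.slope frame i ≡ rise → e (Frame.v frame i) ≡ α₁ (e i))
    (e-fall : ∀ {i} → Frame.slope frame i ≡ fall → α₀ (e (z i)) ≡ α₁ (e i))
    (e-up-flat : ∀ {i} → Frame.slope frame i ≡ flat → α₀ (e (Frame.τ frame i)) ≡ α₁ (α₀ (e i)))
    (e-up-rise : ∀ {i} → Frame.slope frame i ≡ rise → e (z i) ≡ α₁ (α₀ (e i)))
    (e-up-fall : ∀ {i} → Frame.slope frame i ≡ fall → α₀ (e (Frame.τ frame i)) ≡ α₁ (α₀ (e i)))
    where

    open Frame frame using (slope-cases)
    open FrameMaps frame using (lo; up; onFlags; on-lo; on-up; flag-elim)
    open FrameMaps.Quad frame matching

    decodeFlag : Fin (n + n) → Fin N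
    decodeFlag = onFlags e (α₀ ∘ e)

    decode-lo : ∀ i → decodeFlag (lo i) ≡ e i
    decode-lo = on-lo e (α₀ ∘ e)

    decode-up : ∀ i → decodeFlag (up i) ≡ α₀ (e i)
    decode-up = on-up e (α₀ ∘ e)

    encodeBy : ∀ {x} → Dec (Low x) → Fin (n + n)
    encodeBy (yes l) = lo (index l)
    encodeBy (no ¬l) = up (index (high⇒low ¬l))

    encode : Fin N → Fin (n + n)
    encode x = encodeBy (low? x)

    decode-encode : ∀ x → decodeFlag (encode x) ≡ x
    decode-encode x with low? x
    ... | yes l = decode-lo _ ∙ e-index l
    ... | no ¬l = decode-up _ ∙ cong α₀ (e-index (high⇒low ¬l)) ∙ inv₀ x

    encode-low : ∀ {x i} → Low x → e i ≡ x → encode x ≡ lo i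
    encode-low {x} l eq with low? x
    ... | yes l′ = cong lo (e-inj _ _ (e-index l′ ∙ sym eq))
    ... | no ¬l  = ⊥-elim (¬l l)

    encode-high : ∀ {x i} → ¬ Low x → e i ≡ α₀ x → encode x ≡ up i
    encode-high {x} ¬l eq with low? x
    ... | yes l  = ⊥-elim (¬l l)
    ... | no ¬l′ = cong up (e-inj _ _ (e-index (high⇒low ¬l′) ∙ sym eq))

    encode-decode : ∀ p → encode (decodeFlag p) ≡ p
    encode-decode = flag-elim _
      (λ i → cong encode (decode-lo i) ∙ encode-low (e-low i) refl)
      (λ i → cong encode (decode-up i) ∙ encode-high (low⇒high (e-low i)) (sym (inv₀ (e i))))

    decode₀ : ∀ p → decodeFlag (β₀ p) ≡ α₀ (decodeFlag p)
    decode₀ = flag-elim _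
      (λ i → cong decodeFlag (β₀-lo i) ∙ decode-up i ∙ cong α₀ (sym (decode-lo i)))
      (λ i → cong decodeFlag (β₀-up i) ∙ decode-lo i ∙
        sym (cong α₀ (decode-up i) ∙ inv₀ (e i)))

    decode₂ : ∀ p → decodeFlag (β₂ p) ≡ α₂ (decodeFlag p)
    decode₂ = flag-elim _
      (λ i → cong decodeFlag (β₂-lo i) ∙ decode-lo _ ∙ e-a′ i ∙ cong α₂ (sym (decode-lo i)))
      (λ i → cong decodeFlag (β₂-up i) ∙ decode-up _ ∙ cong α₀ (e-a′ i) ∙
        comm₀₂ (e i) ∙ cong α₂ (sym (decode-up i)))

    decode₁ : ∀ p → decodeFlag (β₁ p) ≡ α₁ (decodeFlag p)
    decode₁ = flag-elim _
      (λ i → slope-cases i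
          (λ s → cong decodeFlag (β₁-lo flat s) ∙ decode-lo _ ∙ e-flat s)
          (λ s → cong decodeFlag (β₁-lo rise s) ∙ decode-lo _ ∙ e-rise s)
          (λ s → cong decodeFlag (β₁-lo fall s) ∙ decode-up _ ∙ e-fall s) ∙
        cong α₁ (sym (decode-lo i)))
      (λ i → slope-cases i
          (λ s → cong decodeFlag (β₁-up flat s) ∙ decode-up _ ∙ e-up-flat s)
          (λ s → cong decodeFlag (β₁-up rise s) ∙ decode-lo _ ∙ e-up-rise s)
          (λ s → cong decodeFlag (β₁-up fall s) ∙ decode-up _ ∙ e-up-fall s) ∙
        cong α₁ (sym (decode-up i)))

    transposed : ∀ {α : Fin N → Fin N} {β : Fin (n + n) → Fin (n + n)} →
      (∀ p → decodeFlag (β p) ≡ α (decodeFlag p)) → ∀ x → encode (α x) ≡ β (encode x)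
    transposed {α} c x = cong (encode ∘ α) (sym (decode-encode x)) ∙
      cong encode (sym (c (encode x))) ∙ encode-decode _

    encode-V : ∀ {x y} → SameV x y → CMap.SameV mapQ (encode x) (encode y)
    encode-V = Star.gmap encode λ where
      (inj₁ refl) → inj₁ (transposed decode₁ _)
      (inj₂ refl) → inj₂ (transposed decode₂ _)

    lo-V : ∀ {i j} → SameV (e i) (e j) → FrameV.SameV frame i j
    lo-V {i} {j} s = Distances.OnQuad.sameV⇐ frame matching
      (subst₂ (CMap.SameV mapQ) (encode-low (e-low i) refl) (encode-low (e-low j) refl) (encode-V s))

    point-low : Low point
    point-low with low? point
    ... | yes l = l
    ... | no ¬l = ⊥-elim (ℕ.0≢1+n (sym d-point ∙ high ¬l))

    -- `α₂` keeps low flags low, so the passage to a high flag around a vertex takes place at some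
    -- `α₁`, that is, at a falling flag.
    leave-low : ∀ {x y} → SameV x y → Low x → ¬ Low y → ∃[ x′ ] (SameV x x′ × Low x′ × ¬ Low (α₁ x′))
    leave-low ε l ¬l = ⊥-elim (¬l l)
    leave-low (inj₂ refl ◅ s) l ¬l = let (x′ , s′ , r) = leave-low s (low-α₂ l) ¬l in x′ , inj₂ refl ◅ s′ , r
    leave-low {x} (inj₁ refl ◅ s) l ¬l with low? (α₁ x)
    ... | no ¬l₁ = x , ε , l , ¬l₁
    ... | yes l₁ = let (x′ , s′ , r) = leave-low s l₁ ¬l in x′ , inj₁ refl ◅ s′ , r

    pointed : FrameV.Pointed frame (index point-low)
    pointed = record
      { ℓ-point = e-ℓ _ ∙ cong d (e-index point-low) ∙ d-point
      ; ℓ-zero = λ i eq → lo-V (subst (SameV (e i)) (sym (e-index point-low)) (d-zero (e i) (sym (e-ℓ i) ∙ eq)))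
      ; ℓ-suc = ℓ-suc }
      where
      ℓ-suc : ∀ i k → Frame.ℓ frame i ≡ suc k → ∃[ j ] (FrameV.SameV frame i j × Frame.slope frame j ≡ fall)
      ℓ-suc i k eq with d-suc (e i) k (sym (e-ℓ i) ∙ eq)
      ... | y , s , eq′ with leave-low s (e-low i)
        (descends⇒high (d-V s ∙ sym (e-ℓ i) ∙ eq ∙ cong suc (sym eq′)))
      ... | x′ , s′ , l , ¬l = index l , lo-V (subst (SameV (e i)) (sym (e-index l)) s′) ,
        e-slope (index l) ∙ cong slopeY (e-index l) ∙ is-fall ¬l

    module _ (l : Low root) where

      quadData : QuadData
      quadData = record
        { N = n ; frame = frame ; z = z ; matching = matching
        ; root = index l ; point = index point-low ; pointed = pointed }

      isomorphism : q ≅ QuadData.rp quadData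
      isomorphism = encode , decodeFlag , decode-encode , encode-decode ,
        transposed decode₀ , transposed decode₁ , transposed decode₂ ,
        encode-low l (e-index l) ,
        subst (λ p → CMap.SameV mapQ p (lo (index point-low))) (sym (encode-low point-low (e-index point-low))) ε

  open Flags Built.frame Built.matching (λ _ → refl) (λ _ → refl) e-a
    (λ s → cong e (Built.v-at flat s) ∙ e-η s)
    (λ s → cong e (Built.v-at rise s) ∙ e-τ rise s)
    (λ s → cong α₀ (e-z fall s) ∙ inv₀ _)
    (λ s → cong α₀ (e-τ flat s) ∙ inv₀ _)
    (e-z rise)
    (λ s → cong α₀ (e-τ fall s) ∙ inv₀ _)
    public using (quadData; isomorphism; point-low)

-- The frame of a map

slopeFromTo : ℕ → ℕ → Slope
slopeFromTo zero    zero    = flat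
slopeFromTo zero    (suc n) = rise
slopeFromTo (suc m) zero    = fall
slopeFromTo (suc m) (suc n) = slopeFromTo m n

slope-reverse : ∀ m n → slopeFromTo n m ≡ opp (slopeFromTo m n)
slope-reverse zero    zero    = refl
slope-reverse zero    (suc n) = refl
slope-reverse (suc m) zero    = refl
slope-reverse (suc m) (suc n) = slope-reverse m n

slope-flat : ∀ m n → slopeFromTo m n ≡ flat → m ≡ n
slope-flat zero    zero    eq = refl
slope-flat (suc m) (suc n) eq = cong suc (slope-flat m n eq)

slope-fall : ∀ m n → slopeFromTo m n ≡ fall → m ≤ suc n → m ≡ suc n
slope-fall (suc m)       (suc n) eq (s≤s le) = cong suc (slope-fall m n eq le)
slope-fall (suc zero)    zero    eq le       = refl
slope-fall (suc (suc m)) zero    eq (s≤s ())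

fall-slope : ∀ n → slopeFromTo (suc n) n ≡ fall
fall-slope zero    = refl
fall-slope (suc n) = fall-slope n

fall-from : ∀ {m n} → m ≡ suc n → slopeFromTo m n ≡ fall
fall-from {n = n} refl = fall-slope n

flat-from : ∀ {m n} → m ≡ n → slopeFromTo m n ≡ flat
flat-from {zero}  refl = refl
flat-from {suc n} refl = flat-from {n} refl

rise-from : ∀ {m n} → n ≡ suc m → slopeFromTo m n ≡ rise
rise-from {m} refl = slope-reverse (suc m) m ∙ cong opp (fall-slope m)

record MapData : Set where
  no-eta-equality
  field
    N        : ℕ
    frame    : Frame N
    t        : Fin N → Fin N
    matching : Frame.MapMatching frame t
    root     : Fin N
    point    : Fin N
    pointed  : FrameV.Pointed frame point

  rp : RPMap
  rp = record
    { map = FrameMaps.mapM frame matching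
    ; conn = MapFacts.Labelling.connected (Distances.OnMap.labelling frame matching pointed)
    ; root = root ; point = point }

  -- Slopes can be read off from distances, hence are preserved by isomorphisms of maps.
  slope-ℓ : ∀ x → slopeFromTo (Frame.ℓ frame x) (Frame.ℓ frame (t x)) ≡ Frame.slope frame x
  slope-ℓ x = slope-cases x
    (λ s → flat-from (sym (cong ℓ (on-flat s) ∙ ℓ-τ x)) ∙ sym s)
    (λ s → rise-from (drop (rise⇒fall s) ∙ cong (λ y → suc (ℓ y)) (inv x)) ∙ sym s)
    (λ s → fall-from (drop s) ∙ sym s)
    where
    open Frame frame
    open Matching matching

module ReadMap (M : RPMap) where
  open RPMap M
  open DistanceFunction map conn
  open From point

  slope : Fin N → Slope
  slope x = slopeFromTo (d x) (d (α₀ x))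

  Rise : Fin N → Set
  Rise x = slope x ≡ rise

  slope-α₀ : ∀ x → slope (α₀ x) ≡ opp (slope x)
  slope-α₀ x = cong (slopeFromTo (d (α₀ x)) ∘ d) (inv₀ x) ∙ slope-reverse (d x) _

  slope-α₂ : ∀ x → slope (α₂ x) ≡ slope x
  slope-α₂ x = cong₂ slopeFromTo (d-α₂ x) (cong d (comm₀₂ x) ∙ d-α₂ _)

  cases : ∀ {A : Set} x → (slope x ≡ flat → A) → (slope x ≡ rise → A) → (slope x ≡ fall → A) → A
  cases x = onSlope (slope x)

  drop : ∀ {x} → slope x ≡ fall → d x ≡ suc (d (α₀ x))
  drop {x} s = slope-fall (d x) _ s
    (ℕ.≤-trans (ℕ.≤-reflexive (cong d (sym (inv₀ x)))) (d-α₀ (α₀ x)))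

  -- On a map `τ` is only determined level by level. An arc is a candidate for `τ` that is an
  -- involution on all flags, but is the right one at a single level.
  record Arc : Set where
    no-eta-equality
    field
      b       : Fin N → Fin N
      b-inv   : ∀ x → b (b x) ≡ x
      slope-b : ∀ x → slope (b x) ≡ slope x
      d-b     : ∀ x → d (b x) ≡ d x

    open Segment α₁ b inv₁ b-inv Rise (λ x → slope x ≟ₛ rise) (λ {x} p → slope-b x ∙ p) public

    seg-d : ∀ {x} → Rise x → d (seg x) ≡ d x
    seg-d {x} p = Seg-inv (λ y → d y ≡ d x) (trans (d-α₁ _)) (trans (d-b _)) refl (seg-Seg p)

  -- The arcs below a falling edge, given the arcs one level lower: an arc starting along that
  -- edge descends it, follows a segment of the lower level and ascends again.
  stepBy : (Fin N → Fin N) → Slope → Fin N → Fin N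
  stepBy below flat x = α₀ x
  stepBy below rise x = α₂ x
  stepBy below fall x = below x

  raise : (below : Fin N → Fin N) →
    (∀ {x} → slope x ≡ fall → below (below x) ≡ x) →
    (∀ {x} → slope x ≡ fall → slope (below x) ≡ fall) →
    (∀ {x} → slope x ≡ fall → d (below x) ≡ d x) → Arc
  raise below below-inv below-fall below-d = record
    { b = b
    ; b-inv = λ x → cases x
        (λ s → at flat (flat-α₀ s) ∙ cong α₀ (at flat s) ∙ inv₀ x)
        (λ s → at rise (cong slope (at rise s) ∙ slope-α₂ x ∙ s) ∙
          cong α₂ (at rise s) ∙ inv₂ x)
        (λ s → at fall (cong slope (at fall s) ∙ below-fall s) ∙
          cong below (at fall s) ∙ below-inv s)
    ; slope-b = λ x → cases x
        (λ s → flat-α₀ s ∙ sym s)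
        (λ s → cong slope (at rise s) ∙ slope-α₂ x)
        (λ s → cong slope (at fall s) ∙ below-fall s ∙ sym s)
    ; d-b = λ x → cases x
        (λ s → cong d (at flat s) ∙ sym (slope-flat _ _ s))
        (λ s → cong d (at rise s) ∙ d-α₂ x)
        (λ s → cong d (at fall s) ∙ below-d s) }
    where
    b : Fin N → Fin N
    b x = stepBy below (slope x) x
    at : ∀ {x} s → slope x ≡ s → b x ≡ stepBy below s x
    at {x} s = cong (λ s → stepBy below s x)
    flat-α₀ : ∀ {x} → slope x ≡ flat → slope (b x) ≡ flat
    flat-α₀ {x} s = cong slope (at flat s) ∙ slope-α₀ x ∙ cong opp s

  arc : ℕ → Arc
  -- No flag at label 0 falls, so the identity is a harmless start.
  arc zero    = raise id (λ _ → refl) id (λ _ → refl)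
  arc (suc k) = raise (λ x → α₀ (seg (α₀ x)))
    (λ s → cong (α₀ ∘ seg) (inv₀ _) ∙ cong α₀ (seg-inv (rises s)) ∙ inv₀ _)
    falls
    (λ s → drop (falls s) ∙ cong (suc ∘ d) (inv₀ _) ∙
      cong suc (seg-d (rises s)) ∙ sym (drop s))
    where
    open Arc (arc k)
    rises : ∀ {x} → slope x ≡ fall → Rise (α₀ x)
    rises {x} s = slope-α₀ x ∙ cong opp s
    falls : ∀ {x} → slope x ≡ fall → slope (α₀ (seg (α₀ x))) ≡ fall
    falls s = slope-α₀ _ ∙ cong opp (seg-P (rises s))

  arc-flat : ∀ k {x} → slope x ≡ flat → Arc.b (arc k) x ≡ α₀ x
  arc-flat zero    {x} s = cong (λ s → stepBy id s x) s
  arc-flat (suc k) {x} s = cong (λ s → stepBy _ s x) s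

  arc-rise : ∀ k {x} → slope x ≡ rise → Arc.b (arc k) x ≡ α₂ x
  arc-rise zero    {x} s = cong (λ s → stepBy id s x) s
  arc-rise (suc k) {x} s = cong (λ s → stepBy _ s x) s

  arc-fall : ∀ k {x} → slope x ≡ fall → Arc.b (arc (suc k)) x ≡ α₀ (Arc.seg (arc k) (α₀ x))
  arc-fall k {x} s = cong (λ s → stepBy _ s x) s

  τ : Fin N → Fin N
  τ x = Arc.b (arc (d x)) x

  τ-level : ∀ k {x} → d x ≡ k → τ x ≡ Arc.b (arc k) x
  τ-level k refl = refl

  τ-flat : ∀ {x} → slope x ≡ flat → τ x ≡ α₀ x
  τ-flat {x} = arc-flat (d x)

  τ-rise : ∀ {x} → slope x ≡ rise → τ x ≡ α₂ x
  τ-rise {x} = arc-rise (d x)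

  d-τ : ∀ x → d (τ x) ≡ d x
  d-τ x = Arc.d-b (arc (d x)) x

  τ-inv : ∀ x → τ (τ x) ≡ x
  τ-inv x = τ-level (d x) (d-τ x) ∙ Arc.b-inv (arc (d x)) x

  slope-τ : ∀ x → slope (τ x) ≡ slope x
  slope-τ x = Arc.slope-b (arc (d x)) x

  rises : ∀ {x} → slope x ≡ fall → Rise (α₀ x)
  rises {x} s = slope-α₀ x ∙ cong opp s

  -- A fixed falling flag would make the segment below it end where it starts, a reflection with a
  -- fixed point one level lower.
  τ-fpf : ∀ k {x} → d x ≡ k → τ x ≢ x
  τ-fpf-fall : ∀ k {x} → d x ≡ k → slope x ≡ fall → τ x ≢ x
  τ-fpf k {x} eq p = cases x
    (λ s → fpf₀ x (sym (τ-flat s) ∙ p))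
    (λ s → fpf₂ x (sym (τ-rise s) ∙ p))
    (λ s → τ-fpf-fall k eq s p)
  τ-fpf-fall zero eq s p = ℕ.0≢1+n (sym eq ∙ drop s)
  τ-fpf-fall (suc k) {x} eq s p = seg-fpf (λ y → d y ≡ k) (trans (d-α₁ _)) (trans (d-b _))
      (λ {y} _ → fpf₁ y) (λ {y} i q → τ-fpf k i (τ-level k i ∙ q))
      (rises s) (ℕ.suc-injective (sym (drop s) ∙ eq))
      (sym (inv₀ _) ∙ cong α₀ (sym (τ-level (suc k) eq ∙ arc-fall k s) ∙ p))
    where open Arc (arc k)

  frame : Frame N
  frame = record
    { a = α₁ ; v = α₂ ; τ = τ ; slope = slope ; ℓ = d
    ; a-inv = inv₁ ; v-inv = inv₂ ; τ-inv = τ-inv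
    ; a-fpf = fpf₁ ; v-fpf = fpf₂ ; τ-fpf = λ x → τ-fpf _ refl
    ; slope-v = slope-α₂ ; slope-τ = slope-τ
    ; ℓ-a = d-α₁ ; ℓ-v = d-α₂ ; ℓ-τ = d-τ
    ; τ-rise = τ-rise
    ; flat-comm = λ {x} s → cong α₂ (τ-flat s) ∙ sym (comm₀₂ x) ∙
        sym (τ-flat (slope-α₂ x ∙ s))
    ; flat-fpf = λ {x} s p → fpf₀₂ x (comm₀₂ x ∙ sym (cong α₂ (τ-flat s)) ∙ p) }

  -- A segment stays on one level, where `τ` and the arc of that level agree.
  seg-level : ∀ k {x} → Rise x → d x ≡ k → Frame.seg frame x ≡ Arc.seg (arc k) x
  seg-level k r eq = sym (Arc.Seg⇒seg (arc k) r (Seg-map id (λ y → d y ≡ k)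
    (trans (d-α₁ _)) (trans (d-τ _)) id id (λ _ → refl) (τ-level k) eq (Frame.seg-Seg frame r)))

  matching : Frame.MapMatching frame α₀
  matching = record
    { inv = inv₀ ; slopes = slope-α₀ ; on-flat = λ s → sym (τ-flat s) ; drop = drop
    ; mv = λ {x} s → comm₀₂ x ∙ sym (τ-rise (rises s))
    ; mτ = λ {x} s → let k = d (α₀ x) in
        cong α₀ (τ-level (suc k) (drop s) ∙ arc-fall k s) ∙
          inv₀ _ ∙ sym (seg-level k (rises s) refl) }

  pointed : FrameV.Pointed frame point
  pointed = record
    { ℓ-point = d-point
    ; ℓ-zero = d-zero
    ; ℓ-suc = λ x k eq → let (y , s , eq′) = d-suc x k eq in
        y , s , cong₂ slopeFromTo (d-V s ∙ eq) eq′ ∙ fall-slope k }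

  mapData : MapData
  mapData = record
    { N = N ; frame = frame ; t = α₀ ; matching = matching
    ; root = root ; point = point ; pointed = pointed }

  isomorphism : M ≅ MapData.rp mapData
  isomorphism = id , id , (λ _ → refl) , (λ _ → refl) , (λ _ → refl) , (λ _ → refl) , (λ _ → refl) , refl , ε

-- Both constructions are injective up to isomorphism

module QuadToMap (D : QuadData) where
  open QuadData D
  open Frame frame
  open FrameMaps frame using (flag-elim; on-lo; on-up)
  module W = MapWords (RPMap.map rp) (lo root)

  visit : ℕ → Fin N
  visit k = pr (W.word k)

  pr-lo : ∀ x → pr (lo x) ≡ x
  pr-lo = on-lo id id

  pr-up : ∀ x → pr (up x) ≡ x
  pr-up = on-up id id

  visit-onto : ∀ x → ∃[ k ] visit k ≡ x
  visit-onto x with W.word-onto (RPMap.conn rp) (lo x)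
  ... | k , eq = k , cong pr eq ∙ pr-lo x

  choice : Σ[ o ∈ (Fin N → Bool) ] (Orientation o × First true visit o)
  choice = oriented a-fpf τ-fpf visit
    (λ x → let (k , eq) = visit-onto x in k , subst (Loop x) (sym eq) ε)

  o : Fin N → Bool
  o = proj₁ choice

  O : Orientation o
  O = proj₁ (proj₂ choice)

  o-first : First true visit o
  o-first = proj₂ (proj₂ choice)

  open Pair frame matching O using (t; mt) public

  mapData : MapData
  mapData = record
    { N = N ; frame = frame ; t = t ; matching = mt ; root = root ; point = point ; pointed = pointed }

  surface : ∀ S → OnSurface (RPMap.map rp) S → OnSurface (RPMap.map (MapData.rp mapData)) S
  surface = PairSurface.surface⇒ frame matching O

  numEdges : ∀ {k} → RPMap.NumFaces rp k → RPMap.NumEdges (MapData.rp mapData) k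
  numEdges = Pair.numFaces⇒numEdges frame matching O

  untwist : ∀ x → twist (not ∘ o) t x ≡ z x
  untwist = TwistMatching.twist-twist O {ρ′ = τ} {σ′ = seg} matching (Twist.θ-seg O) (Twist.θ-τ O)

module MapToQuad (E : MapData) where
  open MapData E
  open Frame frame
  module W = MapWords (RPMap.map rp) root

  choice : Σ[ o ∈ (Fin N → Bool) ] (Orientation o × First true W.word o)
  choice = oriented a-fpf τ-fpf W.word
    (λ x → let (k , eq) = W.word-onto (RPMap.conn rp) x in k , subst (Loop x) (sym eq) ε)

  o : Fin N → Bool
  o = proj₁ choice

  O : Orientation o
  O = proj₁ (proj₂ choice)

  o-first : First true W.word o
  o-first = proj₂ (proj₂ choice)

  open TwistMatching O {ρ′ = seg} {σ′ = τ} matching (Twist.θ-τ O) (Twist.θ-seg O)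
    public using () renaming (t to z; matching to mz; twist-twist to untwist)

  quadData : QuadData
  quadData = record
    { N = N ; frame = frame ; z = z ; matching = mz ; root = root ; point = point ; pointed = pointed }

  open Pair frame mz (not-orientation O) using () renaming (t to t′; mt to mt′)

  -- Twisting back gives `t` only pointwise, so the facts on pairs are carried over by an
  -- isomorphism whose underlying map is the identity.
  partner : MapData
  partner = record
    { N = N ; frame = frame ; t = t′ ; matching = mt′ ; root = root ; point = point ; pointed = pointed }

  partner-≅ : rp ≅ MapData.rp partner
  partner-≅ = id , id , (λ _ → refl) , (λ _ → refl) , (λ x → sym (untwist x)) ,
    (λ _ → refl) , (λ _ → refl) , refl , ε

  quadrangulation : RPMap.IsQuadrangulation (QuadData.rp quadData)
  quadrangulation = Distances.OnQuad.quadrangulation frame mz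

  bipartite : RPMap.IsBipartite (QuadData.rp quadData)
  bipartite = Distances.OnQuad.bipartite frame mz

  surface : ∀ S → OnSurface (RPMap.map rp) S → OnSurface (RPMap.map (QuadData.rp quadData)) S
  surface S s = PairSurface.surface⇐ frame mz (not-orientation O) S
    (≅-surface {rp} {MapData.rp partner} partner-≅ S s)

  numFaces : ∀ {k} → RPMap.NumEdges rp k → RPMap.NumFaces (QuadData.rp quadData) k
  numFaces c = Pair.numEdges⇒numFaces frame mz (not-orientation O)
    (IsoTransfer.numEdges {rp} {MapData.rp partner} partner-≅ c)

record FrameIso {N N′ : ℕ} (F : Frame N) (F′ : Frame N′) : Set where
  no-eta-equality
  private
    module F  = Frame F
    module F′ = Frame F′
  field
    f  : Fin N → Fin N′
    g  : Fin N′ → Fin N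
    gf : ∀ x → g (f x) ≡ x
    fg : ∀ y → f (g y) ≡ y
    frameMap : FrameMap F F′ f
    f-v : ∀ x → f (F.v x) ≡ F′.v (f x)

module MapIso (E E′ : MapData) (i : MapData.rp E ≅ MapData.rp E′) where
  private
    module E   = MapData E
    module E′  = MapData E′
    module F   = Frame E.frame
    module F′  = Frame E′.frame
    module m   = F.Matching E.matching
    module m′  = F′.Matching E′.matching
    module L   = MapFacts.Labelling (Distances.OnMap.labelling E.frame E.matching E.pointed)
    module L′  = MapFacts.Labelling (Distances.OnMap.labelling E′.frame E′.matching E′.pointed)
  open Iso {E.rp} {E′.rp} i public using (f; g; gf; fg; f-injective; f-root; f-point)
    renaming (f₀ to f-t; f₁ to f-a; f₂ to f-v)

  f-ℓ : ∀ x → F′.ℓ (f x) ≡ F.ℓ x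
  f-ℓ x = MapFacts.dist-unique (RPMap.map E′.rp) (L′.isDist (f x))
    (IsoTransfer.dist {E.rp} {E′.rp} i (L.isDist x))

  f-slope : ∀ x → F′.slope (f x) ≡ F.slope x
  f-slope x = sym (E′.slope-ℓ (f x)) ∙ cong₂ slopeFromTo (f-ℓ x) (cong F′.ℓ (sym (f-t x)) ∙ f-ℓ (E.t x)) ∙ E.slope-ℓ x

  f-slope-at : ∀ {x s} → F.slope x ≡ s → F′.slope (f x) ≡ s
  f-slope-at = trans (f-slope _)

  -- Only `t`, `a` and `v` are known to commute with `f`. At a fall `t` reduces `τ` to a segment one
  -- level lower, whence the induction.
  f-τ : ∀ k x → F.ℓ x ≡ k → f (F.τ x) ≡ F′.τ (f x)
  f-τ-fall : ∀ k x → F.ℓ x ≡ k → F.slope x ≡ fall → f (F.τ x) ≡ F′.τ (f x)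
  f-τ k x eq = F.slope-cases x
    (λ s → cong f (sym (m.on-flat s)) ∙ f-t x ∙ m′.on-flat (f-slope-at s))
    (λ s → cong f (F.τ-rise s) ∙ f-v x ∙ sym (F′.τ-rise (f-slope-at s)))
    (f-τ-fall k x eq)
  f-τ-fall zero x eq s = ⊥-elim (ℕ.0≢1+n (sym eq ∙ m.drop s))
  f-τ-fall (suc k) x eq s = m′.injective (sym (f-t (F.τ x)) ∙
    cong f (m.mτ s) ∙ sym (F′.Seg⇒seg (f-slope-at (m.fall⇒rise s)) (Seg-map f (λ y → F.ℓ y ≡ k)
        (trans (F.ℓ-a _)) (trans (F.ℓ-τ _)) (trans (f-slope _)) (trans (sym (f-slope _)))
        (λ {y} _ → f-a y) (λ {y} e → f-τ k y e) (ℕ.suc-injective (sym (m.drop s) ∙ eq))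
        (F.seg-Seg (m.fall⇒rise s)))) ∙
      cong F′.seg (f-t x) ∙ sym (m′.mτ (f-slope-at s)))

  frameIso : FrameIso E.frame E′.frame
  frameIso = record
    { f = f ; g = g ; gf = gf ; fg = fg ; f-v = f-v
    ; frameMap = record { f-inj = f-injective ; f-slope = f-slope ; f-a = f-a ; f-τ = λ x → f-τ _ x refl } }

module QuadIsoLow (D D′ : QuadData) (i : QuadData.rp D ≅ QuadData.rp D′) where
  private
    module D   = QuadData D
    module D′  = QuadData D′
    module M′  = FrameMaps D′.frame
    module B   = FrameMaps.Quad D.frame D.matching
    module B′  = FrameMaps.Quad D′.frame D′.matching
    module L   = MapFacts.Labelling (Distances.OnQuad.labelling D.frame D.matching D.pointed)
    module L′  = MapFacts.Labelling (Distances.OnQuad.labelling D′.frame D′.matching D′.pointed)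
    module Q   = Distances.OnQuad D.frame D.matching
    module Q′  = Distances.OnQuad D′.frame D′.matching
  open Iso {D.rp} {D′.rp} i public using (f₀; f₁; f₂; f-root; f-point; f-injective)
    renaming (f to F̂; g to Ĝ; gf to ĜF̂; fg to F̂Ĝ)

  F̂-label : ∀ p → Q′.label (F̂ p) ≡ Q.label p
  F̂-label p = MapFacts.dist-unique (RPMap.map D′.rp) (L′.isDist (F̂ p))
    (IsoTransfer.dist {D.rp} {D′.rp} i (L.isDist p))

  f : Fin D.N → Fin D′.N
  f x = D′.pr (F̂ (D.lo x))

  -- Labels are preserved at both ends of the edge, but would increase along the edge and decrease
  -- along its image.
  F̂-lo≢up : ∀ x y → F̂ (D.lo x) ≢ D′.up y
  F̂-lo≢up x y eq = ℕ.m≢1+n+m (Frame.ℓ D′.frame y) {1} (above ∙ cong suc below)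
    where
    below : Frame.ℓ D.frame x ≡ suc (Frame.ℓ D′.frame y)
    below = sym (Q.label-lo x) ∙ sym (F̂-label _) ∙ cong Q′.label eq ∙ Q′.label-up y
    above : Frame.ℓ D′.frame y ≡ suc (Frame.ℓ D.frame x)
    above = sym (Q′.label-β₀-up y) ∙ cong (Q′.label ∘ B′.β₀) (sym eq) ∙
      cong Q′.label (sym (f₀ (D.lo x))) ∙ F̂-label _ ∙ Q.label-β₀-lo x

  F̂-lo : ∀ x → F̂ (D.lo x) ≡ D′.lo (f x)
  F̂-lo x = M′.flag-elim (λ p → F̂ (D.lo x) ≡ p → p ≡ D′.lo (D′.pr p))
    (λ y _ → cong D′.lo (sym (M′.on-lo id id y)))
    (λ y eq → ⊥-elim (F̂-lo≢up x y eq)) (F̂ (D.lo x)) refl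

  F̂-up : ∀ x → F̂ (D.up x) ≡ D′.up (f x)
  F̂-up x = cong F̂ (sym (B.β₀-lo x)) ∙ f₀ _ ∙ cong B′.β₀ (F̂-lo x) ∙ B′.β₀-lo _

module QuadIso (D D′ : QuadData) (i : QuadData.rp D ≅ QuadData.rp D′) where
  private
    module D   = QuadData D
    module D′  = QuadData D′
    module F   = Frame D.frame
    module F′  = Frame D′.frame
    module m   = F.Matching D.matching
    module m′  = F′.Matching D′.matching
    module B   = FrameMaps.Quad D.frame D.matching
    module B′  = FrameMaps.Quad D′.frame D′.matching
    module M   = FrameMaps D.frame
    module M′  = FrameMaps D′.frame
    module J   = QuadIsoLow D′ D (≅-sym {D.rp} {D′.rp} i)
  open QuadIsoLow D D′ i public

  g : Fin D′.N → Fin D.N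
  g = J.f

  gf : ∀ x → g (f x) ≡ x
  gf x = cong (D.pr ∘ Ĝ) (sym (F̂-lo x)) ∙ cong D.pr (ĜF̂ _) ∙ M.on-lo id id x

  fg : ∀ y → f (g y) ≡ y
  fg y = cong (D′.pr ∘ F̂) (sym (J.F̂-lo y)) ∙ cong D′.pr (F̂Ĝ _) ∙ M′.on-lo id id y

  f-inj : ∀ {x y} → f x ≡ f y → x ≡ y
  f-inj eq = sym (gf _) ∙ cong g eq ∙ gf _

  f-a : ∀ x → f (F.a x) ≡ F′.a (f x)
  f-a x = M′.lo-inj (sym (F̂-lo _) ∙ cong F̂ (sym (B.β₂-lo x)) ∙
    f₂ _ ∙ cong B′.β₂ (F̂-lo x) ∙ B′.β₂-lo _)

  lo→lo : ∀ {x y} → B.β₁ (D.lo x) ≡ D.lo y → B′.β₁ (D′.lo (f x)) ≡ D′.lo (f y)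
  lo→lo eq = cong B′.β₁ (sym (F̂-lo _)) ∙ sym (f₁ _) ∙ cong F̂ eq ∙ F̂-lo _

  lo→up : ∀ {x y} → B.β₁ (D.lo x) ≡ D.up y → B′.β₁ (D′.lo (f x)) ≡ D′.up (f y)
  lo→up eq = cong B′.β₁ (sym (F̂-lo _)) ∙ sym (f₁ _) ∙ cong F̂ eq ∙ F̂-up _

  up→lo : ∀ {x y} → B.β₁ (D.up x) ≡ D.lo y → B′.β₁ (D′.up (f x)) ≡ D′.lo (f y)
  up→lo eq = cong B′.β₁ (sym (F̂-up _)) ∙ sym (f₁ _) ∙ cong F̂ eq ∙ F̂-lo _

  up→up : ∀ {x y} → B.β₁ (D.up x) ≡ D.up y → B′.β₁ (D′.up (f x)) ≡ D′.up (f y)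
  up→up eq = cong B′.β₁ (sym (F̂-up _)) ∙ sym (f₁ _) ∙ cong F̂ eq ∙ F̂-up _

  -- The slope is visible in whether turning switches between low and upper flags, which the
  -- isomorphism preserves.
  f-fall : ∀ {x} → F.slope x ≡ fall → F′.slope (f x) ≡ fall
  f-fall {x} s = F′.slope-cases (f x)
    (λ s′ → ⊥-elim (M′.up≢lo (sym (lo→up (B.β₁-lo fall s)) ∙ B′.β₁-lo flat s′)))
    (λ s′ → ⊥-elim (M′.up≢lo (sym (lo→up (B.β₁-lo fall s)) ∙ B′.β₁-lo rise s′)))
    id

  f-rise : ∀ {x} → F.slope x ≡ rise → F′.slope (f x) ≡ rise
  f-rise {x} s = F′.slope-cases (f x)
    (λ s′ → ⊥-elim (M′.up≢lo (sym (B′.β₁-up flat s′) ∙ up→lo (B.β₁-up rise s))))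
    id
    (λ s′ → ⊥-elim (M′.up≢lo (sym (B′.β₁-up fall s′) ∙ up→lo (B.β₁-up rise s))))

  f-flat : ∀ {x} → F.slope x ≡ flat → F′.slope (f x) ≡ flat
  f-flat {x} s = F′.slope-cases (f x) id
    (λ s′ → ⊥-elim (M′.up≢lo (sym (up→up (B.β₁-up flat s)) ∙ B′.β₁-up rise s′)))
    (λ s′ → ⊥-elim (M′.up≢lo (sym (B′.β₁-lo fall s′) ∙ lo→lo (B.β₁-lo flat s))))

  f-τ : ∀ x → f (F.τ x) ≡ F′.τ (f x)
  f-τ x = F.slope-cases x
    (λ s → M′.up-inj (sym (up→up (B.β₁-up flat s)) ∙ B′.β₁-up flat (f-flat s)))
    (λ s → cong f (F.τ-rise s) ∙ M′.lo-inj (sym (lo→lo (B.β₁-lo rise s)) ∙ B′.β₁-lo rise (f-rise s)) ∙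
      sym (F′.τ-rise (f-rise s)))
    (λ s → M′.up-inj (sym (up→up (B.β₁-up fall s)) ∙ B′.β₁-up fall (f-fall s)))

  f-z : ∀ x → f (D.z x) ≡ D′.z (f x)
  f-z x = F.slope-cases x
    (λ s → cong f (m.on-flat s) ∙ f-τ x ∙ sym (m′.on-flat (f-flat s)))
    (λ s → M′.lo-inj (sym (up→lo (B.β₁-up rise s)) ∙ B′.β₁-up rise (f-rise s)))
    (λ s → M′.up-inj (sym (lo→up (B.β₁-lo fall s)) ∙ B′.β₁-lo fall (f-fall s)))

  frameMap : FrameMap D.frame D′.frame f
  frameMap = record
    { f-inj = f-inj
    ; f-slope = λ x → F.slope-cases x (λ s → f-flat s ∙ sym s)
        (λ s → f-rise s ∙ sym s) (λ s → f-fall s ∙ sym s)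
    ; f-a = f-a ; f-τ = f-τ }

  f-v : ∀ x → f (F.v x) ≡ F′.v (f x)
  f-v x = F.slope-cases x
    (λ s → M′.lo-inj (sym (lo→lo (B.β₁-lo flat s)) ∙ B′.β₁-lo flat (f-flat s)))
    (λ s → M′.lo-inj (sym (lo→lo (B.β₁-lo rise s)) ∙ B′.β₁-lo rise (f-rise s)))
    (λ s → m′.injective (sym (f-z (F.v x)) ∙ cong f (m.mv s) ∙
      FrameMap.f-seg frameMap (m.fall⇒rise s) ∙
        cong F′.seg (f-z x) ∙ sym (m′.mv (f-fall s))))

  frameIso : FrameIso D.frame D′.frame
  frameIso = record { f = f ; g = g ; gf = gf ; fg = fg ; frameMap = frameMap ; f-v = f-v }

  root-f : f D.root ≡ D′.root
  root-f = M′.lo-inj (sym (F̂-lo _) ∙ f-root)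

  point-f : FrameV.SameV D′.frame (f D.point) D′.point
  point-f = Distances.OnQuad.sameV⇐ D′.frame D′.matching
    (subst (λ p → RPMap.SameV D′.rp p (D′.lo D′.point)) (F̂-lo _) f-point)

buildMapIso : (E E′ : MapData) (φ : FrameIso (MapData.frame E) (MapData.frame E′)) →
  (∀ x → FrameIso.f φ (MapData.t E x) ≡ MapData.t E′ (FrameIso.f φ x)) →
  FrameIso.f φ (MapData.root E) ≡ MapData.root E′ →
  FrameV.SameV (MapData.frame E′) (FrameIso.f φ (MapData.point E)) (MapData.point E′) →
  MapData.rp E ≅ MapData.rp E′
buildMapIso E E′ φ f-t r p = f , g , gf , fg , f-t , FrameMap.f-a frameMap , f-v , r , p
  where open FrameIso φ

-- Φ respects isomorphism: an isomorphism carries words to words, hence the orientation chosen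
-- on each loop to the one chosen on its image.
map-respects : ∀ D D′ → QuadData.rp D ≅ QuadData.rp D′ →
  MapData.rp (QuadToMap.mapData D) ≅ MapData.rp (QuadToMap.mapData D′)
map-respects D D′ i = buildMapIso (QuadToMap.mapData D) (QuadToMap.mapData D′) I.frameIso f-t I.root-f I.point-f
  where
  module I = QuadIso D D′ i
  module D = QuadToMap D
  module D′ = QuadToMap D′
  module F = Frame (QuadData.frame D)
  module F′ = Frame (QuadData.frame D′)
  module m = F.Matching (QuadData.matching D)
  open I using (f; F̂)
  open FrameMap I.frameMap using (f-θ)

  F̂-act : ∀ w → F̂ (D.W.act w) ≡ D′.W.act w
  F̂-act []                       = I.f-root
  F̂-act (zero ∷ w)               = I.f₀ _ ∙ cong (RPMap.α₀ (QuadData.rp D′)) (F̂-act w)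
  F̂-act (suc zero ∷ w)           = I.f₁ _ ∙ cong (RPMap.α₁ (QuadData.rp D′)) (F̂-act w)
  F̂-act (suc (suc zero) ∷ w)     = I.f₂ _ ∙ cong (RPMap.α₂ (QuadData.rp D′)) (F̂-act w)

  f-pr : ∀ p → QuadData.pr D′ (F̂ p) ≡ f (QuadData.pr D p)
  f-pr = FrameMaps.flag-elim (QuadData.frame D) _
    (λ x → cong f (sym (D.pr-lo x)))
    (λ x → cong (QuadData.pr D′) (I.F̂-up x) ∙ D′.pr-up (f x) ∙ cong f (sym (D.pr-up x)))

  f-visit : ∀ k → f (D.visit k) ≡ D′.visit k
  f-visit k = sym (f-pr (D.W.word k)) ∙ cong (QuadData.pr D′) (F̂-act (decode k))

  f-o : ∀ x → D.o x ≡ D′.o (f x)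
  f-o x with D.visit-onto x
  ... | k , refl = FirstVisits.agrees I.frameMap D.O D′.O D.o-first D′.o-first k (λ j _ → f-visit j)

  f-t : ∀ x → f (D.t x) ≡ D′.t (f x)
  f-t x = F.slope-cases x
    (λ s → cong f (F.twist-flat s) ∙ I.f-z x ∙ sym (F′.twist-flat (I.f-flat s)))
    (λ s → cong f (F.twist-rise s) ∙ I.f-z _ ∙
      cong (QuadData.z D′) (f-θ (not ∘ D.o) (not ∘ D′.o) s (cong not (f-o x))) ∙
        sym (F′.twist-rise (I.f-rise s)))
    (λ s → cong f (F.twist-fall s) ∙ f-θ D.o D′.o (m.fall⇒rise s) (f-o _) ∙
      cong (F′.θ D′.o) (I.f-z x) ∙ sym (F′.twist-fall (I.f-fall s)))

-- The frames and `t` correspond, and `z` is the twist of `t` by the reversed orientation. Among the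
-- generators of the quadrangulation only `β₁`, at falling low flags and rising upper flags,
-- involves `z`; all the rest commutes at once.
quad-injective : ∀ D D′ →
  MapData.rp (QuadToMap.mapData D) ≅ MapData.rp (QuadToMap.mapData D′) → QuadData.rp D ≅ QuadData.rp D′
quad-injective D D′ i = h , h⁻ ,
    M.flag-elim _ (λ x → cong h⁻ (h-lo x) ∙ h⁻-lo _ ∙ cong DD.lo (gf x))
                  (λ x → cong h⁻ (h-up x) ∙ h⁻-up _ ∙ cong DD.up (gf x)) ,
    M′.flag-elim _ (λ x → cong h (h⁻-lo x) ∙ h-lo _ ∙ cong DD′.lo (fg x))
                   (λ x → cong h (h⁻-up x) ∙ h-up _ ∙ cong DD′.up (fg x)) ,
    h-commutes zero , h-commutes (suc zero) , h-commutes (suc (suc zero)) , h-root ,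
    subst (λ p → RPMap.SameV DD′.rp p (DD′.lo DD′.point)) (sym (h-lo _))
      (Distances.OnQuad.sameV⇒ DD′.frame DD′.matching I.f-point)
  where
  module I = MapIso (QuadToMap.mapData D) (QuadToMap.mapData D′) i
  module D = QuadToMap D
  module D′ = QuadToMap D′
  module DD = QuadData D
  module DD′ = QuadData D′
  module M = FrameMaps DD.frame
  module M′ = FrameMaps DD′.frame
  module B = FrameMaps.Quad DD.frame DD.matching
  module B′ = FrameMaps.Quad DD′.frame DD′.matching
  module F = Frame DD.frame
  module F′ = Frame DD′.frame
  open I using (f; g; gf; fg; f-a; f-v; f-t; f-slope-at)
  open FrameIso I.frameIso using (frameMap)
  open FrameMap frameMap using (f-τ)

  h : Fin (DD.N + DD.N) → Fin (DD′.N + DD′.N)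
  h = M.onFlags (DD′.lo ∘ f) (DD′.up ∘ f)

  h⁻ : Fin (DD′.N + DD′.N) → Fin (DD.N + DD.N)
  h⁻ = M′.onFlags (DD.lo ∘ g) (DD.up ∘ g)

  h-lo : ∀ x → h (DD.lo x) ≡ DD′.lo (f x)
  h-lo = M.on-lo _ _

  h-up : ∀ x → h (DD.up x) ≡ DD′.up (f x)
  h-up = M.on-up _ _

  h⁻-lo : ∀ x → h⁻ (DD′.lo x) ≡ DD.lo (g x)
  h⁻-lo = M′.on-lo _ _

  h⁻-up : ∀ x → h⁻ (DD′.up x) ≡ DD.up (g x)
  h⁻-up = M′.on-up _ _

  h-root : h (DD.lo DD.root) ≡ DD′.lo DD′.root
  h-root = h-lo _ ∙ cong DD′.lo I.f-root

  h-pr : ∀ p → DD′.pr (h p) ≡ f (DD.pr p)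
  h-pr = M.flag-elim _
    (λ x → cong DD′.pr (h-lo x) ∙ D′.pr-lo _ ∙ cong f (sym (D.pr-lo x)))
    (λ x → cong DD′.pr (h-up x) ∙ D′.pr-up _ ∙ cong f (sym (D.pr-up x)))

  via-lo : ∀ {x q y} → B.β₁ (DD.lo x) ≡ q → B′.β₁ (DD′.lo (f x)) ≡ y → h q ≡ y →
    h (B.β₁ (DD.lo x)) ≡ B′.β₁ (h (DD.lo x))
  via-lo e e′ e″ = cong h e ∙ e″ ∙ sym e′ ∙ cong B′.β₁ (sym (h-lo _))

  via-up : ∀ {x q y} → B.β₁ (DD.up x) ≡ q → B′.β₁ (DD′.up (f x)) ≡ y → h q ≡ y →
    h (B.β₁ (DD.up x)) ≡ B′.β₁ (h (DD.up x))
  via-up e e′ e″ = cong h e ∙ e″ ∙ sym e′ ∙ cong B′.β₁ (sym (h-up _))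

  s : Fin DD.N → Fin DD.N
  s = F.twist (not ∘ D.o) D.t

  s′ : Fin DD′.N → Fin DD′.N
  s′ = F′.twist (not ∘ D′.o) D′.t

  s-at : ∀ {p x} → DD.pr p ≡ x → s (DD.pr p) ≡ DD.z x
  s-at {p} {x} e = cong s e ∙ D.untwist x

  s′-at : ∀ {p x} → DD.pr p ≡ x → s′ (f (DD.pr p)) ≡ DD′.z (f x)
  s′-at {p} {x} e = cong (λ y → s′ (f y)) e ∙ D′.untwist (f x)

  f-z-at : ∀ {p x} → DD.pr p ≡ x → f (s (DD.pr p)) ≡ s′ (f (DD.pr p)) → f (DD.z x) ≡ DD′.z (f x)
  f-z-at {p} {x} e c = cong f (sym (s-at {p} {x} e)) ∙ c ∙ s′-at {p} {x} e

  Turn : Fin (DD.N + DD.N) → Set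
  Turn p = h (B.β₁ p) ≡ B′.β₁ (h p) ⊎
    (DD.pr (B.β₁ p) ≡ s (DD.pr p) × DD′.pr (B′.β₁ (h p)) ≡ s′ (f (DD.pr p)) ×
     (f (s (DD.pr p)) ≡ s′ (f (DD.pr p)) → h (B.β₁ p) ≡ B′.β₁ (h p)))

  turn-lo-fall : ∀ x → F.slope x ≡ fall → Turn (DD.lo x)
  turn-lo-fall x e = inj₂ (here , there′ , λ c → via-lo (B.β₁-lo fall e) (B′.β₁-lo fall (f-slope-at e))
      (h-up (DD.z x) ∙ cong DD′.up (f-z-at {DD.lo x} (D.pr-lo x) c)))
    where
    here : DD.pr (B.β₁ (DD.lo x)) ≡ s (DD.pr (DD.lo x))
    here = cong DD.pr (B.β₁-lo fall e) ∙ D.pr-up (DD.z x) ∙ sym (s-at {DD.lo x} (D.pr-lo x))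
    there′ : DD′.pr (B′.β₁ (h (DD.lo x))) ≡ s′ (f (DD.pr (DD.lo x)))
    there′ = cong (λ p → DD′.pr (B′.β₁ p)) (h-lo x) ∙
      cong DD′.pr (B′.β₁-lo fall (f-slope-at e)) ∙
        D′.pr-up (DD′.z (f x)) ∙ sym (s′-at {DD.lo x} (D.pr-lo x))

  turn-up-rise : ∀ x → F.slope x ≡ rise → Turn (DD.up x)
  turn-up-rise x e = inj₂ (here , there′ , λ c → via-up (B.β₁-up rise e) (B′.β₁-up rise (f-slope-at e))
      (h-lo (DD.z x) ∙ cong DD′.lo (f-z-at {DD.up x} (D.pr-up x) c)))
    where
    here : DD.pr (B.β₁ (DD.up x)) ≡ s (DD.pr (DD.up x))
    here = cong DD.pr (B.β₁-up rise e) ∙ D.pr-lo (DD.z x) ∙ sym (s-at {DD.up x} (D.pr-up x))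
    there′ : DD′.pr (B′.β₁ (h (DD.up x))) ≡ s′ (f (DD.pr (DD.up x)))
    there′ = cong (λ p → DD′.pr (B′.β₁ p)) (h-up x) ∙
      cong DD′.pr (B′.β₁-up rise (f-slope-at e)) ∙
        D′.pr-lo (DD′.z (f x)) ∙ sym (s′-at {DD.up x} (D.pr-up x))

  turn-lo : ∀ x → Turn (DD.lo x)
  turn-lo x = F.slope-cases x
    (λ e → inj₁ (via-lo (B.β₁-lo flat e) (B′.β₁-lo flat (f-slope-at e)) (h-lo _ ∙ cong DD′.lo (f-v x))))
    (λ e → inj₁ (via-lo (B.β₁-lo rise e) (B′.β₁-lo rise (f-slope-at e)) (h-lo _ ∙ cong DD′.lo (f-v x))))
    (turn-lo-fall x)

  turn-up : ∀ x → Turn (DD.up x)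
  turn-up x = F.slope-cases x
    (λ e → inj₁ (via-up (B.β₁-up flat e) (B′.β₁-up flat (f-slope-at e)) (h-up _ ∙ cong DD′.up (f-τ x))))
    (turn-up-rise x)
    (λ e → inj₁ (via-up (B.β₁-up fall e) (B′.β₁-up fall (f-slope-at e)) (h-up _ ∙ cong DD′.up (f-τ x))))

  h-G : ∀ j p → h (generator (RPMap.map DD.rp) j p) ≡ generator (RPMap.map DD′.rp) j (h p) ⊎
    (DD.pr (generator (RPMap.map DD.rp) j p) ≡ s (DD.pr p) ×
     DD′.pr (generator (RPMap.map DD′.rp) j (h p)) ≡ s′ (f (DD.pr p)) ×
     (f (s (DD.pr p)) ≡ s′ (f (DD.pr p)) →
       h (generator (RPMap.map DD.rp) j p) ≡ generator (RPMap.map DD′.rp) j (h p)))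
  h-G zero = M.flag-elim _
    (λ x → inj₁ (cong h (B.β₀-lo x) ∙ h-up x ∙ sym (cong B′.β₀ (h-lo x) ∙ B′.β₀-lo _)))
    (λ x → inj₁ (cong h (B.β₀-up x) ∙ h-lo x ∙ sym (cong B′.β₀ (h-up x) ∙ B′.β₀-up _)))
  h-G (suc zero) = M.flag-elim _ turn-lo turn-up
  h-G (suc (suc zero)) = M.flag-elim _
    (λ x → inj₁ (cong h (B.β₂-lo x) ∙ h-lo _ ∙ cong DD′.lo (f-a x) ∙
      sym (cong B′.β₂ (h-lo x) ∙ B′.β₂-lo _)))
    (λ x → inj₁ (cong h (B.β₂-up x) ∙ h-up _ ∙ cong DD′.up (f-a x) ∙
      sym (cong B′.β₂ (h-up x) ∙ B′.β₂-up _)))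

  h-commutes : ∀ j p → h (generator (RPMap.map DD.rp) j p) ≡ generator (RPMap.map DD′.rp) j (h p)
  h-commutes = Comparison.h-commutes frameMap (F.not-orientation D.O) (F′.not-orientation D′.O)
    D.mt D′.mt f-t DD.pr DD′.pr (generator (RPMap.map DD.rp)) (generator (RPMap.map DD′.rp))
    (DD.lo DD.root) (DD′.lo DD′.root) h h-pr h-root
    (λ k n → cong not (D.o-first k n)) (λ k n → cong not (D′.o-first k n)) h-G
    (D.W.word-onto (RPMap.conn DD.rp))

-- The mirror argument: now `z` is known to correspond, the map is explored, and `α₀` is the only
-- generator that moves by the twist.
map-injective : ∀ E E′ →
  QuadData.rp (MapToQuad.quadData E) ≅ QuadData.rp (MapToQuad.quadData E′) → MapData.rp E ≅ MapData.rp E′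
map-injective E E′ i = buildMapIso E E′ I.frameIso (h-commutes zero) I.root-f I.point-f
  where
  module I = QuadIso (MapToQuad.quadData E) (MapToQuad.quadData E′) i
  module E = MapToQuad E
  module E′ = MapToQuad E′
  module EE = MapData E
  module EE′ = MapData E′
  module F = Frame EE.frame
  module F′ = Frame EE′.frame
  open I using (f)

  h-G : ∀ j x → f (generator (RPMap.map EE.rp) j x) ≡ generator (RPMap.map EE′.rp) j (f x) ⊎
    (generator (RPMap.map EE.rp) j x ≡ F.twist (not ∘ E.o) E.z x ×
     generator (RPMap.map EE′.rp) j (f x) ≡ F′.twist (not ∘ E′.o) E′.z (f x) ×
     (f (F.twist (not ∘ E.o) E.z x) ≡ F′.twist (not ∘ E′.o) E′.z (f x) →
       f (generator (RPMap.map EE.rp) j x) ≡ generator (RPMap.map EE′.rp) j (f x)))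
  h-G zero x = inj₂ (sym (E.untwist x) , sym (E′.untwist (f x)) ,
    λ c → cong f (sym (E.untwist x)) ∙ c ∙ E′.untwist (f x))
  h-G (suc zero) x = inj₁ (I.f-a x)
  h-G (suc (suc zero)) x = inj₁ (I.f-v x)

  h-commutes : ∀ j x → f (generator (RPMap.map EE.rp) j x) ≡ generator (RPMap.map EE′.rp) j (f x)
  h-commutes = Comparison.h-commutes I.frameMap (F.not-orientation E.O) (F′.not-orientation E′.O)
    E.mz E′.mz I.f-z id id (generator (RPMap.map EE.rp)) (generator (RPMap.map EE′.rp))
    EE.root EE′.root f (λ _ → refl) I.root-f
    (λ k n → cong not (E.o-first k n)) (λ k n → cong not (E′.o-first k n)) h-G
    (E.W.word-onto (RPMap.conn EE.rp))

-- The correspondence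

funToFin-injective : ∀ {m n} (f g : Fin m → Fin n) → funToFin f ≡ funToFin g → ∀ x → f x ≡ g x
funToFin-injective f g eq x = sym (finToFun-funToFin f x) ∙
  cong (λ c → finToFun c x) eq ∙ finToFun-funToFin g x

codeSize : ℕ → ℕ
codeSize N = N ^ N * (N ^ N * (N ^ N * (N * N)))

encodeFlags : ∀ {N} → (α₀ α₁ α₂ : Fin N → Fin N) → Fin N → Fin N → Fin (codeSize N)
encodeFlags α₀ α₁ α₂ r p =
  combine (funToFin α₀) (combine (funToFin α₁) (combine (funToFin α₂) (combine r p)))

encodeFlags-injective : ∀ {N} (α₀ α₁ α₂ β₀ β₁ β₂ : Fin N → Fin N) (r p r′ p′ : Fin N) →
  encodeFlags α₀ α₁ α₂ r p ≡ encodeFlags β₀ β₁ β₂ r′ p′ →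
  (∀ x → α₀ x ≡ β₀ x) × (∀ x → α₁ x ≡ β₁ x) × (∀ x → α₂ x ≡ β₂ x) × r ≡ r′ × p ≡ p′
encodeFlags-injective {N} α₀ α₁ α₂ β₀ β₁ β₂ r p r′ p′ eq =
  let (e₀ , eq₁) = combine-injective (funToFin α₀) _ (funToFin β₀) _ eq
      (e₁ , eq₂) = combine-injective (funToFin α₁) _ (funToFin β₁) _ eq₁
      (e₂ , eq₃) = combine-injective (funToFin α₂) _ (funToFin β₂) _ eq₂
      (er , ep)  = combine-injective r p r′ p′ eq₃
  in funToFin-injective α₀ β₀ e₀ , funToFin-injective α₁ β₁ e₁ , funToFin-injective α₂ β₂ e₂ , er , ep

code : ∀ {N} (A : RPMap) → RPMap.N A ≡ N → Fin (codeSize N)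
code A refl = encodeFlags α₀ α₁ α₂ root point
  where open RPMap A

code-injective : ∀ {N} (A B : RPMap) (p : RPMap.N A ≡ N) (q : RPMap.N B ≡ N) → code A p ≡ code B q → A ≅ B
code-injective A record { map = record { N = _ ; α₀ = α₀ ; α₁ = α₁ ; α₂ = α₂ } ; root = root ; point = point } refl refl eq =
  let (e₀ , e₁ , e₂ , er , ep) = encodeFlags-injective (RPMap.α₀ A) (RPMap.α₁ A) (RPMap.α₂ A) α₀ α₁ α₂
                                   (RPMap.root A) (RPMap.point A) root point eq
  in id , id , (λ _ → refl) , (λ _ → refl) , e₀ , e₁ , e₂ , er , subst (Star _ (RPMap.point A)) ep ε

-- An injective self-map of a finite set has only periodic points, hence is onto; here up to
-- isomorphism, on maps of a given size.
module Recurrence {B : Set} (rp : B → RPMap) (N : ℕ) (size : ∀ b → RPMap.N (rp b) ≡ N)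
  (s : B → B) (s-inj : ∀ b b′ → rp (s b) ≅ rp (s b′) → rp b ≅ rp b′) where

  recurs : ∀ b → ∃[ k ] rp (s (iter s k b)) ≅ rp b
  recurs b with pigeonhole (ℕ.n<1+n (codeSize N)) (λ i → code (rp (iter s (toℕ i) b)) (size _))
  ... | i , j , i<j , eq = toℕ j ∸ suc (toℕ i) ,
    subst (λ c → rp c ≅ rp b) (iter-comm s (toℕ j ∸ suc (toℕ i)) b) (cancel (toℕ i) (suc (toℕ j ∸ suc (toℕ i)))
      (subst (λ k → rp (iter s k b) ≅ rp (iter s (toℕ i) b)) (sym shift)
        (≅-sym {rp (iter s (toℕ i) b)} {rp (iter s (toℕ j) b)} (code-injective _ _ (size _) (size _) eq))))
    where
    shift : toℕ i + suc (toℕ j ∸ suc (toℕ i)) ≡ toℕ j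
    shift = ℕ.+-suc (toℕ i) _ ∙ ℕ.m+[n∸m]≡n i<j
    cancel : ∀ m k → rp (iter s (m + k) b) ≅ rp (iter s m b) → rp (iter s k b) ≅ rp b
    cancel zero    k i = i
    cancel (suc m) k i = cancel m k (s-inj _ _
      (subst₂ (λ c c′ → rp c ≅ rp c′) (iter-comm s (m + k) b) (iter-comm s m b) i))

withRoot : (q : RPMap) → Fin (RPMap.N q) → RPMap
withRoot q r = record { map = RPMap.map q ; conn = RPMap.conn q ; root = r ; point = RPMap.point q }

reroot : ∀ {q q′} (i : q ≅ q′) {r r′} → proj₁ i r ≡ r′ → withRoot q r ≅ withRoot q′ r′
reroot (f , g , gf , fg , f₀ , f₁ , f₂ , _ , p) eq = f , g , gf , fg , f₀ , f₁ , f₂ , eq , p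

-- Phrased by distances alone, so that it makes sense on any rooted pointed map and is invariant
-- under isomorphism.
LowFlag : (q : RPMap) → Fin (RPMap.N q) → Set
LowFlag q x = ∃[ i ] (RPMap.Dist q x (RPMap.point q) i × RPMap.Dist q (RPMap.α₀ q x) (RPMap.point q) (suc i))

lowFlag-asym : ∀ q {x} → LowFlag q x → ¬ LowFlag q (RPMap.α₀ q x)
lowFlag-asym q {x} (i , d , d′) (j , e , e′) = ℕ.m≢1+n+m i {1} (MapFacts.dist-unique (RPMap.map q) d
    (subst (λ y → RPMap.Dist q y (RPMap.point q) (suc j)) (RPMap.inv₀ q x) e′) ∙
  cong suc (MapFacts.dist-unique (RPMap.map q) e d′))

lowFlag-unique : ∀ q {r r′ x} → LowFlag q r → LowFlag q r′ →
  r ≡ x ⊎ r ≡ RPMap.α₀ q x → r′ ≡ x ⊎ r′ ≡ RPMap.α₀ q x → r ≡ r′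
lowFlag-unique q l l′ (inj₁ refl) (inj₁ refl) = refl
lowFlag-unique q l l′ (inj₁ refl) (inj₂ refl) = ⊥-elim (lowFlag-asym q l l′)
lowFlag-unique q l l′ (inj₂ refl) (inj₁ refl) = ⊥-elim (lowFlag-asym q l′ l)
lowFlag-unique q l l′ (inj₂ refl) (inj₂ refl) = refl

lowFlag-iso : ∀ {q q′} (i : q ≅ q′) {x} → LowFlag q x → LowFlag q′ (proj₁ i x)
lowFlag-iso {q} {q′} i {x} (k , d , d′) = k , IsoTransfer.dist {q} {q′} i d ,
  subst (λ y → RPMap.Dist q′ y (RPMap.point q′) (suc k)) (Iso.f₀ {q} {q′} i x) (IsoTransfer.dist {q} {q′} i d′)

root-low : ∀ D → LowFlag (QuadData.rp D) (QuadData.lo D (QuadData.root D))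
root-low D = Frame.ℓ frame root ,
  subst (RPMap.Dist rp (lo root) (lo point)) (Q.label-lo root) (L.isDist _) ,
  subst (RPMap.Dist rp (RPMap.α₀ rp (lo root)) (lo point)) (Q.label-β₀-lo root) (L.isDist _)
  where
  open QuadData D
  module Q = Distances.OnQuad frame matching
  module L = MapFacts.Labelling (Q.labelling pointed)

-- Exactly one of the two orientations of the root edge points away from the pointed vertex.
record LowRooted (q : RPMap) : Set where
  no-eta-equality
  field
    low-root : Fin (RPMap.N q)
    is-low   : LowFlag q low-root
    near     : low-root ≡ RPMap.root q ⊎ low-root ≡ RPMap.α₀ q (RPMap.root q)
    quadData    : QuadData
    reading  : withRoot q low-root ≅ QuadData.rp quadData

opaque
  lowRooted : (q : RPMap) → RPMap.IsQuadrangulation q → RPMap.IsBipartite q → LowRooted q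
  lowRooted q quad bip = choose (R.low? root)
    where
    open RPMap q
    module R = ReadQuad q quad bip
    open DistanceFunction map conn
    open From point
    lowFlag : ∀ {x} → R.Low x → LowFlag q x
    lowFlag {x} l = d x , d-dist x , subst (Dist (α₀ x) point) l (d-dist (α₀ x))
    rooted : ∀ {r} → R.Low r → r ≡ root ⊎ r ≡ α₀ root → LowRooted q
    rooted {r} l nr = record
      { low-root = r ; is-low = lowFlag l ; near = nr
      ; quadData = ReadQuad.quadData (withRoot q r) quad bip l
      ; reading = ReadQuad.isomorphism (withRoot q r) quad bip l }
    choose : Dec (R.Low root) → LowRooted q
    choose (yes l) = rooted l (inj₁ refl)
    choose (no ¬l) = rooted (R.high⇒low ¬l) (inj₂ refl)

record Reading (m : RPMap) : Set where
  no-eta-equality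
  field
    mapData : MapData
    reading : m ≅ MapData.rp mapData

opaque
  readMap : (m : RPMap) → Reading m
  readMap m = record { mapData = ReadMap.mapData m ; reading = ReadMap.isomorphism m }

module Statistics (q : RPMap) (D : QuadData) (i : q ≅ QuadData.rp D) where
  private
    module q = RPMap q
    module D = RPMap (QuadData.rp D)
    module M = RPMap (MapData.rp (QuadToMap.mapData D))
  module T = IsoTransfer {q} {QuadData.rp D} i
  module T⁻ = IsoTransfer {QuadData.rp D} {q} (≅-sym {q} {QuadData.rp D} i)
  module I = Iso {q} {QuadData.rp D} i
  module P = PairStatistics (QuadData.frame D) (QuadData.matching D) (QuadToMap.O D) (QuadData.pointed D)
  open Classes D.SameV (MapFacts.sameV-sym (RPMap.map (QuadData.rp D))) _◅◅_

  extremal⁻ : ∀ {x} → D.Extremal D.point (I.f x) → q.Extremal q.point x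
  extremal⁻ {x} ext = subst (q.Extremal q.point) (I.gf x) (T⁻.extremal {I.f x} ext)

  extremal⁺ : ∀ {y} → q.Extremal q.point (I.g y) → D.Extremal D.point y
  extremal⁺ {y} ext = subst (D.Extremal D.point) (I.fg y) (T.extremal {I.g y} ext)

  layers : ∀ k c → ClassCount q.SameV (λ u → q.Dist u q.point k × ¬ q.Extremal q.point u) c →
    ClassCount M.SameV (λ u → M.Dist u M.point k) c
  layers k c count = P.count-layer (count-forward (T.vertex-classes
    (λ {x} (d , ¬ext) → T.dist d , λ ext → ¬ext (extremal⁻ {x} ext))
    (λ {y} (d , ¬ext) → T.dist⁻ d , λ ext → ¬ext (extremal⁺ {y} ext))) count)

  faces : ∀ k → ClassCount q.SameV (q.Extremal q.point) k → M.NumFaces k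
  faces k count = P.count-extremal (count-forward (T.vertex-classes
    (λ {x} → T.extremal {x}) (λ {y} → T⁻.extremal {y})) count)

record Image (q : RPMap) : Set where
  no-eta-equality
  private module q = RPMap q
  field
    m : RPMap
  private module m = RPMap m
  field
    surface  : ∀ S → OnSurface q.map S → OnSurface m.map S
    numEdges : ∀ {k} → q.NumFaces k → m.NumEdges k
    layers   : ∀ k c → ClassCount q.SameV (λ u → q.Dist u q.point k × ¬ q.Extremal q.point u) c →
               ClassCount m.SameV (λ u → m.Dist u m.point k) c
    faces    : ∀ k → ClassCount q.SameV (q.Extremal q.point) k → m.NumFaces k

opaque
  image : ∀ {q} D → q ≅ QuadData.rp D → Image q
  image {q} D i = record
    { m = MapData.rp (QuadToMap.mapData D)
    ; surface = λ S s → QuadToMap.surface D S (≅-surface {q} {QuadData.rp D} i S s)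
    ; numEdges = λ c → QuadToMap.numEdges D (IsoTransfer.numFaces {q} {QuadData.rp D} i c)
    ; layers = Statistics.layers q D i
    ; faces = Statistics.faces q D i }

  image-respects : ∀ {q q′} D D′ (i : q ≅ QuadData.rp D) (i′ : q′ ≅ QuadData.rp D′) →
    q ≅ q′ → Image.m (image {q} D i) ≅ Image.m (image {q′} D′ i′)
  image-respects {q} {q′} D D′ i i′ j = map-respects D D′
    (≅-trans {QuadData.rp D} {q} {QuadData.rp D′} (≅-sym {q} {QuadData.rp D} i)
      (≅-trans {q} {q′} {QuadData.rp D′} j i′))

  image-injective : ∀ {q q′} D D′ (i : q ≅ QuadData.rp D) (i′ : q′ ≅ QuadData.rp D′) →
    Image.m (image {q} D i) ≅ Image.m (image {q′} D′ i′) → q ≅ q′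
  image-injective {q} {q′} D D′ i i′ j = ≅-trans {q} {QuadData.rp D} {q′} i
    (≅-trans {QuadData.rp D} {QuadData.rp D′} {q′} (quad-injective D D′ j)
      (≅-sym {q′} {QuadData.rp D′} i′))

module Correspondence (S : Surface) (n : ℕ) where

  lowered : (a : PointedQuad S n) → LowRooted (proj₁ a)
  lowered (q , quad , bip , _) = lowRooted q quad bip

  module Low (a : PointedQuad S n) where
    open LowRooted (lowered a) public
    q : RPMap
    q = proj₁ a
    q⁻ : RPMap
    q⁻ = withRoot q low-root
    target : Image q⁻
    target = image {q⁻} quadData reading

  Φ : PointedQuad S n → PointedMap S n
  Φ a@(_ , _ , _ , s , c) = Image.m target , Image.surface target S s , Image.numEdges target c
    where open Low a using (target)

  Φ-respects⁻ : ∀ a a′ → Low.q⁻ a ≅ Low.q⁻ a′ → proj₁ (Φ a) ≅ proj₁ (Φ a′)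
  Φ-respects⁻ a a′ = image-respects {Low.q⁻ a} {Low.q⁻ a′} (Low.quadData a) (Low.quadData a′) (Low.reading a) (Low.reading a′)

  Φ-injective⁻ : ∀ a a′ → proj₁ (Φ a) ≅ proj₁ (Φ a′) → Low.q⁻ a ≅ Low.q⁻ a′
  Φ-injective⁻ a a′ = image-injective {Low.q⁻ a} {Low.q⁻ a′} (Low.quadData a) (Low.quadData a′) (Low.reading a) (Low.reading a′)

  Φ-respects : ∀ a a′ → proj₁ a ≅ proj₁ a′ → proj₁ (Φ a) ≅ proj₁ (Φ a′)
  Φ-respects a a′ i = Φ-respects⁻ a a′ (reroot {A.q} {A′.q} i
    (lowFlag-unique A′.q (lowFlag-iso {A.q} {A′.q} i A.is-low) A′.is-low (moved A.near) A′.near))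
    where
    module A = Low a
    module A′ = Low a′
    module I = Iso {A.q} {A′.q} i
    moved : ∀ {r} → r ≡ RPMap.root A.q ⊎ r ≡ RPMap.α₀ A.q (RPMap.root A.q) →
      I.f r ≡ RPMap.root A′.q ⊎ I.f r ≡ RPMap.α₀ A′.q (RPMap.root A′.q)
    moved (inj₁ refl) = inj₁ I.f-root
    moved (inj₂ refl) = inj₂ (I.f₀ _ ∙ cong (RPMap.α₀ A′.q) I.f-root)

  low-root-≡ : ∀ a → LowFlag (proj₁ a) (RPMap.root (proj₁ a)) → Low.low-root a ≡ RPMap.root (proj₁ a)
  low-root-≡ a l = lowFlag-unique (proj₁ a) (Low.is-low a) l (Low.near a) (inj₁ refl)

  lower-≅ : ∀ a → LowFlag (proj₁ a) (RPMap.root (proj₁ a)) → Low.q⁻ a ≅ proj₁ a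
  lower-≅ a l = reroot {proj₁ a} {proj₁ a} (≅-refl {proj₁ a}) (low-root-≡ a l)

  module Read (b : PointedMap S n) where
    open Reading (readMap (proj₁ b)) public renaming (mapData to E)
    D : QuadData
    D = MapToQuad.quadData E

  opaque
    Ψ : PointedMap S n → PointedQuad S n
    Ψ b@(m , s , c) = QuadData.rp D , MapToQuad.quadrangulation E , MapToQuad.bipartite E ,
      MapToQuad.surface E S (≅-surface {m} {MapData.rp E} reading S s) ,
      MapToQuad.numFaces E (IsoTransfer.numEdges {m} {MapData.rp E} reading c)
      where open Read b

    Ψ-low : ∀ b → LowFlag (proj₁ (Ψ b)) (RPMap.root (proj₁ (Ψ b)))
    Ψ-low b = root-low (Read.D b)

    Ψ-injective : ∀ b b′ → proj₁ (Ψ b) ≅ proj₁ (Ψ b′) → proj₁ b ≅ proj₁ b′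
    Ψ-injective b b′ i = ≅-trans {proj₁ b} {MapData.rp B.E} {proj₁ b′} B.reading
      (≅-trans {MapData.rp B.E} {MapData.rp B′.E} {proj₁ b′} (map-injective B.E B′.E i)
        (≅-sym {proj₁ b′} {MapData.rp B′.E} B′.reading))
      where
      module B = Read b
      module B′ = Read b′

  -- `Ψ` yields quadrangulations already rooted at a low flag, where lowering the root inside `Φ`
  -- changes nothing; the two injectivity results then compose.
  ΦΨ-injective : ∀ b b′ → proj₁ (Φ (Ψ b)) ≅ proj₁ (Φ (Ψ b′)) → proj₁ b ≅ proj₁ b′
  ΦΨ-injective b b′ i = Ψ-injective b b′
    (≅-trans {q} {Low.q⁻ (Ψ b)} {q′} (≅-sym {Low.q⁻ (Ψ b)} {q} (lower-≅ (Ψ b) (Ψ-low b)))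
      (≅-trans {Low.q⁻ (Ψ b)} {Low.q⁻ (Ψ b′)} {q′} (Φ-injective⁻ (Ψ b) (Ψ b′) i)
        (lower-≅ (Ψ b′) (Ψ-low b′))))
    where
    q : RPMap
    q = proj₁ (Ψ b)
    q′ : RPMap
    q′ = proj₁ (Ψ b′)

  private
    module R = Recurrence {PointedMap S n} proj₁ (n * 4)
      (λ (m , _ , c) → EdgeFlags.edges*4 (RPMap.map m) c) (λ b → Φ (Ψ b)) ΦΨ-injective

  Preimage : PointedMap S n → Set
  Preimage b = Σ[ a ∈ PointedQuad S n ] (LowFlag (proj₁ a) (RPMap.root (proj₁ a)) × proj₁ (Φ a) ≅ proj₁ b)

  -- Iterating `Φ ∘ Ψ` from `b` comes back to the class of `b`; the last iterate before the return
  -- supplies the preimage.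
  preimage : ∀ b → Preimage b
  preimage b = Ψ b′ , Ψ-low b′ , proj₂ (R.recurs b)
    where
    b′ : PointedMap S n
    b′ = iter (λ b → Φ (Ψ b)) (proj₁ (R.recurs b)) b

  flip : PointedQuad S n → PointedQuad S n
  flip (q , props) = withRoot q (RPMap.α₀ q (RPMap.root q)) , props

  flip-near : ∀ q {r} → r ≡ RPMap.α₀ q (RPMap.root q) ⊎ r ≡ RPMap.α₀ q (RPMap.α₀ q (RPMap.root q)) →
    r ≡ RPMap.root q ⊎ r ≡ RPMap.α₀ q (RPMap.root q)
  flip-near q (inj₁ eq) = inj₂ eq
  flip-near q (inj₂ eq) = inj₁ (eq ∙ RPMap.inv₀ q _)

  two-to-one : TwoToOne (λ (a a′ : PointedQuad S n) → proj₁ a ≅ proj₁ a′)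
                        (λ (b b′ : PointedMap S n) → proj₁ b ≅ proj₁ b′) Φ
  two-to-one = Φ-respects , λ b → fibre b (preimage b)
    where
    fibre : ∀ b → Preimage b → Σ[ a₁ ∈ PointedQuad S n ] Σ[ a₂ ∈ PointedQuad S n ]
      (proj₁ (Φ a₁) ≅ proj₁ b × proj₁ (Φ a₂) ≅ proj₁ b × ¬ proj₁ a₁ ≅ proj₁ a₂ ×
       (∀ a → proj₁ (Φ a) ≅ proj₁ b → proj₁ a ≅ proj₁ a₁ ⊎ proj₁ a ≅ proj₁ a₂))
    fibre b (a₁ , l , i) = a₁ , flip a₁ , i ,
      ≅-trans {proj₁ (Φ (flip a₁))} {proj₁ (Φ a₁)} {proj₁ b} flipped i ,
      -- An isomorphism would make both ends of the root edge low.
      (λ j → lowFlag-asym q₁ l (subst (LowFlag q₁) (Iso.f-root {q₁} {proj₁ (flip a₁)} j)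
        (lowFlag-iso {q₁} {proj₁ (flip a₁)} j l))) ,
      -- With lowered roots any two preimages are isomorphic; what remains is the end of the root
      -- edge at which `a` was rooted.
      λ a j → classify a (Low.near a) (Φ-injective⁻ a a₁
        (≅-trans {proj₁ (Φ a)} {proj₁ b} {proj₁ (Φ a₁)} j (≅-sym {proj₁ (Φ a₁)} {proj₁ b} i)))
      where
      q₁ : RPMap
      q₁ = proj₁ a₁
      flipped : proj₁ (Φ (flip a₁)) ≅ proj₁ (Φ a₁)
      flipped = Φ-respects⁻ (flip a₁) a₁ (reroot {q₁} {q₁} (≅-refl {q₁})
        (lowFlag-unique q₁ (Low.is-low (flip a₁)) (Low.is-low a₁) (flip-near q₁ (Low.near (flip a₁))) (Low.near a₁)))
      classify : ∀ a → Low.low-root a ≡ RPMap.root (proj₁ a) ⊎ Low.low-root a ≡ RPMap.α₀ (proj₁ a) (RPMap.root (proj₁ a)) →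
        Low.q⁻ a ≅ Low.q⁻ a₁ → proj₁ a ≅ q₁ ⊎ proj₁ a ≅ proj₁ (flip a₁)
      classify a (inj₁ e) j = inj₁ (reroot {Low.q⁻ a} {Low.q⁻ a₁} j
        (cong (proj₁ j) (sym e) ∙ Iso.f-root {Low.q⁻ a} {Low.q⁻ a₁} j ∙ low-root-≡ a₁ l))
      classify a (inj₂ e) j = inj₂ (reroot {Low.q⁻ a} {Low.q⁻ a₁} j
        (cong (proj₁ j) (sym (RPMap.inv₀ (proj₁ a) _) ∙ cong (RPMap.α₀ (proj₁ a)) (sym e)) ∙
          Iso.f₀ {Low.q⁻ a} {Low.q⁻ a₁} j _ ∙
            cong (RPMap.α₀ q₁) (Iso.f-root {Low.q⁻ a} {Low.q⁻ a₁} j ∙ low-root-≡ a₁ l)))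

theorem5p13 : (S : Surface) (n : ℕ) → 1 ≤ n →
  Σ[ Φ ∈ (PointedQuad S n → PointedMap S n) ]
    (TwoToOne (λ q q' → proj₁ q ≅ proj₁ q') (λ m m' → proj₁ m ≅ proj₁ m') Φ ×
     (∀ (q : PointedQuad S n) →
        let Q = proj₁ q
            M = proj₁ (Φ q)
        in
        (∀ (i c : ℕ) → 1 ≤ i →
           ClassCount (RPMap.SameV Q)
             (λ u → RPMap.Dist Q u (RPMap.point Q) i × ¬ RPMap.Extremal Q (RPMap.point Q) u) c →
           ClassCount (RPMap.SameV M) (λ u → RPMap.Dist M u (RPMap.point M) i) c) ×
        (∀ (k : ℕ) →
           ClassCount (RPMap.SameV Q) (RPMap.Extremal Q (RPMap.point Q)) k →
           RPMap.NumFaces M k)))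
theorem5p13 S n _ = Φ , two-to-one , λ a →
    (λ i c _ → Image.layers (Low.target a) i c) , Image.faces (Low.target a)
  where open Correspondence S n
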